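{- Let $C$ be a smooth projective curve of genus $2$ defined over $\mathbb{Q}$ which has exactly two $\mathbb{Q}$-rational Weierstrass points and a quadratic Weierstrass point. If $C$ is described by a globally minimal Weierstrass equation of the form $E: y^2+Q(x)y=P(x)$ with $P,Q\in\mathbb{Z}[x]$, $\deg Q(x)\le 2$ and $P(x)$ monic of degree $5$, then $|\Delta_E|$ is never an odd prime.
   Context: For a Weierstrass equation $E: y^2+Q(x)y=P(x)$ of a genus $2$ curve over $\mathbb{Q}$, its discriminant is $\Delta_E=2^{ -12}\operatorname{disc}(4P(x)+Q(x)^2)$. An integral Weierstrass equation (coefficients in $\mathbb{Z}$) is minimal at a prime $p$ if the $p$-adic valuation of its discriminant is smallest among all integral Weierstrass equations over $\mathbb{Z}_p$ describing the curve, and globally minimal if it is minimal at every prime. A Weierstrass point is a fixed point of the hyperelliptic involution; a quadratic Weierstrass point is one whose field of definition is a quadratic extension of $\mathbb{Q}$. -}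

module Defs where

open import Data.Nat as ℕ using (ℕ; zero; suc; _∸_; _≤ᵇ_)
open import Data.Nat.Divisibility using (_∣_)
open import Data.Integer as ℤ using (ℤ; +_)
open import Data.Rational using (ℚ; 0ℚ; 1ℚ; _+_; _*_; -_; _-_; _/_; ↧ₙ_)
open import Data.Fin using (Fin; toℕ; punchIn)
import Data.Fin as Fin
open import Data.Vec using (Vec; lookup; _∷_; []; map; _++_)
open import Data.Bool using (Bool; true; false; if_then_else_; _∧_)
open import Data.Product using (Σ; _×_; _,_; ∃)
open import Data.Empty using (⊥)
open import Relation.Nullary using (¬_)
open import Relation.Binary.PropositionalEquality using (_≡_; _≢_)

ℕ→ℚ : ℕ → ℚ
ℕ→ℚ n = (+ n) / 1

ℤ→ℚ : ℤ → ℚ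
ℤ→ℚ z = z / 1

_^_ : ℚ → ℕ → ℚ
x ^ zero = 1ℚ
x ^ suc n = x * (x ^ n)

sumBelow : ℕ → (ℕ → ℚ) → ℚ
sumBelow zero    g = 0ℚ
sumBelow (suc n) g = sumBelow n g + g n

sumFin : ∀ n → (Fin n → ℚ) → ℚ
sumFin zero    g = 0ℚ
sumFin (suc n) g = g Fin.zero + sumFin n (λ i → g (Fin.suc i))

-- Polynomials over ℚ, represented by their coefficient functions
-- (coefficient of x^i at i; only finitely many are nonzero in all uses)

Poly : Set
Poly = ℕ → ℚ

vcoeff : ∀ {n} → Vec ℚ n → Poly
vcoeff {zero}  []       i       = 0ℚ
vcoeff {suc n} (a ∷ as) zero    = a
vcoeff {suc n} (a ∷ as) (suc i) = vcoeff as i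

_⊕_ : Poly → Poly → Poly
(f ⊕ g) i = f i + g i

scale : ℚ → Poly → Poly
scale c f i = c * f i

_⊗_ : Poly → Poly → Poly
(f ⊗ g) k = sumBelow (suc k) (λ i → f i * g (k ∸ i))

constP : ℚ → Poly
constP c zero    = c
constP c (suc i) = 0ℚ

_⊗^_ : Poly → ℕ → Poly
f ⊗^ zero  = constP 1ℚ
f ⊗^ suc n = f ⊗ (f ⊗^ n)

sumPoly : ℕ → (ℕ → Poly) → Poly
sumPoly zero    g = constP 0ℚ
sumPoly (suc n) g = sumPoly n g ⊕ g n

lin : ℚ → ℚ → Poly
lin a b zero          = b
lin a b (suc zero)    = a
lin a b (suc (suc i)) = 0ℚ

-- (c x + d)^n f((a x + b)/(c x + d)), f regarded as a form of degree n
homog : ℕ → Poly → ℚ → ℚ → ℚ → ℚ → Poly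
homog n f a b c d =
  sumPoly (suc n) (λ i → scale (f i) ((lin a b ⊗^ i) ⊗ (lin c d ⊗^ (n ∸ i))))

evalP : ℕ → Poly → ℚ → ℚ
evalP n f x = sumBelow (suc n) (λ i → f i * (x ^ i))

det : ∀ n → (Fin n → Fin n → ℚ) → ℚ
det zero    M = 1ℚ
det (suc n) M = sumFin (suc n) (λ j →
  (sgn (toℕ j) * M Fin.zero j) * det n (λ r c → M (Fin.suc r) (punchIn j c)))
  where
  sgn : ℕ → ℚ
  sgn zero          = 1ℚ
  sgn (suc zero)    = - 1ℚ
  sgn (suc (suc k)) = sgn k

-- Discriminant of a binary form of degree n ≥ 2 with coefficients
-- a 0, ..., a n (a n may vanish).  It is (-1)^(n(n-1)/2) Res(f,f')/a_n;
-- the Sylvester matrix is reduced (row_{n-1} := row_{n-1} - n row_0 and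
-- expansion along the first column removes the factor a_n), giving the
-- (2n-2)×(2n-2) matrix below, whose determinant is a polynomial in the a_i.

discMat : (n : ℕ) → Poly → ℕ → ℕ → ℚ
discMat n a r c =
  if suc r ≤ᵇ (n ∸ 2) then
    (if (r ≤ᵇ c) ∧ ((c ∸ r) ≤ᵇ n) then a (n ∸ (c ∸ r)) else 0ℚ)
  else if r ≤ᵇ (n ∸ 2) then
    (if suc c ≤ᵇ n then - (ℕ→ℚ (suc c) * a (n ∸ suc c)) else 0ℚ)
  else
    (if (r ≤ᵇ (c ℕ.+ (n ∸ 1))) ∧ (((c ℕ.+ (n ∸ 1)) ∸ r) ≤ᵇ (n ∸ 1))
     then ℕ→ℚ (n ∸ ((c ℕ.+ (n ∸ 1)) ∸ r)) * a (n ∸ ((c ℕ.+ (n ∸ 1)) ∸ r))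
     else 0ℚ)

signQ : ℕ → ℚ
signQ zero          = 1ℚ
signQ (suc zero)    = - 1ℚ
signQ (suc (suc k)) = signQ k

discForm : ℕ → Poly → ℚ
discForm n a =
  signQ ((n ℕ.* (n ∸ 1)) ℕ./ 2) *
  det ((n ∸ 1) ℕ.+ (n ∸ 1)) (λ r c → discMat n a (toℕ r) (toℕ c))

-- Genus 2 Weierstrass equations  y^2 + Q(x) y = P(x)
-- with deg P ≤ 6, deg Q ≤ 3 (coefficients in ℚ; entry i = coeff of x^i)

record WEq : Set where
  constructor weq
  field
    P : Vec ℚ 7
    Q : Vec ℚ 4
open WEq public

Pp Qp : WEq → Poly
Pp E = vcoeff (P E)
Qp E = vcoeff (Q E)

Fp : WEq → Poly
Fp E = scale (ℕ→ℚ 4) (Pp E) ⊕ (Qp E ⊗ Qp E)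

Δ : WEq → ℚ
Δ E = discForm 6 (Fp E) * ((+ 1) / 4096)

fromℤ : Vec ℤ 7 → Vec ℤ 4 → WEq
fromℤ p q = weq (map ℤ→ℚ p) (map ℤ→ℚ q)

-- Points of the smooth projective model (in weighted projective space
-- P(1,3,1)): affine points (x , y), and points at infinity [1 : y : 0],
-- which satisfy y^2 + q3 y = p6.
-- The hyperelliptic involution is (x , y) ↦ (x , - y - Q(x)) and
-- [1 : y : 0] ↦ [1 : - y - q3 : 0].

data Pt : Set where
  aff : ℚ → ℚ → Pt
  inf : ℚ → Pt

OnCurve : WEq → Pt → Set
OnCurve E (aff x y) = y * y + evalP 3 (Qp E) x * y ≡ evalP 6 (Pp E) x
OnCurve E (inf y)   = y * y + Qp E 3 * y ≡ Pp E 6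

ι : WEq → Pt → Pt
ι E (aff x y) = aff x (- y - evalP 3 (Qp E) x)
ι E (inf y)   = inf (- y - Qp E 3)

RatWP : WEq → Pt → Set
RatWP E pt = OnCurve E pt × ι E pt ≡ pt

-- Arithmetic in ℚ(√d): the pair (r , s) stands for r + s √d
Qd : Set
Qd = ℚ × ℚ

module QuadArith (d : ℚ) where
  _+d_ : Qd → Qd → Qd
  (r₁ , s₁) +d (r₂ , s₂) = (r₁ + r₂ , s₁ + s₂)

  _*d_ : Qd → Qd → Qd
  (r₁ , s₁) *d (r₂ , s₂) = (r₁ * r₂ + d * (s₁ * s₂) , r₁ * s₂ + s₁ * r₂)

  negd : Qd → Qd
  negd (r , s) = (- r , - s)

  emb : ℚ → Qd
  emb r = (r , 0ℚ)

  powd : Qd → ℕ → Qd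
  powd x zero    = emb 1ℚ
  powd x (suc n) = x *d powd x n

  evald : ℕ → Poly → Qd → Qd
  evald zero    f x = emb (f 0)
  evald (suc n) f x = evald n f x +d (emb (f (suc n)) *d powd x (suc n))

data PtQd : Set where
  affd : Qd → Qd → PtQd
  infd : Qd → PtQd

module _ (d : ℚ) where
  open QuadArith d

  OnCurveQd : WEq → PtQd → Set
  OnCurveQd E (affd x y) =
    (y *d y) +d (evald 3 (Qp E) x *d y) ≡ evald 6 (Pp E) x
  OnCurveQd E (infd y) = (y *d y) +d (emb (Qp E 3) *d y) ≡ emb (Pp E 6)

  ιQd : WEq → PtQd → PtQd
  ιQd E (affd x y) = affd x (negd y +d negd (evald 3 (Qp E) x))
  ιQd E (infd y)   = infd (negd y +d negd (emb (Qp E 3)))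

  WPQd : WEq → PtQd → Set
  WPQd E pt = OnCurveQd E pt × ιQd E pt ≡ pt

NotRational : PtQd → Set
NotRational (affd (_ , s) (_ , t)) = ¬ (s ≡ 0ℚ × t ≡ 0ℚ)
NotRational (infd (_ , t))         = ¬ (t ≡ 0ℚ)

NonSquare : ℚ → Set
NonSquare d = ∀ q → q * q ≢ d

-- E has a Weierstrass point whose field of definition is a quadratic
-- extension of ℚ: it is defined over ℚ(√d) for a non-square d and is not
-- rational (hence its field of definition is exactly ℚ(√d)).
HasQuadraticWP : WEq → Set
HasQuadraticWP E =
  Σ ℚ λ d → NonSquare d × Σ PtQd λ pt → WPQd d E pt × NotRational pt

ExactlyTwoRatWP : WEq → Set
ExactlyTwoRatWP E =
  Σ Pt λ w₁ → Σ Pt λ w₂ → w₁ ≢ w₂ × RatWP E w₁ × RatWP E w₂ ×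
    (∀ w → RatWP E w → (w ≡ w₁) ⊎' (w ≡ w₂))
  where
  open import Data.Sum renaming (_⊎_ to _⊎'_)

-- Changes of Weierstrass equation:
--   x = (a x' + b)/(c x' + d),  y = (e y' + H(x'))/(c x' + d)^3,
-- a d - b c ≠ 0, e ≠ 0, deg H ≤ 3.  The new equation y'^2 + Q' y' = P' is
--   e Q' = 2H + Q~,   e^2 P' = P~ - Q~ H - H^2,
-- where Q~ = (c x'+d)^3 Q(..), P~ = (c x'+d)^6 P(..).

IsTransform : WEq → WEq → Set
IsTransform E E' =
  Σ ℚ λ a → Σ ℚ λ b → Σ ℚ λ c → Σ ℚ λ d → Σ ℚ λ e → Σ (Vec ℚ 4) λ H →
    (a * d - b * c ≢ 0ℚ) × (e ≢ 0ℚ) ×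
    (∀ i → e * Qp E' i ≡ (scale (ℕ→ℚ 2) (vcoeff H) ⊕ Qt a b c d) i) ×
    (∀ i → (e * e) * Pp E' i ≡
       (homog 6 (Pp E) a b c d ⊕
         scale (- 1ℚ) ((Qt a b c d ⊗ vcoeff H) ⊕ (vcoeff H ⊗ vcoeff H))) i)
  where
  Qt : ℚ → ℚ → ℚ → ℚ → Poly
  Qt a b c d = homog 3 (Qp E) a b c d

PIntegral : ℕ → ℚ → Set
PIntegral p q = ¬ (p ∣ ↧ₙ q)

IntegralAt : ℕ → WEq → Set
IntegralAt p E = (∀ i → PIntegral p (Pp E i)) × (∀ i → PIntegral p (Qp E i))

-- minimal at p: every p-integral equation of the same curve has
-- v_p(Δ') ≥ v_p(Δ_E), i.e. Δ' = r Δ_E with r p-integral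
MinimalAt : ℕ → WEq → Set
MinimalAt p E =
  ∀ E' → IsTransform E E' → IntegralAt p E' →
    Σ ℚ λ r → PIntegral p r × Δ E' ≡ r * Δ E

GloballyMinimal : WEq → Set
GloballyMinimal E = ∀ p → Prime p → MinimalAt p E
  where open import Data.Nat.Primality using (Prime)

{-# OPTIONS --safe #-}

-- Since P is monic of degree 5, the point at infinity is one rational Weierstrass point, so
-- F = 4P + Q² has exactly one rational root, and the quadratic Weierstrass point makes F a product
-- l f g of a linear and two quadratic polynomials.  By Gauss's lemma the factors may be taken
-- integral, with leading coefficients α, w, w′ of product 4, and then
--   2⁸ |Δ| = |disc f · disc g| · (Res(f, g) Res(l, f) Res(l, g))².
-- If |Δ| = ℓ is an odd prime, one of the two discriminants is therefore ± a power of 2, and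
-- neither is a square because F has no further rational root.  Comparing F with Q² modulo 4 in each
-- of the cases (4,1,1), (1,4,1), (2,2,1), (1,2,2) for (α, w, w′) gives a contradiction: if the leading
-- coefficient of Q is even, the right-hand side is divisible by 2⁹; if it is odd, the possible
-- discriminants are ±1, 0, 2 or - 4ⁿ, and these are excluded one by one.
module Submission where

open import Data.Empty using (⊥; ⊥-elim)
open import Data.Fin as Fin using (Fin; #_; toℕ; fromℕ<; punchIn)
open import Data.Integer as ℤ using (ℤ; +_; -[1+_])
import Data.Integer.Properties as ℤ
open import Data.Integer.Tactic.RingSolver using (ring; solve-∀)
open import Data.Nat as ℕ using (ℕ; zero; suc; _∸_; _≤ᵇ_)
import Data.Nat.Divisibility as ℕ
open import Data.Nat.Primality using (Prime; prime?; prime⇒irreducible; prime⇒nonZero; euclidsLemma; ¬prime[1])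
import Data.Nat.Properties as ℕ
import Data.Nat.Tactic.RingSolver as ℕSolver
open import Data.Product using (Σ; _×_; _,_; ∃; ∃-syntax; proj₁; proj₂)
open import Data.Rational as ℚ using (ℚ; 0ℚ; 1ℚ)
import Data.Rational.Properties as ℚ
open import Data.Sum using (_⊎_; inj₁; inj₂)
open import Data.Vec as Vec using (Vec; []; _∷_; lookup)
open import Data.Vec.Properties using (lookup-map)
open import Relation.Binary.PropositionalEquality hiding ([_])
open import Relation.Nullary using (¬_; yes; no; contradiction; _→-dec_)
open import Relation.Nullary.Decidable using (from-yes; from-no; isYes; toWitness; fromWitness)
open import Tactic.RingSolver.Core.AlmostCommutativeRing
  using (AlmostCommutativeRing; fromCommutativeRing; module AlmostCommutativeRing)
open import Tactic.RingSolver.Core.Polynomial.Parameters using (Homomorphism)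
open import Tactic.RingSolver.NonReflective ring
  using (Expr; Κ; Ι; _⊛_; module Ops; module Eval) renaming (_⊕_ to _:+_; _⊗_ to _:*_; ⊝_ to :-_)
open Ops using (⟦_⟧; norm)

-- The prime `ℓ` occurs to the first power only, so it cannot divide the squared resultants; it is
-- absorbed by one of the two discriminants, and everything else divides 256. When `q₂` is even,
-- which (2,2,1) and (1,2,2) force, the congruence F ≡ Q² modulo 4 makes each of the three factors
-- divisible by its own leading coefficient. Pulling these contents out of the resultants puts at
-- least 2⁵ into their product, and its square 2¹⁰ is more than 2⁸ ℓ allows. When `q₂` is odd, the
-- case (4,1,1) rests on (β - 2u)² = Res(l, f) + 4 disc f: once Res(l, f) = 1 is known, disc f is a
-- product of two consecutive integers. In the case (1,4,1), disc f is 1 modulo 4 and takes up `ℓ`,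
-- so disc g is minus a square and g = (x + c)² + τ²; the bound on the resultants leaves τ² = 1,
-- which is impossible modulo 4. The congruences are decided by running through residues. This is
-- feasible for about six variables, hence the preliminary elimination of the others by explicit
-- linear combinations.

-- Symbolic coefficients, discriminants and resultants of the factors

module Forms where
  -- Assertions about values are kept in the form ⟦ e ⟧ ρ with e a named expression: integer
  -- multiplication of open terms unfolds, so comparing expanded values by conversion is infeasible.
  infixl 6 _:-_
  infixr 8 _·_
  _:-_ : ∀ {n} → Expr ℤ n → Expr ℤ n → Expr ℤ n
  e :- f = e :+ :- f

  _·_ : ∀ {n} → ℕ → Expr ℤ n → Expr ℤ n
  k · e = Κ (+ k) :* e

  sumE : ∀ {n} → ℕ → (ℕ → Expr ℤ n) → Expr ℤ n
  sumE zero    g = Κ (+ 0)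
  sumE (suc n) g = sumE n g :+ g n

  coeffE : ∀ {m n} → Vec (Expr ℤ m) n → ℕ → Expr ℤ m
  coeffE []       i       = Κ (+ 0)
  coeffE (a ∷ as) zero    = a
  coeffE (a ∷ as) (suc i) = coeffE as i

  convE : ∀ {n} → (ℕ → Expr ℤ n) → (ℕ → Expr ℤ n) → ℕ → Expr ℤ n
  convE f g k = sumE (suc k) (λ i → f i :* g (k ∸ i))

  -- The coefficients of l = α x + β, f = w x² + u x + v, g = w′ x² + u′ x + v′ and Q = q₂ x² + q₁ x + q₀.
  -- Below, prodC k and squareC k are the coefficients of xᵏ in l f g and Q², and val, val′, res are
  -- Res(l, f), Res(l, g), Res(f, g).
  β α v u w v′ u′ w′ q₀ q₁ q₂ : Expr ℤ 11
  β  = Ι (# 0)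
  α  = Ι (# 1)
  v  = Ι (# 2)
  u  = Ι (# 3)
  w  = Ι (# 4)
  v′ = Ι (# 5)
  u′ = Ι (# 6)
  w′ = Ι (# 7)
  q₀ = Ι (# 8)
  q₁ = Ι (# 9)
  q₂ = Ι (# 10)

  linC quadC quadC′ sqrtC : ℕ → Expr ℤ 11
  linC   = coeffE (β ∷ α ∷ [])
  quadC  = coeffE (v ∷ u ∷ w ∷ [])
  quadC′ = coeffE (v′ ∷ u′ ∷ w′ ∷ [])
  sqrtC  = coeffE (q₀ ∷ q₁ ∷ q₂ ∷ [])

  prodC squareC : ℕ → Expr ℤ 11
  prodC   = convE (convE linC quadC) quadC′
  squareC = convE sqrtC sqrtC

  disc disc′ val val′ res mixed : Expr ℤ 11
  disc  = u :* u :- 4 · (w :* v)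
  disc′ = u′ :* u′ :- 4 · (w′ :* v′)
  val   = w :* (β :* β) :- u :* (β :* α) :+ v :* (α :* α)
  val′  = w′ :* (β :* β) :- u′ :* (β :* α) :+ v′ :* (α :* α)
  res   = (w :* v′ :- w′ :* v) :* (w :* v′ :- w′ :* v) :- (w :* u′ :- w′ :* u) :* (u :* v′ :- u′ :* v)
  mixed = res :* (val :* val′)

-- Congruences modulo 4 by exhaustive search, and polynomial identities by normal forms

module Congruence where
  open import Data.List as List using (List; []; _∷_)
  open import Data.List.Relation.Unary.All as All using (All; []; _∷_)
  open import Data.Integer using (-_; _+_; _*_; _-_; ∣_∣)
  open import Algebra.Properties.Semiring.Exp.TCOptimised (AlmostCommutativeRing.semiring ring) using () renaming (_^_ to _^′_)
  open import Data.Bool using (Bool; true; T; if_then_else_)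
  open import Data.Bool.ListAction using (all)
  open import Data.Integer.DivMod using (_%ℕ_; _/ℕ_; a≡a%ℕn+[a/ℕn]*n; n%ℕd<d)
  open import Data.Integer.Divisibility.Signed
  open import Data.List.Membership.Propositional.Properties using (∈-upTo⁺)
  open import Data.List.Relation.Unary.All.Properties using (all⁺; all⁻)
  open import Data.Vec.Relation.Binary.Pointwise.Inductive as PW using (Pointwise; []; _∷_)
  open Ops using (correct)
  open import Data.Integer.Properties using (pos-*)
  open import Data.Nat.Divisibility using (n∣m⇒m%n≡0; m%n≡0⇒n∣m)
  open import Data.Nat.Properties using (*-comm; *-identityʳ; ≡⇒≡ᵇ; ≡ᵇ⇒≡)

  infix 4 _≈₄_
  record _≈₄_ (x y : ℤ) : Set where
    constructor congruent
    field 4∣diff : + 4 ∣ x - y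
  open _≈₄_

  +-≈ : ∀ {a b c d} → a ≈₄ b → c ≈₄ d → (a + c) ≈₄ (b + d)
  +-≈ {a} {b} {c} {d} (congruent p) (congruent q) =
    congruent (subst (+ 4 ∣_) (eq a b c d) (∣m∣n⇒∣m+n p q))
    where
    eq : ∀ a b c d → (a - b) + (c - d) ≡ (a + c) - (b + d)
    eq = solve-∀

  *-≈ : ∀ {a b c d} → a ≈₄ b → c ≈₄ d → (a * c) ≈₄ (b * d)
  *-≈ {a} {b} {c} {d} (congruent p) (congruent q) =
    congruent (subst (+ 4 ∣_) (eq a b c d) (∣m∣n⇒∣m+n (∣m⇒∣m*n c p) (∣m⇒∣m*n b q)))
    where
    eq : ∀ a b c d → (a - b) * c + (c - d) * b ≡ a * c - b * d
    eq = solve-∀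

  -- Modulo 4 the negation is multiplication by 3, so that residues are computed in ℕ.
  ⟦_⟧₄ : ∀ {n} → Expr ℤ n → Vec ℕ n → ℕ
  ⟦ Κ x   ⟧₄ ρ = x %ℕ 4
  ⟦ Ι i   ⟧₄ ρ = Vec.lookup ρ i
  ⟦ e :+ f ⟧₄ ρ = ⟦ e ⟧₄ ρ ℕ.+ ⟦ f ⟧₄ ρ
  ⟦ e :* f ⟧₄ ρ = ⟦ e ⟧₄ ρ ℕ.* ⟦ f ⟧₄ ρ
  ⟦ e ⊛ n ⟧₄ ρ = ⟦ e ⟧₄ ρ ℕ.^ n
  ⟦ :- e   ⟧₄ ρ = 3 ℕ.* ⟦ e ⟧₄ ρ

  residue : ∀ x → x ≈₄ + (x %ℕ 4)
  residue x = congruent (divides (x /ℕ 4) (eq x _ _ (a≡a%ℕn+[a/ℕn]*n x 4)))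
    where
    eq : ∀ x r q → x ≡ r + q → x - r ≡ q
    eq x r q refl = lem r q
      where
      lem : ∀ r q → r + q - r ≡ q
      lem = solve-∀

  neg-≈ : ∀ {a b} → a ≈₄ + b → (- a) ≈₄ + (3 ℕ.* b)
  neg-≈ {a} {b} (congruent p) =
    congruent (subst (+ 4 ∣_) (trans (eq a (+ b)) (cong (λ c → - a - c) (sym (pos-* 3 b))))
      (∣m∣n⇒∣m+n (∣m⇒∣-m p) (divides (- + b) (eq′ (+ b)))))
    where
    eq : ∀ a b → - (a - b) + - (+ 4 * b) ≡ - a - + 3 * b
    eq = solve-∀
    eq′ : ∀ b → - (+ 4 * b) ≡ - b * + 4
    eq′ = solve-∀

  ^-≈ : ∀ {a b} n → a ≈₄ + b → (a ^′ n) ≈₄ + (b ℕ.^ n)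
  ^-≈         zero          p = residue (+ 1)
  ^-≈ {b = b} (suc zero)    p = subst (λ c → _ ≈₄ + c) (sym (*-identityʳ b)) p
  ^-≈ {b = b} (suc (suc n)) p =
    subst (λ c → _ ≈₄ c) (trans (sym (pos-* (b ℕ.^ suc n) b)) (cong +_ (*-comm (b ℕ.^ suc n) b)))
      (*-≈ (^-≈ (suc n) p) p)

  ⟦⟧-≈ : ∀ {n} (e : Expr ℤ n) {ρ σ} → Pointwise (λ x r → x ≈₄ + r) ρ σ → ⟦ e ⟧ ρ ≈₄ + ⟦ e ⟧₄ σ
  ⟦⟧-≈ (Κ x)   p = residue x
  ⟦⟧-≈ (Ι i)   p = PW.lookup p i
  ⟦⟧-≈ (e :+ f) p = +-≈ (⟦⟧-≈ e p) (⟦⟧-≈ f p)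
  ⟦⟧-≈ (e :* f) p = subst (λ c → _ ≈₄ c) (sym (pos-* (⟦ e ⟧₄ _) (⟦ f ⟧₄ _))) (*-≈ (⟦⟧-≈ e p) (⟦⟧-≈ f p))
  ⟦⟧-≈ (e ⊛ n) p = ^-≈ n (⟦⟧-≈ e p)
  ⟦⟧-≈ (:- e)   p = neg-≈ (⟦⟧-≈ e p)

  search : ∀ n → (Vec ℕ n → Bool) → Bool
  search zero    f = f []
  search (suc n) f = all (λ r → search n (λ ρ → f (r ∷ ρ))) (List.upTo 4)

  search-sound : ∀ {n} (f : Vec ℕ n → Bool) → T (search n f) →
                 (ρ : Vec ℤ n) → ∃ λ σ → Pointwise (λ x r → x ≈₄ + r) ρ σ × T (f σ)
  search-sound f t []      = [] , [] , t
  search-sound f t (x ∷ ρ) with search-sound (λ ρ → f (x %ℕ 4 ∷ ρ))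
    (All.lookup (all⁺ (λ r → search _ (λ ρ → f (r ∷ ρ))) (List.upTo 4) t) (∈-upTo⁺ (n%ℕd<d x 4))) ρ
  ... | σ , ρ≈σ , ok = x %ℕ 4 ∷ σ , residue x ∷ ρ≈σ , ok

  test : ∀ {n} → List (Expr ℤ n) → List (Expr ℤ n) → Vec ℕ n → Bool
  test hs cs ρ = if all holds hs then all holds cs else true
    where
    holds : Expr ℤ _ → Bool
    holds e = ⟦ e ⟧₄ ρ ℕ.% 4 ℕ.≡ᵇ 0

  guard : ∀ b {x} → T b → T (if b then x else true) → T x
  guard true _ t = t

  -- All 4ⁿ residue vectors are tested while the implicit argument is being solved: its type
  -- computes to the unit type exactly when the search succeeds. So `n` has to stay small.
  mod4 : ∀ {n} (hs cs : List (Expr ℤ n)) → {T (search n (test hs cs))} →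
         ∀ ρ → All (λ h → + 4 ∣ ⟦ h ⟧ ρ) hs → All (λ c → + 4 ∣ ⟦ c ⟧ ρ) cs
  mod4 hs cs {t} ρ ds with search-sound (test hs cs) t ρ
  ... | σ , ρ≈σ , ok =
    All.map (λ {c} → backward c) (all⁺ _ cs (guard _ (all⁻ _ (All.map (λ {h} → forward h) ds)) ok))
    where
    forward : ∀ e → + 4 ∣ ⟦ e ⟧ ρ → T (⟦ e ⟧₄ σ ℕ.% 4 ℕ.≡ᵇ 0)
    forward e d = ≡⇒≡ᵇ _ 0 (n∣m⇒m%n≡0 _ 4 (∣⇒∣ᵤ (subst (+ 4 ∣_) (eq (⟦ e ⟧ ρ) (+ ⟦ e ⟧₄ σ)) (∣m∣n⇒∣m-n d (4∣diff (⟦⟧-≈ e ρ≈σ))))))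
      where
      eq : ∀ a b → a - (a - b) ≡ b
      eq = solve-∀
    backward : ∀ e → T (⟦ e ⟧₄ σ ℕ.% 4 ℕ.≡ᵇ 0) → + 4 ∣ ⟦ e ⟧ ρ
    backward e d = subst (+ 4 ∣_) (eq (⟦ e ⟧ ρ) (+ ⟦ e ⟧₄ σ))
      (∣m∣n⇒∣m+n (∣ᵤ⇒∣ {_} {+ ⟦ e ⟧₄ σ} (m%n≡0⇒n∣m _ 4 (≡ᵇ⇒≡ _ 0 d))) (4∣diff (⟦⟧-≈ e ρ≈σ)))
      where
      eq : ∀ a b → b + (a - b) ≡ a
      eq = solve-∀

  open import Tactic.RingSolver.Core.Polynomial.Semantics Ops.homo using () renaming (⟦_⟧ to ⟦_⟧ₚ)

  identity : ∀ {n} (e f : Expr ℤ n) → norm e ≡ norm f → ∀ ρ → ⟦ e ⟧ ρ ≡ ⟦ f ⟧ ρ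
  identity e f eq ρ = trans (sym (correct e ρ)) (trans (cong (λ p → ⟦ p ⟧ₚ ρ) eq) (correct f ρ))

  infixl 9 _[_]
  _[_] : ∀ {m n} → Expr ℤ m → Vec (Expr ℤ n) m → Expr ℤ n
  Κ x     [ σ ] = Κ x
  Ι i     [ σ ] = Vec.lookup σ i
  (e :+ f) [ σ ] = e [ σ ] :+ f [ σ ]
  (e :* f) [ σ ] = e [ σ ] :* f [ σ ]
  (e ⊛ n) [ σ ] = e [ σ ] ⊛ n
  (:- e)   [ σ ] = :- e [ σ ]

  ⟦_⟧* : ∀ {m n} → Vec (Expr ℤ n) m → Vec ℤ n → Vec ℤ m
  ⟦ σ ⟧* ρ = Vec.map (λ e → ⟦ e ⟧ ρ) σ

  ⟦[]⟧ : ∀ {m n} (e : Expr ℤ m) (σ : Vec (Expr ℤ n) m) ρ → ⟦ e [ σ ] ⟧ ρ ≡ ⟦ e ⟧ (⟦ σ ⟧* ρ)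
  ⟦[]⟧ (Κ x)   σ ρ = refl
  ⟦[]⟧ (Ι i)   σ ρ = sym (lookup-map i (λ e → ⟦ e ⟧ ρ) σ)
  ⟦[]⟧ (e :+ f) σ ρ = cong₂ _+_ (⟦[]⟧ e σ ρ) (⟦[]⟧ f σ ρ)
  ⟦[]⟧ (e :* f) σ ρ = cong₂ _*_ (⟦[]⟧ e σ ρ) (⟦[]⟧ f σ ρ)
  ⟦[]⟧ (e ⊛ n) σ ρ = cong (_^′ n) (⟦[]⟧ e σ ρ)
  ⟦[]⟧ (:- e)   σ ρ = cong -_ (⟦[]⟧ e σ ρ)

  combination : ∀ {n} → Expr ℤ n → List (Expr ℤ n × Expr ℤ n) → Expr ℤ n
  combination x []             = Κ (+ 4) :* x
  combination x ((c , h) ∷ hs) = c :* h :+ combination x hs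

  -- Prepares the input of `mod4`: `σ` selects the few quantities that survive modulo 4, and `s` is,
  -- up to `4 x`, a combination of expressions already known to be multiples of 4.
  linear : ∀ {m n} (s : Expr ℤ m) (σ : Vec (Expr ℤ n) m) x (hs : List (Expr ℤ n × Expr ℤ n)) →
           norm (s [ σ ]) ≡ norm (combination x hs) →
           ∀ ρ → All (λ ch → + 4 ∣ ⟦ proj₂ ch ⟧ ρ) hs → + 4 ∣ ⟦ s ⟧ (⟦ σ ⟧* ρ)
  linear s σ x hs eq ρ ds =
    subst (+ 4 ∣_) (trans (sym (identity (s [ σ ]) (combination x hs) eq ρ)) (⟦[]⟧ s σ ρ)) (go hs ds)
    where
    go : ∀ hs → All (λ ch → + 4 ∣ ⟦ proj₂ ch ⟧ ρ) hs → + 4 ∣ ⟦ combination x hs ⟧ ρ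
    go []             []       = ∣m⇒∣m*n (⟦ x ⟧ ρ) ∣-refl
    go ((c , h) ∷ hs) (d ∷ ds) = ∣m∣n⇒∣m+n (∣n⇒∣m*n (⟦ c ⟧ ρ) d) (go hs ds)

-- Consequences of F ≡ Q² modulo 4 for each triple of leading coefficients

module Defects where
  open import Data.List using (List; []; _∷_)
  open import Data.List.Relation.Unary.All as All using (All; []; _∷_)
  open Forms
  open Congruence
  open import Data.Integer.Divisibility.Signed

  x₀ x₁ x₂ x₃ x₄ x₅ : ∀ {n} → Expr ℤ (6 ℕ.+ n)
  x₀ = Ι (# 0)
  x₁ = Ι (# 1)
  x₂ = Ι (# 2)
  x₃ = Ι (# 3)
  x₄ = Ι (# 4)
  x₅ = Ι (# 5)

  one : ∀ {n} → Expr ℤ n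
  one = Κ (+ 1)

  -- Since F - Q² = 4P, this is four times a coefficient of P when l f g = F.
  defect : ℕ → Expr ℤ 11
  defect k = prodC k :- squareC k

  leads : ℤ → ℤ → ℤ → Vec (Expr ℤ 11) 11
  leads a b c = β ∷ Κ a ∷ v ∷ u ∷ Κ b ∷ v′ ∷ u′ ∷ Κ c ∷ q₀ ∷ q₁ ∷ q₂ ∷ []

  Divides4 : Vec ℤ 11 → Expr ℤ 11 → Set
  Divides4 ρ e = + 4 ∣ ⟦ e ⟧ ρ

  module _ (ρ : Vec ℤ 11) where
    private
      _at_ : ∀ {n} → Expr ℤ n → Vec (Expr ℤ 11) n → Set
      e at σ = + 4 ∣ ⟦ e ⟧ (⟦ σ ⟧* ρ)

    module Leads221 (d : ∀ k → k ℕ.≤ 4 → Divides4 ρ (defect k [ leads (+ 2) (+ 2) (+ 1) ])) where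
      D : ℕ → Expr ℤ 11
      D k = defect k [ leads (+ 2) (+ 2) (+ 1) ]

      σ : Vec (Expr ℤ 11) 6
      σ = β ∷ u ∷ v ∷ u′ ∷ q₁ ∷ q₂ ∷ []

      h₄ h₃ : Expr ℤ 6
      h₄ = 2 · (x₁ :+ x₀) :- x₅ :* x₅
      h₃ = 2 · (x₁ :* x₃) :+ 2 · x₂ :+ x₀ :* x₁ :+ 2 · (x₀ :* x₃) :- 2 · (x₄ :* x₅)

      d₄ : h₄ at σ
      d₄ = linear h₄ σ (:- u′) ((one , D 4) ∷ []) refl ρ (d 4 (ℕ.≤ᵇ⇒≤ _ _ _) ∷ [])

      d₃ : h₃ at σ
      d₃ = linear h₃ σ (:- v′) ((one , D 3) ∷ []) refl ρ (d 3 (ℕ.≤ᵇ⇒≤ _ _ _) ∷ [])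

      -- By `h₄`, `q₂` and `u + β` are even. Then `h₃` reduces to `2 v + β u` modulo 4, so `β u` is
      -- even; as `β` and `u` have the same parity both are even, and `v` follows.
      evens : All (_at σ) (2 · x₀ ∷ 2 · x₁ ∷ 2 · x₂ ∷ [])
      evens = mod4 (h₄ ∷ h₃ ∷ []) (2 · x₀ ∷ 2 · x₁ ∷ 2 · x₂ ∷ []) (⟦ σ ⟧* ρ) (d₄ ∷ d₃ ∷ [])

    module Leads122 (d : ∀ k → k ℕ.≤ 4 → Divides4 ρ (defect k [ leads (+ 1) (+ 2) (+ 2) ])) where
      D : ℕ → Expr ℤ 11
      D k = defect k [ leads (+ 1) (+ 2) (+ 2) ]

      σ₀ : Vec (Expr ℤ 11) 6
      σ₀ = u ∷ u′ ∷ v ∷ v′ ∷ q₁ ∷ q₂ ∷ []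

      -- The coefficients of f g, reduced modulo 4 and compared with Q². Multiplying by x + β adds
      -- to each coefficient β times the next higher one of f g, which is known modulo 4 by then; so
      -- `β` can be eliminated degree by degree.
      h₄ h₃ h₂ h₁ : Expr ℤ 6
      h₄ = 2 · (x₀ :+ x₁) :- x₅ :* x₅
      h₃ = 2 · (x₂ :+ x₃) :+ x₀ :* x₁
      h₂ = x₀ :* x₃ :+ x₂ :* x₁ :- x₄ :* x₄
      h₁ = x₂ :* x₃

      d₄ : h₄ at σ₀
      d₄ = linear h₄ σ₀ (:- β) ((one , D 4) ∷ []) refl ρ (d 4 (ℕ.≤ᵇ⇒≤ _ _ _) ∷ [])

      e₄ : All (_at σ₀) (2 · (x₀ :+ x₁) ∷ 2 · x₅ ∷ [])
      e₄ = mod4 (h₄ ∷ []) (2 · (x₀ :+ x₁) ∷ 2 · x₅ ∷ []) (⟦ σ₀ ⟧* ρ) (d₄ ∷ [])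

      u+u′ : Divides4 ρ (2 · (u :+ u′))
      u+u′ = All.head e₄
      q₂-even : Divides4 ρ (2 · q₂)
      q₂-even = All.head (All.tail e₄)

      d₃ : h₃ at σ₀
      d₃ = linear h₃ σ₀ (Κ (+ 0)) ((one , D 3) ∷ (:- β , 2 · (u :+ u′)) ∷ (q₁ , 2 · q₂) ∷ []) refl ρ
             (d 3 (ℕ.≤ᵇ⇒≤ _ _ _) ∷ u+u′ ∷ q₂-even ∷ [])

      d₂ : h₂ at σ₀
      d₂ = linear h₂ σ₀ (Κ (+ 0)) ((one , D 2) ∷ (:- β , h₃ [ σ₀ ]) ∷ (q₀ , 2 · q₂) ∷ []) refl ρ
             (d 2 (ℕ.≤ᵇ⇒≤ _ _ _) ∷ subst (+ 4 ∣_) (sym (⟦[]⟧ h₃ σ₀ ρ)) d₃ ∷ q₂-even ∷ [])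

      evens : All (_at σ₀) (2 · x₀ ∷ 2 · x₁ ∷ 2 · (x₂ :+ x₃) ∷ 2 · x₄ ∷ x₀ :* x₃ :+ x₂ :* x₁ ∷ [])
      evens = mod4 (h₃ ∷ h₂ ∷ 2 · (x₀ :+ x₁) ∷ [])
                (2 · x₀ ∷ 2 · x₁ ∷ 2 · (x₂ :+ x₃) ∷ 2 · x₄ ∷ x₀ :* x₃ :+ x₂ :* x₁ ∷ []) (⟦ σ₀ ⟧* ρ) (d₃ ∷ d₂ ∷ u+u′ ∷ [])

      2u 2u′ 2v+2v′ 2q₁ cross : Set
      2u     = Divides4 ρ (2 · u)
      2u′    = Divides4 ρ (2 · u′)
      2v+2v′ = Divides4 ρ (2 · (v :+ v′))
      2q₁    = Divides4 ρ (2 · q₁)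
      cross  = Divides4 ρ (u :* v′ :+ v :* u′)

      split : All (_at σ₀) (2 · x₀ ∷ 2 · x₁ ∷ 2 · (x₂ :+ x₃) ∷ 2 · x₄ ∷ x₀ :* x₃ :+ x₂ :* x₁ ∷ []) →
              2u × 2u′ × 2v+2v′ × 2q₁ × cross
      split (a ∷ b ∷ c ∷ d ∷ e ∷ []) = a , b , c , d , e

      d₁ : cross → 2q₁ → h₁ at σ₀
      d₁ x y = linear h₁ σ₀ (Κ (+ 0)) ((one , D 1) ∷ (:- β , u :* v′ :+ v :* u′) ∷ (q₀ , 2 · q₁) ∷ []) refl ρ
             (d 1 (ℕ.≤ᵇ⇒≤ _ _ _) ∷ x ∷ y ∷ [])

      -- `v` and `v′` have the same parity and their product is divisible by 4.
      vs : cross → 2q₁ → 2v+2v′ → All (_at σ₀) (2 · x₂ ∷ 2 · x₃ ∷ [])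
      vs x y z = mod4 (h₁ ∷ 2 · (x₂ :+ x₃) ∷ []) (2 · x₂ ∷ 2 · x₃ ∷ []) (⟦ σ₀ ⟧* ρ) (d₁ x y ∷ z ∷ [])

    module Leads411 (d : ∀ k → k ℕ.≤ 4 → Divides4 ρ (defect k [ leads (+ 4) (+ 1) (+ 1) ])) where
      D : ℕ → Expr ℤ 11
      D k = defect k [ leads (+ 4) (+ 1) (+ 1) ]

      σ : Vec (Expr ℤ 11) 2
      σ = β ∷ q₂ ∷ []

      h₄ : Expr ℤ 2
      h₄ = Ι (# 0) :- Ι (# 1) :* Ι (# 1)

      -- The coefficient of x⁴ in F is `β + 4 (u + u′)`, so `β` is congruent to the square of `q₂`:
      -- to 0 or 1 according to the parity of `q₂`.
      d₄ : h₄ at σ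
      d₄ = linear h₄ σ (:- (u :+ u′)) ((one , D 4) ∷ []) refl ρ (d 4 (ℕ.≤ᵇ⇒≤ _ _ _) ∷ [])

      even : Divides4 ρ (2 · q₂) → Divides4 ρ β
      even e = All.head (mod4 (h₄ ∷ 2 · Ι (# 1) ∷ []) (Ι (# 0) ∷ []) (⟦ σ ⟧* ρ) (d₄ ∷ e ∷ []))

      odd : Divides4 ρ (2 · q₂ :- Κ (+ 2)) → Divides4 ρ (β :- one)
      odd e = All.head (mod4 (h₄ ∷ 2 · Ι (# 1) :- Κ (+ 2) ∷ []) (Ι (# 0) :- one ∷ []) (⟦ σ ⟧* ρ) (d₄ ∷ e ∷ []))

    module Leads141 (d : ∀ k → k ℕ.≤ 4 → Divides4 ρ (defect k [ leads (+ 1) (+ 4) (+ 1) ])) where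
      D : ℕ → Expr ℤ 11
      D k = defect k [ leads (+ 1) (+ 4) (+ 1) ]

      σ : Vec (Expr ℤ 11) 2
      σ = u ∷ q₂ ∷ []

      h₄ : Expr ℤ 2
      h₄ = Ι (# 0) :- Ι (# 1) :* Ι (# 1)

      d₄ : h₄ at σ
      d₄ = linear h₄ σ (:- (u′ :+ β)) ((one , D 4) ∷ []) refl ρ (d 4 (ℕ.≤ᵇ⇒≤ _ _ _) ∷ [])

      u-even : Divides4 ρ (2 · q₂) → Divides4 ρ u
      u-even e = All.head (mod4 (h₄ ∷ 2 · Ι (# 1) ∷ []) (Ι (# 0) ∷ []) (⟦ σ ⟧* ρ) (d₄ ∷ e ∷ []))

      v-even : Divides4 ρ (2 · q₂) → Divides4 ρ v
      v-even e = linear (Ι (# 0)) (v ∷ []) (:- (v′ :+ β :* u′)) ((one , D 3) ∷ (:- (u′ :+ β) , u) ∷ (q₁ , 2 · q₂) ∷ []) refl ρ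
                   (d 3 (ℕ.≤ᵇ⇒≤ _ _ _) ∷ u-even e ∷ e ∷ [])

      odd : Divides4 ρ (2 · q₂ :- Κ (+ 2)) → Divides4 ρ (u :- one)
      odd e = All.head (mod4 (h₄ ∷ 2 · Ι (# 1) :- Κ (+ 2) ∷ []) (Ι (# 0) :- one ∷ []) (⟦ σ ⟧* ρ) (d₄ ∷ e ∷ []))

      -- 2 val ≡ 2 F₃
      val-even : Divides4 ρ (2 · u′) → Divides4 ρ (2 · (val [ leads (+ 1) (+ 4) (+ 1) ]))
      val-even e = subst (+ 4 ∣_) (sym (⟦[]⟧ (2 · val) (leads (+ 1) (+ 4) (+ 1)) ρ))
        (linear (2 · val) (leads (+ 1) (+ 4) (+ 1)) (2 · (β :* β) :- u :* β :- 2 · v′ :- 2 · (β :* u′) :+ q₁ :* q₂)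
           ((Κ (+ 2) , D 3) ∷ (:- u , 2 · u′) ∷ []) refl ρ (d 3 (ℕ.≤ᵇ⇒≤ _ _ _) ∷ e ∷ []))

    -- v′ = c² + 1, u′ = 2 c, with c in place of u′
    monic : Vec (Expr ℤ 11) 11
    monic = β ∷ one ∷ v ∷ u ∷ Κ (+ 4) ∷ u′ :* u′ :+ one ∷ u′ :* Κ (+ 2) ∷ one ∷ q₀ ∷ q₁ ∷ q₂ ∷ []

    module Monic (d : ∀ k → k ℕ.≤ 4 → Divides4 ρ (defect k [ monic ]))
                 (q₂-odd : Divides4 ρ (2 · q₂ :- Κ (+ 2))) (u-odd : Divides4 ρ (u :- one)) where
      D : ℕ → Expr ℤ 11
      D k = defect k [ monic ]

      σ : Vec (Expr ℤ 11) 6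
      σ = β ∷ u′ ∷ v ∷ q₀ ∷ q₁ ∷ q₂ ∷ []

      b : Expr ℤ 6
      b = x₁ :* x₁ :+ one

      h₃ h₂ h₁ h₀ : Expr ℤ 6
      h₃ = 2 · x₁ :+ x₂ :+ x₀ :- 2 · x₄
      h₂ = b :+ 2 · (x₁ :* x₂) :+ x₀ :* (2 · x₁ :+ x₂) :- x₄ :* x₄ :- 2 · x₃
      h₁ = x₂ :* b :+ x₀ :* (b :+ 2 · (x₁ :* x₂)) :- 2 · (x₃ :* x₄)
      h₀ = x₀ :* (x₂ :* b) :- x₃ :* x₃

      B : Expr ℤ 11
      B = b [ σ ]

      d₃ : h₃ at σ
      d₃ = linear h₃ σ (:- B :- 2 · (β :* u′)) ((one , D 3) ∷ (:- (2 · u′ :+ β) , u :- one) ∷ (q₁ , 2 · q₂ :- Κ (+ 2)) ∷ []) refl ρ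
             (d 3 (ℕ.≤ᵇ⇒≤ _ _ _) ∷ u-odd ∷ q₂-odd ∷ [])

      d₂ : h₂ at σ
      d₂ = linear h₂ σ (:- (β :* B)) ((one , D 2) ∷ (:- (B :+ 2 · (β :* u′)) , u :- one) ∷ (q₀ , 2 · q₂ :- Κ (+ 2)) ∷ []) refl ρ
             (d 2 (ℕ.≤ᵇ⇒≤ _ _ _) ∷ u-odd ∷ q₂-odd ∷ [])

      d₁ : h₁ at σ
      d₁ = linear h₁ σ (Κ (+ 0)) ((one , D 1) ∷ (:- (β :* B) , u :- one) ∷ []) refl ρ
             (d 1 (ℕ.≤ᵇ⇒≤ _ _ _) ∷ u-odd ∷ [])

      d₀ : h₀ at σ
      d₀ = linear h₀ σ (Κ (+ 0)) ((one , D 0) ∷ []) refl ρ (d 0 ℕ.z≤n ∷ [])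

      -- Modulo 4, F is (x + β)(x + v)((x + c)² + 1); translate so that c = 0. If `β v` ≡ 0, then
      -- `q₀` is even and the coefficient of x² makes `q₁` odd, so `β + v` is 2 by the coefficient
      -- of x³ and 0 by that of x. If `β v` ≡ 1, then `q₀` is odd, `q₁` is even and `β + v` ≡ 0,
      -- whereas `β` ≡ `v` ≡ ±1 gives 2.
      absurd : All (_at σ) (one ∷ [])
      absurd = mod4 (h₀ ∷ h₁ ∷ h₂ ∷ h₃ ∷ []) (one ∷ []) (⟦ σ ⟧* ρ) (d₀ ∷ d₁ ∷ d₂ ∷ d₃ ∷ [])

-- Two-adic analysis of the discriminant equation, case by case

module TwoAdic where
  open import Data.List using (List; []; _∷_)
  open import Data.List.Relation.Unary.All as All using (All; []; _∷_)
  open Forms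
  open Congruence
  open Defects
  open import Data.Integer using (-_; _+_; _*_; _-_; ∣_∣)
  open import Data.Fin.Properties using (all?; toℕ-fromℕ<)
  open import Data.Integer.Divisibility.Signed
  open import Data.Integer.DivMod using (_%ℕ_; _/ℕ_; n%ℕd<d; a≡a%ℕn+[a/ℕn]*n)
  open import Data.Integer.Properties using (*-cancelˡ-≡; abs-*; +-identityˡ; +-inverseˡ; pos-*)
  open import Data.Nat.Coprimality using (Coprime; coprime-divisor)

  odd-∣-2^ : ∀ {n} k → ¬ 2 ℕ.∣ n → n ℕ.∣ 2 ℕ.^ k → n ≡ 1
  odd-∣-2^ zero    odd d = ℕ.∣1⇒≡1 d
  odd-∣-2^ {n} (suc k) odd d = odd-∣-2^ k odd (coprime-divisor coprime d)
    where
    coprime : Coprime n 2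
    coprime {i} (i∣n , i∣2) = cases (prime⇒irreducible (from-yes (prime? 2)) i∣2)
      where
      cases : i ≡ 1 ⊎ i ≡ 2 → i ≡ 1
      cases (inj₁ eq)   = eq
      cases (inj₂ refl) = contradiction i∣n odd

  odd-prime : ∀ {ℓ} → Prime ℓ → ℓ ≢ 2 → ¬ 2 ℕ.∣ ℓ
  odd-prime p ℓ≢2 2∣ℓ with prime⇒irreducible p 2∣ℓ
  ... | inj₁ ()
  ... | inj₂ 2≡ℓ = ℓ≢2 (sym 2≡ℓ)

  4∣1-absurd : ¬ (+ 4 ∣ + 1)
  4∣1-absurd d with ℕ.∣1⇒≡1 (∣⇒∣ᵤ d)
  ... | ()

  odd-abs : ∀ x → + 2 ∣ x - + 1 → ¬ 2 ℕ.∣ ∣ x ∣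
  odd-abs x d e with ℕ.∣1⇒≡1 (∣⇒∣ᵤ (subst (+ 2 ∣_) (eq x) (∣m∣n⇒∣m-n (∣ᵤ⇒∣ {+ 2} {x} e) d)))
    where
    eq : ∀ x → x - (x - + 1) ≡ + 1
    eq = solve-∀
  ... | ()

  4∣⇒2∣ : ∀ {x} → + 4 ∣ x → + 2 ∣ x
  4∣⇒2∣ = ∣-trans (divides (+ 2) refl)

  abs≡1 : ∀ x → ∣ x ∣ ≡ 1 → x ≡ + 1 ⊎ x ≡ - + 1
  abs≡1 (+ .1)    refl = inj₁ refl
  abs≡1 -[1+ .0 ] refl = inj₂ refl

  half : ∀ {x} → + 4 ∣ + 2 * x → ∃ λ h → x ≡ h * + 2
  half {x} (divides k eq) = k , *-cancelˡ-≡ (+ 2) x (k * + 2) (trans eq (lem k))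
    where
    lem : ∀ k → k * + 4 ≡ + 2 * (k * + 2)
    lem = solve-∀

  parity : ∀ x → (∃ λ k → x ≡ k * + 2) ⊎ (∃ λ k → x ≡ + 1 + k * + 2)
  parity x with x %ℕ 2 | x /ℕ 2 | n%ℕd<d x 2 | a≡a%ℕn+[a/ℕn]*n x 2
  ... | 0 | k | _ | eq = inj₁ (k , trans eq (lem k))
    where
    lem : ∀ k → + 0 + k * + 2 ≡ k * + 2
    lem = solve-∀
  ... | 1 | k | _ | eq = inj₂ (k , eq)
  ... | suc (suc _) | _ | ℕ.s≤s (ℕ.s≤s ()) | _

  square-abs : ∀ x → x * x ≡ + (∣ x ∣ ℕ.* ∣ x ∣)
  square-abs (+ n)      = sym (ℤ.pos-* n n)

  square-abs (-[1+ n ]) = refl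

  -- For odd k or k + 1 being a divisor of 256 forces it to be ±1.
  consecutive-∣256 : ∀ k → ∣ k ∣ ℕ.∣ 256 → ∣ k + + 1 ∣ ℕ.∣ 256 → k * (k + + 1) ≡ + 0 ⊎ k * (k + + 1) ≡ + 2
  consecutive-∣256 k d e with parity k
  ... | inj₁ (j , eq) = cases (abs≡1 _ (odd-∣-2^ 8 (odd-abs (k + + 1) (divides j (trans (lem k) eq))) e))
    where
    lem : ∀ k → k + + 1 - + 1 ≡ k
    lem = solve-∀
    back : ∀ k {c} → k + + 1 ≡ c → k ≡ c - + 1
    back k refl = sym (lem k)
    cases : k + + 1 ≡ + 1 ⊎ k + + 1 ≡ - + 1 → k * (k + + 1) ≡ + 0 ⊎ k * (k + + 1) ≡ + 2
    cases (inj₁ p) = inj₁ (cong (λ x → x * (x + + 1)) (back k p))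
    cases (inj₂ p) = inj₂ (cong (λ x → x * (x + + 1)) (back k p))
  ... | inj₂ (j , eq) = cases (abs≡1 k (odd-∣-2^ 8 (odd-abs k (divides j (trans (cong (_- + 1) eq) (lem j)))) d))
    where
    lem : ∀ j → + 1 + j * + 2 - + 1 ≡ j * + 2
    lem = solve-∀
    cases : k ≡ + 1 ⊎ k ≡ - + 1 → k * (k + + 1) ≡ + 0 ⊎ k * (k + + 1) ≡ + 2
    cases (inj₁ p) = inj₂ (cong (λ x → x * (x + + 1)) p)
    cases (inj₂ p) = inj₁ (cong (λ x → x * (x + + 1)) p)

  -- ℓ cannot divide s, because ℓ² does not divide 256 ℓ.
  absorb : ∀ {ℓ} → Prime ℓ → ¬ 2 ℕ.∣ ℓ → ∀ a b s → a ℕ.* b ℕ.* (s ℕ.* s) ≡ 256 ℕ.* ℓ →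
           (∃ λ e → b ≡ e ℕ.* ℓ × a ℕ.* e ℕ.* (s ℕ.* s) ≡ 256) ⊎
           (∃ λ e → a ≡ e ℕ.* ℓ × b ℕ.* e ℕ.* (s ℕ.* s) ≡ 256)
  absorb {ℓ} pr odd a b s eq = cases (euclidsLemma (a ℕ.* b) (s ℕ.* s) pr (ℕ.divides 256 eq))
    where
    instance _ = prime⇒nonZero pr
    goal₁ = ∃ λ e → b ≡ e ℕ.* ℓ × a ℕ.* e ℕ.* (s ℕ.* s) ≡ 256
    goal₂ = ∃ λ e → a ≡ e ℕ.* ℓ × b ℕ.* e ℕ.* (s ℕ.* s) ≡ 256
    lem₁ : ∀ a e l s → a ℕ.* e ℕ.* (s ℕ.* s) ℕ.* l ≡ a ℕ.* (e ℕ.* l) ℕ.* (s ℕ.* s)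
    lem₁ = ℕSolver.solve-∀
    lem₂ : ∀ b e l s → b ℕ.* e ℕ.* (s ℕ.* s) ℕ.* l ≡ e ℕ.* l ℕ.* b ℕ.* (s ℕ.* s)
    lem₂ = ℕSolver.solve-∀
    lem₃ : ∀ a b t l → a ℕ.* b ℕ.* (t ℕ.* t) ℕ.* l ℕ.* l ≡ a ℕ.* b ℕ.* (t ℕ.* l ℕ.* (t ℕ.* l))
    lem₃ = ℕSolver.solve-∀
    ℓ∤s : ∀ t → s ≡ t ℕ.* ℓ → ⊥
    ℓ∤s t refl = ℓ≢1 (odd-∣-2^ 8 odd (ℕ.divides (a ℕ.* b ℕ.* (t ℕ.* t))
        (sym (ℕ.*-cancelʳ-≡ _ 256 ℓ (trans (lem₃ a b t ℓ) eq)))))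
      where
      ℓ≢1 : ℓ ≢ 1
      ℓ≢1 refl = ¬prime[1] pr
    cases : ℓ ℕ.∣ a ℕ.* b ⊎ ℓ ℕ.∣ s ℕ.* s → goal₁ ⊎ goal₂
    cases (inj₂ d) with euclidsLemma s s pr d
    ... | inj₁ (ℕ.divides t p) = ⊥-elim (ℓ∤s t p)
    ... | inj₂ (ℕ.divides t p) = ⊥-elim (ℓ∤s t p)
    cases (inj₁ d) with euclidsLemma a b pr d
    ... | inj₁ (ℕ.divides e refl) = inj₂ (e , refl , ℕ.*-cancelʳ-≡ _ 256 ℓ (trans (lem₂ b e ℓ s) eq))
    ... | inj₂ (ℕ.divides e refl) = inj₁ (e , refl , ℕ.*-cancelʳ-≡ _ 256 ℓ (trans (lem₁ a e ℓ s) eq))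

  -- All that is kept of the curve: F ≡ Q² modulo 4, the equation |Δ| = `ℓ` in terms of the factors,
  -- and the absence of rational roots of f and g.
  record Reduced (ℓ : ℕ) (ρ : Vec ℤ 11) : Set where
    field
      defects    : ∀ k → k ℕ.≤ 4 → + 4 ∣ ⟦ defect k ⟧ ρ
      size       : ∣ ⟦ disc ⟧ ρ ∣ ℕ.* ∣ ⟦ disc′ ⟧ ρ ∣ ℕ.* (∣ ⟦ mixed ⟧ ρ ∣ ℕ.* ∣ ⟦ mixed ⟧ ρ ∣) ≡ 256 ℕ.* ℓ
      nonsquare  : ∀ k → ⟦ disc ⟧ ρ ≢ k * k
      nonsquare′ : ∀ k → ⟦ disc′ ⟧ ρ ≢ k * k
  open Reduced

  -- As 256 is the square of 16, `s` divides 16 and the cofactor is itself a square. This is what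
  -- turns |disc g| into a square.
  dividing-16 : ∀ a s → a ℕ.* (s ℕ.* s) ≡ 256 → ∃ λ t → t ℕ.* s ≡ 16 × a ≡ t ℕ.* t
  dividing-16 a s eq = t , sym 16≡ts , ℕ.*-cancelʳ-≡ a (t ℕ.* t) (s ℕ.* s) (trans eq (trans (cong (λ n → n ℕ.* n) 16≡ts) (lem t s)))
    where
    s≤16 : s ℕ.< 17
    -- 17² = 289 exceeds 256, so a table of 17 entries suffices.
    s≤16 = ℕ.≰⇒> λ 17≤s → ℕ.1+n≰n {256} (ℕ.≤-trans (ℕ.≤-trans (ℕ.≤ᵇ⇒≤ 257 289 _) (ℕ.*-mono-≤ 17≤s 17≤s)) (ℕ.∣⇒≤ (ℕ.divides a (sym eq))))
    table : ∀ (i : Fin 17) → toℕ i ℕ.* toℕ i ℕ.∣ 256 → toℕ i ℕ.∣ 16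
    table = from-yes (all? {17} λ i → (toℕ i ℕ.* toℕ i ℕ.∣? 256) →-dec (toℕ i ℕ.∣? 16))
    s∣16 : s ℕ.∣ 16
    s∣16 = subst (ℕ._∣ 16) (toℕ-fromℕ< s≤16) (table (fromℕ< s≤16)
      (subst (λ n → n ℕ.* n ℕ.∣ 256) (sym (toℕ-fromℕ< s≤16)) (ℕ.divides a (sym eq))))
    t = ℕ.quotient s∣16
    16≡ts : 16 ≡ t ℕ.* s
    16≡ts = ℕ._∣_.equality s∣16
    instance
      s*s≢0 : ℕ.NonZero (s ℕ.* s)
      s*s≢0 = ℕ.≢-nonZero λ z → nope (trans (sym eq) (trans (cong (a ℕ.*_) z) (ℕ.*-zeroʳ a)))
        where
        nope : ¬ 256 ≡ 0
        nope ()
    lem : ∀ t s → t ℕ.* s ℕ.* (t ℕ.* s) ≡ t ℕ.* t ℕ.* (s ℕ.* s)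
    lem = ℕSolver.solve-∀

  ∣mixed∣ : ∀ ρ → ∣ ⟦ mixed ⟧ ρ ∣ ≡ ∣ ⟦ res ⟧ ρ ∣ ℕ.* (∣ ⟦ val ⟧ ρ ∣ ℕ.* ∣ ⟦ val′ ⟧ ρ ∣)
  ∣mixed∣ ρ = trans (abs-* (⟦ res ⟧ ρ) (⟦ val :* val′ ⟧ ρ)) (cong (∣ ⟦ res ⟧ ρ ∣ ℕ.*_) (abs-* (⟦ val ⟧ ρ) (⟦ val′ ⟧ ρ)))

  module Cases {ℓ} (pr : Prime ℓ) (odd : ¬ 2 ℕ.∣ ℓ) where

    defects-at : ∀ (σ : Vec (Expr ℤ 11) 11) ρ → Reduced ℓ (⟦ σ ⟧* ρ) → ∀ k → k ℕ.≤ 4 → + 4 ∣ ⟦ defect k [ σ ] ⟧ ρ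
    defects-at σ ρ r k k≤4 = subst (+ 4 ∣_) (sym (⟦[]⟧ (defect k) σ ρ)) (defects r k k≤4)

    -- 32² = 2¹⁰ exceeds 256 = 2⁸ by a factor 4, which would have to divide the odd `ℓ`.
    size-even : ∀ a b s t → s ≡ 32 ℕ.* t → a ℕ.* b ℕ.* (s ℕ.* s) ≢ 256 ℕ.* ℓ
    size-even a b _ t refl eq = odd (ℕ.divides (a ℕ.* b ℕ.* (t ℕ.* t) ℕ.* 2) (ℕ.*-cancelˡ-≡ ℓ _ 256 (trans (sym eq) (lem a b t))))
      where
      lem : ∀ a b t → a ℕ.* b ℕ.* (32 ℕ.* t ℕ.* (32 ℕ.* t)) ≡ 256 ℕ.* (a ℕ.* b ℕ.* (t ℕ.* t) ℕ.* 2 ℕ.* 2)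
      lem = ℕSolver.solve-∀

    not-32∣mixed : ∀ ρ (τ : Vec (Expr ℤ 11) 11) (e : Expr ℤ 11) ρ′ → ρ ≡ ⟦ τ ⟧* ρ′ →
                   norm (mixed [ τ ]) ≡ norm (32 · e) → ¬ Reduced ℓ ρ
    not-32∣mixed ρ τ e ρ′ refl eq r =
      size-even (∣ ⟦ disc ⟧ ρ ∣) (∣ ⟦ disc′ ⟧ ρ ∣) (∣ ⟦ mixed ⟧ ρ ∣) (∣ ⟦ e ⟧ ρ′ ∣) (trans (cong ∣_∣ (trans (sym (⟦[]⟧ mixed τ ρ′)) (identity (mixed [ τ ]) (32 · e) eq ρ′)))
                                          (abs-* (+ 32) (⟦ e ⟧ ρ′))) (size r)

    -- The product of the three resultants after each factor has been divided by its leading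
    -- coefficient.
    hat : Expr ℤ 11
    hat = mixed [ leads (+ 1) (+ 1) (+ 1) ]

    -- With l = 2 l₀ and f = 2 f₀, homogeneity takes 8 out of Res(l, f), 4 out of Res(l, g) and 4
    -- out of Res(f, g): together 128 = 32 · 4. The zeros in the new vector stand at the leading
    -- coefficients, which `τ` supplies itself.
    case221 : ∀ ρ → ¬ Reduced ℓ (⟦ leads (+ 2) (+ 2) (+ 1) ⟧* ρ)
    case221 ρ@(b ∷ _ ∷ y ∷ x ∷ _ ∷ y′ ∷ x′ ∷ _ ∷ qs@(_ ∷ _ ∷ _ ∷ [])) r = go (Leads221.evens ρ (defects-at (leads (+ 2) (+ 2) (+ 1)) ρ r))
      where
      σ : Vec (Expr ℤ 11) 6
      σ = β ∷ u ∷ v ∷ u′ ∷ q₁ ∷ q₂ ∷ []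
      τ : Vec (Expr ℤ 11) 11
      τ = β :* Κ (+ 2) ∷ Κ (+ 2) ∷ v :* Κ (+ 2) ∷ u :* Κ (+ 2) ∷ Κ (+ 2) ∷ v′ ∷ u′ ∷ Κ (+ 1) ∷ q₀ ∷ q₁ ∷ q₂ ∷ []
      same : ∀ b₀ y₀ x₀ → b ≡ b₀ * + 2 → x ≡ x₀ * + 2 → y ≡ y₀ * + 2 →
             ⟦ leads (+ 2) (+ 2) (+ 1) ⟧* ρ ≡ ⟦ τ ⟧* (b₀ ∷ + 0 ∷ y₀ ∷ x₀ ∷ + 0 ∷ y′ ∷ x′ ∷ + 0 ∷ qs)
      same _ _ _ refl refl refl = refl
      go : All (λ e → + 4 ∣ ⟦ e ⟧ (⟦ σ ⟧* ρ)) (2 · x₀ ∷ 2 · x₁ ∷ 2 · x₂ ∷ []) → ⊥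
      go (e₁ ∷ e₂ ∷ e₃ ∷ []) =
        let b₀ , p₁ = half {b} e₁
            x₀ , p₂ = half {x} e₂
            y₀ , p₃ = half {y} e₃
        in not-32∣mixed _ τ (4 · hat) (b₀ ∷ + 0 ∷ y₀ ∷ x₀ ∷ + 0 ∷ y′ ∷ x′ ∷ + 0 ∷ qs) (same b₀ y₀ x₀ p₁ p₂ p₃) refl r

    -- With f = 2 f₀ and g = 2 g₀, Res(f, g) yields 16 and the other two resultants 2 each: together
    -- 64 = 32 · 2.
    case122 : ∀ ρ → ¬ Reduced ℓ (⟦ leads (+ 1) (+ 2) (+ 2) ⟧* ρ)
    case122 ρ@(b ∷ _ ∷ y ∷ x ∷ _ ∷ y′ ∷ x′ ∷ _ ∷ qs@(_ ∷ _ ∷ _ ∷ [])) r = go (L.split L.evens)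
      where
      module L = Leads122 ρ (defects-at (leads (+ 1) (+ 2) (+ 2)) ρ r)
      τ : Vec (Expr ℤ 11) 11
      τ = β ∷ Κ (+ 1) ∷ v :* Κ (+ 2) ∷ u :* Κ (+ 2) ∷ Κ (+ 2) ∷ v′ :* Κ (+ 2) ∷ u′ :* Κ (+ 2) ∷ Κ (+ 2) ∷ q₀ ∷ q₁ ∷ q₂ ∷ []
      same : ∀ y₀ x₀ y₁ x₁ → y ≡ y₀ * + 2 → x ≡ x₀ * + 2 → y′ ≡ y₁ * + 2 → x′ ≡ x₁ * + 2 →
             ⟦ leads (+ 1) (+ 2) (+ 2) ⟧* ρ ≡ ⟦ τ ⟧* (b ∷ + 0 ∷ y₀ ∷ x₀ ∷ + 0 ∷ y₁ ∷ x₁ ∷ + 0 ∷ qs)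
      same _ _ _ _ refl refl refl refl = refl
      finish : L.2u → L.2u′ → All (λ e → + 4 ∣ ⟦ e ⟧ (⟦ L.σ₀ ⟧* ρ)) (2 · x₂ ∷ 2 · x₃ ∷ []) → ⊥
      finish e₁ e₂ (e₃ ∷ e₄ ∷ []) =
        let x₀ , p₁ = half {x} e₁
            x₁ , p₂ = half {x′} e₂
            y₀ , p₃ = half {y} e₃
            y₁ , p₄ = half {y′} e₄
        in not-32∣mixed _ τ (2 · hat) (b ∷ + 0 ∷ y₀ ∷ x₀ ∷ + 0 ∷ y₁ ∷ x₁ ∷ + 0 ∷ qs) (same y₀ x₀ y₁ x₁ p₃ p₁ p₄ p₂) refl r
      go : L.2u × L.2u′ × L.2v+2v′ × L.2q₁ × L.cross → ⊥
      go (e₁ , e₂ , e₃ , e₄ , e₅) = finish e₁ e₂ (L.vs e₅ e₄ e₃)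

    parity₄ : ∀ x → (+ 4 ∣ + 2 * x) ⊎ (+ 4 ∣ + 2 * x - + 2)
    parity₄ x = cases (parity x)
      where
      lem₀ : ∀ k → + 2 * (k * + 2) ≡ k * + 4
      lem₀ = solve-∀
      lem₁ : ∀ k → + 2 * (+ 1 + k * + 2) - + 2 ≡ k * + 4
      lem₁ = solve-∀
      cases : (∃ λ k → x ≡ k * + 2) ⊎ (∃ λ k → x ≡ + 1 + k * + 2) → (+ 4 ∣ + 2 * x) ⊎ (+ 4 ∣ + 2 * x - + 2)
      cases (inj₁ (k , p)) = inj₁ (divides k (trans (cong (λ z → + 2 * z) p) (lem₀ k)))
      cases (inj₂ (k , p)) = inj₂ (divides k (trans (cong (λ x → + 2 * x - + 2) p) (lem₁ k)))

    -- With l = 4 l₀ both resultants of l yield 16: together 256 = 32 · 8.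
    case411-even : ∀ ρ → + 4 ∣ ⟦ 2 · q₂ ⟧ ρ → ¬ Reduced ℓ (⟦ leads (+ 4) (+ 1) (+ 1) ⟧* ρ)
    case411-even ρ@(b ∷ _ ∷ y ∷ x ∷ _ ∷ y′ ∷ x′ ∷ _ ∷ qs@(_ ∷ _ ∷ _ ∷ [])) q-even r =
      go (Leads411.even ρ (defects-at (leads (+ 4) (+ 1) (+ 1)) ρ r) q-even)
      where
      τ : Vec (Expr ℤ 11) 11
      τ = β :* Κ (+ 4) ∷ Κ (+ 4) ∷ v ∷ u ∷ Κ (+ 1) ∷ v′ ∷ u′ ∷ Κ (+ 1) ∷ q₀ ∷ q₁ ∷ q₂ ∷ []
      same : ∀ k → b ≡ k * + 4 → ⟦ leads (+ 4) (+ 1) (+ 1) ⟧* ρ ≡ ⟦ τ ⟧* (k ∷ + 0 ∷ y ∷ x ∷ + 0 ∷ y′ ∷ x′ ∷ + 0 ∷ qs)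
      same _ refl = refl
      go : + 4 ∣ b → ⊥
      go (divides k p) = not-32∣mixed _ τ (8 · hat) (k ∷ + 0 ∷ y ∷ x ∷ + 0 ∷ y′ ∷ x′ ∷ + 0 ∷ qs) (same k p) refl r

    -- With f = 4 f₀, Res(l, f) yields 4 and Res(f, g) yields 16: together 64 = 32 · 2.
    case141-even : ∀ ρ → + 4 ∣ ⟦ 2 · q₂ ⟧ ρ → ¬ Reduced ℓ (⟦ leads (+ 1) (+ 4) (+ 1) ⟧* ρ)
    case141-even ρ@(b ∷ _ ∷ y ∷ x ∷ _ ∷ y′ ∷ x′ ∷ _ ∷ qs@(_ ∷ _ ∷ _ ∷ [])) q-even r =
      go (L.u-even q-even) (L.v-even q-even)
      where
      module L = Leads141 ρ (defects-at (leads (+ 1) (+ 4) (+ 1)) ρ r)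
      τ : Vec (Expr ℤ 11) 11
      τ = β ∷ Κ (+ 1) ∷ v :* Κ (+ 4) ∷ u :* Κ (+ 4) ∷ Κ (+ 4) ∷ v′ ∷ u′ ∷ Κ (+ 1) ∷ q₀ ∷ q₁ ∷ q₂ ∷ []
      same : ∀ j k → x ≡ j * + 4 → y ≡ k * + 4 →
             ⟦ leads (+ 1) (+ 4) (+ 1) ⟧* ρ ≡ ⟦ τ ⟧* (b ∷ + 0 ∷ k ∷ j ∷ + 0 ∷ y′ ∷ x′ ∷ + 0 ∷ qs)
      same _ _ refl refl = refl
      go : + 4 ∣ x → + 4 ∣ y → ⊥
      go (divides j p) (divides k q) = not-32∣mixed _ τ (2 · hat) (b ∷ + 0 ∷ k ∷ j ∷ + 0 ∷ y′ ∷ x′ ∷ + 0 ∷ qs) (same j k p q) refl r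

    -- The hypothesis is the situation in which `ℓ` has been absorbed by the discriminant of g, so
    -- that disc f and Res(l, f) divide 256. Res(l, f) is 1 modulo 4, hence equal to 1, and then
    -- disc f is a product of consecutive integers dividing 256.
    case411-core : ∀ ρ e → + 4 ∣ ⟦ β :- one ⟧ ρ → let ρ⁺ = ⟦ leads (+ 4) (+ 1) (+ 1) ⟧* ρ in
                   ∣ ⟦ disc ⟧ ρ⁺ ∣ ℕ.* e ℕ.* (∣ ⟦ mixed ⟧ ρ⁺ ∣ ℕ.* ∣ ⟦ mixed ⟧ ρ⁺ ∣) ≢ 256
    case411-core ρ@(b ∷ _ ∷ y ∷ x ∷ _ ∷ y′ ∷ x′ ∷ _ ∷ qs@(_ ∷ _ ∷ _ ∷ [])) e β-odd@(divides m b-1≡m*4) eq = D-cases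
      where
      σ τ : Vec (Expr ℤ 11) 11
      σ = leads (+ 4) (+ 1) (+ 1)
      τ = one :+ β :* Κ (+ 4) ∷ Κ (+ 4) ∷ v ∷ u ∷ one ∷ v′ ∷ u′ ∷ one ∷ q₀ ∷ q₁ ∷ q₂ ∷ []
      ρ⁺ ρ′ : Vec ℤ 11
      ρ⁺ = ⟦ σ ⟧* ρ
      ρ′ = m ∷ + 0 ∷ y ∷ x ∷ + 0 ∷ y′ ∷ x′ ∷ + 0 ∷ qs
      b≡ : b ≡ + 1 + m * + 4
      b≡ = trans (lem b) (cong (λ z → + 1 + z) b-1≡m*4)
        where
        lem : ∀ b → b ≡ + 1 + (b - + 1)
        lem = solve-∀
      same : b ≡ + 1 + m * + 4 → ρ⁺ ≡ ⟦ τ ⟧* ρ′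
      same refl = refl

      D V s : ℕ
      D = ∣ ⟦ disc ⟧ ρ⁺ ∣
      V = ∣ ⟦ val ⟧ ρ⁺ ∣
      s = ∣ ⟦ mixed ⟧ ρ⁺ ∣

      V∣256 : V ℕ.∣ 256
      V∣256 = subst (V ℕ.∣_) eq (ℕ.∣n⇒∣m*n (D ℕ.* e) (ℕ.∣m⇒∣m*n s (subst (V ℕ.∣_) (sym (∣mixed∣ ρ⁺))
        (ℕ.∣n⇒∣m*n ∣ ⟦ res ⟧ ρ⁺ ∣ (ℕ.∣m⇒∣m*n ∣ ⟦ val′ ⟧ ρ⁺ ∣ ℕ.∣-refl)))))

      D∣256 : D ℕ.∣ 256
      D∣256 = subst (D ℕ.∣_) eq (ℕ.∣m⇒∣m*n (s ℕ.* s) (ℕ.∣m⇒∣m*n e ℕ.∣-refl))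

      V-odd : + 4 ∣ ⟦ val ⟧ ρ⁺ - + 1
      V-odd = linear (val :- one) σ (4 · v :- u :* β) ((β :+ one , β :- one) ∷ []) refl ρ (β-odd ∷ [])

      V≡1 : ⟦ val ⟧ ρ⁺ ≡ + 1
      V≡1 = cases (abs≡1 _ (odd-∣-2^ 8 (odd-abs (⟦ val ⟧ ρ⁺) (4∣⇒2∣ V-odd)) V∣256))
        where
        cases : ⟦ val ⟧ ρ⁺ ≡ + 1 ⊎ ⟦ val ⟧ ρ⁺ ≡ - + 1 → ⟦ val ⟧ ρ⁺ ≡ + 1
        cases (inj₁ p) = p
        cases (inj₂ p) = contradiction (∣⇒∣ᵤ (subst (λ z → + 4 ∣ z - + 1) p V-odd)) (from-no (4 ℕ.∣? 2))

      -- Here the slot of `β` holds `m`, where β = 1 + 4m. So β - 2u = 2k + 1, and its square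
      -- exceeds 1 by 4 k (k + 1).
      K : Expr ℤ 11
      K = 2 · β :- u

      k : ℤ
      k = ⟦ K ⟧ ρ′

      -- (β - 2u)² = val + 4 disc
      k[k+1]≡disc : k * (k + + 1) ≡ ⟦ disc ⟧ ρ⁺
      k[k+1]≡disc = *-cancelˡ-≡ (+ 4) _ _ (begin
        + 4 * (k * (k + + 1))                              ≡⟨ identity (4 · (K :* (K :+ one))) ((val :- one :+ 4 · disc) [ τ ]) refl ρ′ ⟩
        ⟦ (val :- one :+ 4 · disc) [ τ ] ⟧ ρ′              ≡⟨ ⟦[]⟧ (val :- one :+ 4 · disc) τ ρ′ ⟩
        ⟦ val :- one :+ 4 · disc ⟧ (⟦ τ ⟧* ρ′)             ≡⟨ cong ⟦ val :- one :+ 4 · disc ⟧ (sym (same b≡)) ⟩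
        (⟦ val ⟧ ρ⁺ - + 1) + + 4 * ⟦ disc ⟧ ρ⁺             ≡⟨ cong (λ z → (z - + 1) + + 4 * ⟦ disc ⟧ ρ⁺) V≡1 ⟩
        + 0 + + 4 * ⟦ disc ⟧ ρ⁺                            ≡⟨ +-identityˡ _ ⟩
        + 4 * ⟦ disc ⟧ ρ⁺                                  ∎)
        where open ≡-Reasoning

      k∣256 : ∀ i → i ℕ.∣ ∣ k ∣ ℕ.* ∣ k + + 1 ∣ → i ℕ.∣ 256
      k∣256 i d = ℕ.∣-trans (subst (i ℕ.∣_) (trans (sym (abs-* k (k + + 1))) (cong ∣_∣ k[k+1]≡disc)) d) D∣256

      D-cases : ⊥
      D-cases = cases (consecutive-∣256 k (k∣256 _ (ℕ.∣m⇒∣m*n ∣ k + + 1 ∣ ℕ.∣-refl)) (k∣256 _ (ℕ.∣n⇒∣m*n ∣ k ∣ ℕ.∣-refl)))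
        where
        h : Expr ℤ 2
        h = Ι (# 0) :* Ι (# 0) :- 4 · (one :* Ι (# 1)) :- Κ (+ 2)
        -- A discriminant u² - 4v is never 2 modulo 4.
        two : ⟦ disc ⟧ ρ⁺ ≡ + 2 → All (λ e → + 4 ∣ ⟦ e ⟧ (x ∷ y ∷ [])) (one ∷ [])
        two p = mod4 (h ∷ []) (one ∷ []) (x ∷ y ∷ []) (divides (+ 0) (cong (_- + 2) p) ∷ [])
        nonzero : D ≢ 0
        nonzero z = ℕ.0≢1+n {255} (trans (cong (λ n → n ℕ.* e ℕ.* (s ℕ.* s)) (sym z)) eq)
        cases : k * (k + + 1) ≡ + 0 ⊎ k * (k + + 1) ≡ + 2 → ⊥
        cases (inj₁ p) = nonzero (cong ∣_∣ (trans (sym k[k+1]≡disc) p))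
        cases (inj₂ p) = 4∣1-absurd (All.head (two (trans (sym k[k+1]≡disc) p)))

    -- disc f is 1 modulo 4. If it divided 256 it would be 1, a square; so it absorbs `ℓ`, with odd
    -- cofactor 1. What remains is |disc g| s² = 256, so disc g = -t², and g is a sum of two
    -- squares.
    case141-odd : ∀ ρ → + 4 ∣ ⟦ 2 · q₂ :- Κ (+ 2) ⟧ ρ → ¬ Reduced ℓ (⟦ leads (+ 1) (+ 4) (+ 1) ⟧* ρ)
    case141-odd ρ@(b ∷ _ ∷ y ∷ x ∷ _ ∷ y′ ∷ x′ ∷ _ ∷ qs@(_ ∷ _ ∷ _ ∷ [])) q-odd r = cases (absorb pr odd D D′ s (size r))
      where
      module L = Leads141 ρ (defects-at (leads (+ 1) (+ 4) (+ 1)) ρ r)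
      σ : Vec (Expr ℤ 11) 11
      σ = leads (+ 1) (+ 4) (+ 1)
      ρ⁺ : Vec ℤ 11
      ρ⁺ = ⟦ σ ⟧* ρ
      R V V′ D D′ s : ℕ
      R  = ∣ ⟦ res ⟧ ρ⁺ ∣
      V  = ∣ ⟦ val ⟧ ρ⁺ ∣
      V′ = ∣ ⟦ val′ ⟧ ρ⁺ ∣
      D  = ∣ ⟦ disc ⟧ ρ⁺ ∣
      D′ = ∣ ⟦ disc′ ⟧ ρ⁺ ∣
      s  = ∣ ⟦ mixed ⟧ ρ⁺ ∣

      u-odd : + 4 ∣ ⟦ u :- one ⟧ ρ
      u-odd = L.odd q-odd

      D-odd : + 4 ∣ ⟦ disc ⟧ ρ⁺ - + 1
      D-odd = linear (disc :- one) σ (:- 4 · v) ((u :+ one , u :- one) ∷ []) refl ρ (u-odd ∷ [])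

      2∤D : ¬ 2 ℕ.∣ D
      2∤D = odd-abs (⟦ disc ⟧ ρ⁺) (4∣⇒2∣ D-odd)

      D≢1 : D ≢ 1
      D≢1 p = go (abs≡1 (⟦ disc ⟧ ρ⁺) p)
        where
        go : ⟦ disc ⟧ ρ⁺ ≡ + 1 ⊎ ⟦ disc ⟧ ρ⁺ ≡ - + 1 → ⊥
        go (inj₁ p) = nonsquare r (+ 1) p
        go (inj₂ p) = contradiction (∣⇒∣ᵤ (subst (λ z → + 4 ∣ z - + 1) p D-odd)) (from-no (4 ℕ.∣? 2))

      module _ (t : ℕ) (ts≡16 : t ℕ.* s ≡ 16) (D′≡-t² : ⟦ disc′ ⟧ ρ⁺ ≡ - (+ (t ℕ.* t))) where
        h : Expr ℤ 3
        h = Ι (# 0) :* Ι (# 0) :- 4 · (one :* Ι (# 1)) :+ Ι (# 2) :* Ι (# 2)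

        h≡0 : x′ * x′ - + 4 * (+ 1 * y′) + + t * + t ≡ + 0
        h≡0 = trans (cong₂ _+_ D′≡-t² (square-abs (+ t))) (+-inverseˡ (+ (t ℕ.* t)))

        -- A sum of two squares is divisible by 4 only if both are even.
        evens : All (λ e → + 4 ∣ ⟦ e ⟧ (x′ ∷ y′ ∷ + t ∷ [])) (2 · Ι (# 0) ∷ 2 · Ι (# 2) ∷ [])
        evens = mod4 (h ∷ []) (2 · Ι (# 0) ∷ 2 · Ι (# 2) ∷ []) (x′ ∷ y′ ∷ + t ∷ []) (divides (+ 0) h≡0 ∷ [])

        2x′ : + 4 ∣ + 2 * x′
        2x′ = All.head evens

        c τ : ℤ
        c = proj₁ (half {x′} 2x′)
        τ = proj₁ (half {+ t} (All.head (All.tail evens)))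

        x′≡ : x′ ≡ c * + 2
        x′≡ = proj₂ (half {x′} 2x′)

        t≡ : + t ≡ τ * + 2
        t≡ = proj₂ (half {+ t} (All.head (All.tail evens)))

        y′≡ : y′ ≡ c * c + τ * τ
        y′≡ = *-cancelˡ-≡ (+ 4) y′ _ (trans (lem x′ y′ (+ t)) (trans (cong₂ _-_ (cong₂ (λ a b → a * a + b * b) x′≡ t≡) h≡0) (lem′ c τ)))
          where
          lem : ∀ x y t → + 4 * y ≡ x * x + t * t - (x * x - + 4 * (+ 1 * y) + t * t)
          lem = solve-∀
          lem′ : ∀ c τ → c * + 2 * (c * + 2) + τ * + 2 * (τ * + 2) - + 0 ≡ + 4 * (c * c + τ * τ)
          lem′ = solve-∀

        n m : ℕ
        n = ∣ τ ∣
        m = ∣ b - c ∣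

        V′≡ : V′ ≡ m ℕ.* m ℕ.+ n ℕ.* n
        V′≡ = cong ∣_∣ (trans (cong₂ (λ x y → + 1 * (b * b) - x * (b * + 1) + y * (+ 1 * + 1)) x′≡ y′≡)
                      (trans (lem b c τ) (cong₂ _+_ (square-abs (b - c)) (square-abs τ))))
          where
          lem : ∀ b c t → + 1 * (b * b) - c * + 2 * (b * + 1) + (c * c + t * t) * (+ 1 * + 1) ≡ (b - c) * (b - c) + t * t
          lem = solve-∀

        2∣V : 2 ℕ.∣ V
        2∣V = ∣⇒∣ᵤ (subst (+ 2 ∣_) (sym V≡) (divides (proj₁ hv) (proj₂ hv)))
          where
          hv = half {⟦ val [ σ ] ⟧ ρ} (L.val-even 2x′)
          V≡ : ⟦ val ⟧ ρ⁺ ≡ ⟦ val [ σ ] ⟧ ρ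
          V≡ = sym (⟦[]⟧ val σ ρ)

        -- One factor 2 leaves `t` and another leaves `V`, which reduces `t s = 16` to 4.
        n-size : ∀ f → V ≡ f ℕ.* 2 → n ℕ.* V′ ℕ.* (R ℕ.* f) ≡ 4
        n-size f p = ℕ.*-cancelʳ-≡ _ 4 4 (trans (lem n V′ R f) (trans (cong (λ z → n ℕ.* 2 ℕ.* (R ℕ.* (z ℕ.* V′))) (sym p))
          (trans (cong₂ ℕ._*_ (sym (trans (cong ∣_∣ t≡) (abs-* τ (+ 2)))) (sym (∣mixed∣ ρ⁺))) ts≡16)))
          where
          lem : ∀ n w r f → n ℕ.* w ℕ.* (r ℕ.* f) ℕ.* 4 ≡ n ℕ.* 2 ℕ.* (r ℕ.* (f ℕ.* 2 ℕ.* w))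
          lem = ℕSolver.solve-∀

        -- `V′` is a sum of two squares, one of them n². From n ≥ 2 it would follow that n V′ ≥ 8,
        -- although n V′ divides 4.
        n≡1 : n ≡ 1
        n≡1 = go n refl
          where
          f : ℕ
          f = ℕ.quotient 2∣V
          prod≡4 : n ℕ.* V′ ℕ.* (R ℕ.* f) ≡ 4
          prod≡4 = n-size f (ℕ._∣_.equality 2∣V)
          go : ∀ k → n ≡ k → n ≡ 1
          go 0 p = ⊥-elim (ℕ.0≢1+n {3} (trans (cong (λ n → n ℕ.* V′ ℕ.* (R ℕ.* f)) (sym p)) prod≡4))
          go 1 p = p
          go (suc (suc k)) p = ⊥-elim (ℕ.<⇒≱ (ℕ.≤ᵇ⇒≤ 5 8 _) (ℕ.≤-trans (ℕ.*-mono-≤ 2≤n 4≤V′) (ℕ.∣⇒≤ (ℕ.divides (R ℕ.* f)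
              (trans (sym prod≡4) (ℕ.*-comm (n ℕ.* V′) _))))))
            where
            2≤n : 2 ℕ.≤ n
            2≤n = subst (2 ℕ.≤_) (sym p) (ℕ.s≤s (ℕ.s≤s ℕ.z≤n))
            4≤V′ : 4 ℕ.≤ V′
            4≤V′ = subst (4 ℕ.≤_) (sym V′≡) (ℕ.≤-trans (ℕ.*-mono-≤ 2≤n 2≤n) (ℕ.m≤n+m (n ℕ.* n) (m ℕ.* m)))

        y′≡c²+1 : y′ ≡ c * c + + 1
        y′≡c²+1 = trans y′≡ (cong (λ z → c * c + z) (trans (square-abs τ) (cong (λ n → + (n ℕ.* n)) n≡1)))

        ρ′ : Vec ℤ 11
        ρ′ = b ∷ + 0 ∷ y ∷ x ∷ + 0 ∷ + 0 ∷ c ∷ + 0 ∷ qs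

        same : y′ ≡ c * c + + 1 → x′ ≡ c * + 2 → ρ⁺ ≡ ⟦ monic ρ′ ⟧* ρ′
        same p q = cong₂ (λ y′ x′ → b ∷ + 1 ∷ y ∷ x ∷ + 4 ∷ y′ ∷ x′ ∷ + 1 ∷ qs) p q

        absurd : ⊥
        absurd = 4∣1-absurd (All.head (Monic.absurd ρ′ (defects-at (monic ρ′) ρ′ (subst (Reduced ℓ) (same y′≡c²+1 x′≡) r)) q-odd u-odd))

      ± : ∀ t → D′ ≡ t ℕ.* t → ⟦ disc′ ⟧ ρ⁺ ≡ - (+ (t ℕ.* t))
      ± t p = go (abs-cases (⟦ disc′ ⟧ ρ⁺) p)
        where
        abs-cases : ∀ z {n} → ∣ z ∣ ≡ n → z ≡ + n ⊎ z ≡ - + n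
        abs-cases (+ n)    refl = inj₁ refl
        abs-cases -[1+ n ] refl = inj₂ refl
        go : ⟦ disc′ ⟧ ρ⁺ ≡ + (t ℕ.* t) ⊎ ⟦ disc′ ⟧ ρ⁺ ≡ - + (t ℕ.* t) → ⟦ disc′ ⟧ ρ⁺ ≡ - (+ (t ℕ.* t))
        go (inj₁ p) = ⊥-elim (nonsquare′ r (+ t) (trans p (sym (square-abs (+ t)))))
        go (inj₂ p) = p

      cases : (∃ λ e → D′ ≡ e ℕ.* ℓ × D ℕ.* e ℕ.* (s ℕ.* s) ≡ 256) ⊎
              (∃ λ e → D ≡ e ℕ.* ℓ × D′ ℕ.* e ℕ.* (s ℕ.* s) ≡ 256) → ⊥
      cases (inj₁ (e , _ , p)) =
        D≢1 (odd-∣-2^ 8 2∤D (subst (D ℕ.∣_) p (ℕ.∣m⇒∣m*n (s ℕ.* s) (ℕ.∣m⇒∣m*n e ℕ.∣-refl))))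
      cases (inj₂ (e , p , q)) = finish (dividing-16 D′ s (subst (λ n → n ℕ.* (s ℕ.* s) ≡ 256) (trans (cong (D′ ℕ.*_) e≡1) (ℕ.*-identityʳ D′)) q))
        where
        e≡1 : e ≡ 1
        e≡1 = odd-∣-2^ 8 (λ d → 2∤D (ℕ.∣-trans d (subst (e ℕ.∣_) (sym p) (ℕ.∣m⇒∣m*n ℓ ℕ.∣-refl))))
                (subst (e ℕ.∣_) q (ℕ.∣m⇒∣m*n (s ℕ.* s) (ℕ.∣n⇒∣m*n D′ ℕ.∣-refl)))
        finish : (∃ λ t → t ℕ.* s ≡ 16 × D′ ≡ t ℕ.* t) → ⊥
        finish (t , ts≡16 , D′≡t²) = absurd t ts≡16 (± t D′≡t²)

-- Symmetry between the two quadratic factors, and exhaustion of the leading coefficients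

module LeadingCoefficients where
  open import Data.List using (List; []; _∷_)
  open import Data.List.Relation.Unary.All as All using (All)
  open Forms
  open Congruence
  open Defects
  open TwoAdic
  open import Data.Integer using (-_; _+_; _*_; _-_; ∣_∣)
  open import Data.Fin.Properties using (all?; toℕ-fromℕ<)
  open import Data.Integer.Divisibility.Signed
  open import Data.List.Membership.Propositional using (_∈_)
  import Data.List.Membership.DecPropositional as DecMembership
  open import Data.List.Relation.Unary.Any using (here; there)
  open import Data.Product.Properties using (≡-dec)

  swapped : Vec (Expr ℤ 11) 11
  swapped = β ∷ α ∷ v′ ∷ u′ ∷ w′ ∷ v ∷ u ∷ w ∷ q₀ ∷ q₁ ∷ q₂ ∷ []

  swap-invariant : ∀ e → norm (e [ swapped ]) ≡ norm e → ∀ ρ → ⟦ e ⟧ (⟦ swapped ⟧* ρ) ≡ ⟦ e ⟧ ρ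
  swap-invariant e eq ρ = trans (sym (⟦[]⟧ e swapped ρ)) (identity (e [ swapped ]) e eq ρ)

  swap-defect : ∀ k → k ℕ.≤ 4 → norm (defect k [ swapped ]) ≡ norm (defect k)
  swap-defect 0 _ = refl
  swap-defect 1 _ = refl
  swap-defect 2 _ = refl
  swap-defect 3 _ = refl
  swap-defect 4 _ = refl
  swap-defect (suc (suc (suc (suc (suc _))))) (ℕ.s≤s (ℕ.s≤s (ℕ.s≤s (ℕ.s≤s ()))))

  swap : ∀ {ℓ} ρ → Reduced ℓ ρ → Reduced ℓ (⟦ swapped ⟧* ρ)
  swap {ℓ} ρ r = record
    { defects    = λ k k≤4 → subst (+ 4 ∣_) (sym (swap-invariant (defect k) (swap-defect k k≤4) ρ)) (defects r k k≤4)
    ; size       = trans (cong₂ ℕ._*_ (trans (cong₂ ℕ._*_ (cong ∣_∣ d) (cong ∣_∣ d′)) (ℕ.*-comm ∣ ⟦ disc′ ⟧ ρ ∣ ∣ ⟦ disc ⟧ ρ ∣))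
                                      (cong (λ z → ∣ z ∣ ℕ.* ∣ z ∣) (swap-invariant mixed refl ρ))) (size r)
    ; nonsquare  = λ k p → nonsquare′ r k (trans (sym d) p)
    ; nonsquare′ = λ k p → nonsquare r k (trans (sym d′) p)
    }
    where
    open Reduced
    d : ⟦ disc ⟧ (⟦ swapped ⟧* ρ) ≡ ⟦ disc′ ⟧ ρ
    d = sym (⟦[]⟧ disc swapped ρ)
    d′ : ⟦ disc′ ⟧ (⟦ swapped ⟧* ρ) ≡ ⟦ disc ⟧ ρ
    d′ = sym (⟦[]⟧ disc′ swapped ρ)

  swap-leads : ∀ {ℓ} a b c ρ → Reduced ℓ (⟦ leads a b c ⟧* ρ) → Reduced ℓ (⟦ leads a c b ⟧* (⟦ swapped ⟧* ρ))
  swap-leads {ℓ} a b c ρ r = subst (Reduced ℓ) (eq ρ) (swap (⟦ leads a b c ⟧* ρ) r)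
    where
    eq : ∀ ρ → ⟦ swapped ⟧* (⟦ leads a b c ⟧* ρ) ≡ ⟦ leads a c b ⟧* (⟦ swapped ⟧* ρ)
    eq (_ ∷ _ ∷ _ ∷ _ ∷ _ ∷ _ ∷ _ ∷ _ ∷ _ ∷ _ ∷ _ ∷ []) = refl

  shapes : List (ℕ × ℕ × ℕ)
  shapes = (4 , 1 , 1) ∷ (1 , 4 , 1) ∷ (1 , 1 , 4) ∷ (2 , 2 , 1) ∷ (2 , 1 , 2) ∷ (1 , 2 , 2) ∷ []

  -- Each entry divides 4 and so lies below 5; the 125 remaining triples are checked by decision.
  leads-table : ∀ a b c → a ℕ.* b ℕ.* c ≡ 4 → (a , b , c) ∈ shapes
  leads-table a b c eq = subst (_∈ shapes) (cong₂ _,_ (toℕ-fromℕ< a<5) (cong₂ _,_ (toℕ-fromℕ< b<5) (toℕ-fromℕ< c<5)))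
    (table (fromℕ< a<5) (fromℕ< b<5) (fromℕ< c<5)
      (trans (cong₂ ℕ._*_ (cong₂ ℕ._*_ (toℕ-fromℕ< a<5) (toℕ-fromℕ< b<5)) (toℕ-fromℕ< c<5)) eq))
    where
    ab∣4 : a ℕ.* b ℕ.∣ 4
    ab∣4 = ℕ.divides c (trans (sym eq) (ℕ.*-comm (a ℕ.* b) c))
    a<5 : a ℕ.< 5
    a<5 = ℕ.s≤s (ℕ.∣⇒≤ (ℕ.∣-trans (ℕ.∣m⇒∣m*n b ℕ.∣-refl) ab∣4))
    b<5 : b ℕ.< 5
    b<5 = ℕ.s≤s (ℕ.∣⇒≤ (ℕ.∣-trans (ℕ.∣n⇒∣m*n a ℕ.∣-refl) ab∣4))
    c<5 : c ℕ.< 5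
    c<5 = ℕ.s≤s (ℕ.∣⇒≤ (ℕ.divides (a ℕ.* b) (sym eq)))
    open DecMembership (≡-dec ℕ._≟_ (≡-dec ℕ._≟_ ℕ._≟_)) using (_∈?_)
    table : ∀ (i j k : Fin 5) → toℕ i ℕ.* toℕ j ℕ.* toℕ k ≡ 4 → (toℕ i , toℕ j , toℕ k) ∈ shapes
    table = from-yes (all? {5} λ i → all? {5} λ j → all? {5} λ k →
      (toℕ i ℕ.* toℕ j ℕ.* toℕ k ℕ.≟ 4) →-dec ((toℕ i , toℕ j , toℕ k) ∈? shapes))

  module _ {ℓ} (pr : Prime ℓ) (odd : ¬ 2 ℕ.∣ ℓ) where
    open Cases pr odd

    -- Either discriminant may absorb `ℓ`. As this shape is symmetric in f and g, exchanging them
    -- brings the second possibility to the first.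
    case411-odd : ∀ ρ → + 4 ∣ ⟦ 2 · q₂ :- Κ (+ 2) ⟧ ρ → ¬ Reduced ℓ (⟦ leads (+ 4) (+ 1) (+ 1) ⟧* ρ)
    case411-odd ρ q-odd r = cases (absorb pr odd (∣ ⟦ disc ⟧ ρ⁺ ∣) (∣ ⟦ disc′ ⟧ ρ⁺ ∣) (∣ ⟦ mixed ⟧ ρ⁺ ∣) (Reduced.size r))
      where
      ρ⁺ = ⟦ leads (+ 4) (+ 1) (+ 1) ⟧* ρ
      β-odd : + 4 ∣ ⟦ β :- one ⟧ ρ
      β-odd = Leads411.odd ρ (defects-at (leads (+ 4) (+ 1) (+ 1)) ρ r) q-odd
      eq : ⟦ swapped ⟧* ρ⁺ ≡ ⟦ leads (+ 4) (+ 1) (+ 1) ⟧* (⟦ swapped ⟧* ρ)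
      eq = lem ρ
        where
        lem : ∀ ρ → ⟦ swapped ⟧* (⟦ leads (+ 4) (+ 1) (+ 1) ⟧* ρ) ≡ ⟦ leads (+ 4) (+ 1) (+ 1) ⟧* (⟦ swapped ⟧* ρ)
        lem (_ ∷ _ ∷ _ ∷ _ ∷ _ ∷ _ ∷ _ ∷ _ ∷ _ ∷ _ ∷ _ ∷ []) = refl
      d : ⟦ disc ⟧ (⟦ leads (+ 4) (+ 1) (+ 1) ⟧* (⟦ swapped ⟧* ρ)) ≡ ⟦ disc′ ⟧ ρ⁺
      d = trans (cong ⟦ disc ⟧ (sym eq)) (sym (⟦[]⟧ disc swapped ρ⁺))
      m : ⟦ mixed ⟧ (⟦ leads (+ 4) (+ 1) (+ 1) ⟧* (⟦ swapped ⟧* ρ)) ≡ ⟦ mixed ⟧ ρ⁺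
      m = trans (cong ⟦ mixed ⟧ (sym eq)) (swap-invariant mixed refl ρ⁺)
      β-odd′ : + 4 ∣ ⟦ β :- one ⟧ (⟦ swapped ⟧* ρ)
      β-odd′ = subst (+ 4 ∣_) (⟦[]⟧ (β :- one) swapped ρ) β-odd
      cases : (∃ λ e → ∣ ⟦ disc′ ⟧ ρ⁺ ∣ ≡ e ℕ.* ℓ × ∣ ⟦ disc ⟧ ρ⁺ ∣ ℕ.* e ℕ.* (∣ ⟦ mixed ⟧ ρ⁺ ∣ ℕ.* ∣ ⟦ mixed ⟧ ρ⁺ ∣) ≡ 256) ⊎
              (∃ λ e → ∣ ⟦ disc ⟧ ρ⁺ ∣ ≡ e ℕ.* ℓ × ∣ ⟦ disc′ ⟧ ρ⁺ ∣ ℕ.* e ℕ.* (∣ ⟦ mixed ⟧ ρ⁺ ∣ ℕ.* ∣ ⟦ mixed ⟧ ρ⁺ ∣) ≡ 256) → ⊥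
      cases (inj₁ (e , _ , p)) = case411-core ρ e β-odd p
      cases (inj₂ (e , _ , p)) = case411-core (⟦ swapped ⟧* ρ) e β-odd′
        (trans (cong₂ (λ x y → ∣ x ∣ ℕ.* e ℕ.* (∣ y ∣ ℕ.* ∣ y ∣)) d m) p)

    leads-absurd : ∀ a b c → a ℕ.* b ℕ.* c ≡ 4 → ∀ ρ → ¬ Reduced ℓ (⟦ leads (+ a) (+ b) (+ c) ⟧* ρ)
    leads-absurd a b c eq ρ r = go (leads-table a b c eq) r
      where
      c411 : Reduced ℓ (⟦ leads (+ 4) (+ 1) (+ 1) ⟧* ρ) → ⊥
      c411 r = cases (parity₄ (⟦ q₂ ⟧ ρ))
        where
        cases : (+ 4 ∣ + 2 * ⟦ q₂ ⟧ ρ) ⊎ (+ 4 ∣ + 2 * ⟦ q₂ ⟧ ρ - + 2) → ⊥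
        cases (inj₁ e) = case411-even ρ e r
        cases (inj₂ e) = case411-odd ρ e r
      c141 : ∀ ρ → Reduced ℓ (⟦ leads (+ 1) (+ 4) (+ 1) ⟧* ρ) → ⊥
      c141 ρ r = cases (parity₄ (⟦ q₂ ⟧ ρ))
        where
        cases : (+ 4 ∣ + 2 * ⟦ q₂ ⟧ ρ) ⊎ (+ 4 ∣ + 2 * ⟦ q₂ ⟧ ρ - + 2) → ⊥
        cases (inj₁ e) = case141-even ρ e r
        cases (inj₂ e) = case141-odd ρ e r
      go : ∀ {a b c} → (a , b , c) ∈ shapes → Reduced ℓ (⟦ leads (+ a) (+ b) (+ c) ⟧* ρ) → ⊥
      go (here refl)                                         = c411
      go (there (here refl))                                 = c141 ρ
      go (there (there (here refl)))                         = λ r → c141 (⟦ swapped ⟧* ρ) (swap-leads (+ 1) (+ 1) (+ 4) ρ r)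
      go (there (there (there (here refl))))                 = case221 ρ
      go (there (there (there (there (here refl)))))         = λ r → case221 (⟦ swapped ⟧* ρ) (swap-leads (+ 2) (+ 1) (+ 2) ρ r)
      go (there (there (there (there (there (here refl)))))) = case122 ρ

-- The ring embedding of ℤ into ℚ

module Embedding where
  open import Defs using (ℤ→ℚ)
  open import Data.Rational using (_+_; _*_; -_; toℚᵘ)
  open import Data.Rational.Properties using (toℚᵘ-fromℚᵘ; toℚᵘ-injective; toℚᵘ-homo-+; toℚᵘ-homo-*; toℚᵘ-homo‿-)
  open import Data.Rational.Unnormalised as ℚᵘ using (mkℚᵘ; _≃_; *≡*)
  import Data.Rational.Unnormalised.Properties as ℚᵘ

  toℚᵘ-ℤ→ℚ : ∀ z → toℚᵘ (ℤ→ℚ z) ≃ mkℚᵘ z 0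
  toℚᵘ-ℤ→ℚ z = toℚᵘ-fromℚᵘ (mkℚᵘ z 0)

  ℤ→ℚ-injective : ∀ {x y} → ℤ→ℚ x ≡ ℤ→ℚ y → x ≡ y
  ℤ→ℚ-injective {x} {y} eq with ℚᵘ.≃-trans (ℚᵘ.≃-sym (toℚᵘ-ℤ→ℚ x)) (ℚᵘ.≃-trans (ℚᵘ.≃-reflexive (cong toℚᵘ eq)) (toℚᵘ-ℤ→ℚ y))
  ... | *≡* p = trans (sym (ℤ.*-identityʳ x)) (trans p (ℤ.*-identityʳ y))

  ℤ→ℚ-+ : ∀ x y → ℤ→ℚ (x ℤ.+ y) ≡ ℤ→ℚ x + ℤ→ℚ y
  ℤ→ℚ-+ x y = toℚᵘ-injective (begin
    toℚᵘ (ℤ→ℚ (x ℤ.+ y))                ≈⟨ toℚᵘ-ℤ→ℚ (x ℤ.+ y) ⟩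
    mkℚᵘ (x ℤ.+ y) 0                    ≈⟨ *≡* (cong (ℤ._* + 1) (sym (cong₂ ℤ._+_ (ℤ.*-identityʳ x) (ℤ.*-identityʳ y)))) ⟩
    mkℚᵘ x 0 ℚᵘ.+ mkℚᵘ y 0              ≈⟨ ℚᵘ.+-cong (ℚᵘ.≃-sym (toℚᵘ-ℤ→ℚ x)) (ℚᵘ.≃-sym (toℚᵘ-ℤ→ℚ y)) ⟩
    toℚᵘ (ℤ→ℚ x) ℚᵘ.+ toℚᵘ (ℤ→ℚ y)      ≈⟨ ℚᵘ.≃-sym (toℚᵘ-homo-+ (ℤ→ℚ x) (ℤ→ℚ y)) ⟩
    toℚᵘ (ℤ→ℚ x + ℤ→ℚ y)                ∎)
    where open ℚᵘ.≃-Reasoning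

  ℤ→ℚ-* : ∀ x y → ℤ→ℚ (x ℤ.* y) ≡ ℤ→ℚ x * ℤ→ℚ y
  ℤ→ℚ-* x y = toℚᵘ-injective (begin
    toℚᵘ (ℤ→ℚ (x ℤ.* y))                ≈⟨ toℚᵘ-ℤ→ℚ (x ℤ.* y) ⟩
    mkℚᵘ x 0 ℚᵘ.* mkℚᵘ y 0              ≈⟨ ℚᵘ.*-cong (ℚᵘ.≃-sym (toℚᵘ-ℤ→ℚ x)) (ℚᵘ.≃-sym (toℚᵘ-ℤ→ℚ y)) ⟩
    toℚᵘ (ℤ→ℚ x) ℚᵘ.* toℚᵘ (ℤ→ℚ y)      ≈⟨ ℚᵘ.≃-sym (toℚᵘ-homo-* (ℤ→ℚ x) (ℤ→ℚ y)) ⟩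
    toℚᵘ (ℤ→ℚ x * ℤ→ℚ y)                ∎)
    where open ℚᵘ.≃-Reasoning

  ℤ→ℚ-neg : ∀ x → ℤ→ℚ (ℤ.- x) ≡ - ℤ→ℚ x
  ℤ→ℚ-neg x = toℚᵘ-injective (begin
    toℚᵘ (ℤ→ℚ (ℤ.- x))     ≈⟨ toℚᵘ-ℤ→ℚ (ℤ.- x) ⟩
    ℚᵘ.- mkℚᵘ x 0          ≈⟨ ℚᵘ.-‿cong (ℚᵘ.≃-sym (toℚᵘ-ℤ→ℚ x)) ⟩
    ℚᵘ.- toℚᵘ (ℤ→ℚ x)      ≈⟨ ℚᵘ.≃-sym (toℚᵘ-homo‿- (ℤ→ℚ x)) ⟩
    toℚᵘ (- ℤ→ℚ x)         ∎)
    where open ℚᵘ.≃-Reasoning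

-- Symbolic evaluation of the discriminant determinant

module Determinants where
  open import Defs
  open Forms
  open Embedding
  open import Data.Rational using (_+_; _*_; -_)
  open import Data.Rational.Properties using (*-identityˡ; neg-distribˡ-*)
  open import Data.Bool using (Bool; true; false; if_then_else_; _∧_)

  sumFin-cong : ∀ n {f g : Fin n → ℚ} → (∀ i → f i ≡ g i) → sumFin n f ≡ sumFin n g
  sumFin-cong zero    f≡g = refl
  sumFin-cong (suc n) f≡g = cong₂ _+_ (f≡g Fin.zero) (sumFin-cong n (λ i → f≡g (Fin.suc i)))

  record Expansion (n : ℕ) : Set where
    field
      expand : ∀ M → det (suc n) M ≡
        sumFin (suc n) (λ j → (signQ (toℕ j) * M Fin.zero j) * det n (λ r c → M (Fin.suc r) (punchIn j c)))
  open Expansion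

  -- The signs in det are a local function of its definition, hence only accessible by computation on a numeral size.
  expansion-0 : Expansion 0
  expansion-0 .expand M = refl
  expansion-1 : Expansion 1
  expansion-1 .expand M = refl
  expansion-2 : Expansion 2
  expansion-2 .expand M = refl
  expansion-3 : Expansion 3
  expansion-3 .expand M = refl
  expansion-4 : Expansion 4
  expansion-4 .expand M = refl
  expansion-5 : Expansion 5
  expansion-5 .expand M = refl
  expansion-6 : Expansion 6
  expansion-6 .expand M = refl
  expansion-7 : Expansion 7
  expansion-7 .expand M = refl
  expansion-8 : Expansion 8
  expansion-8 .expand M = refl
  expansion-9 : Expansion 9
  expansion-9 .expand M = refl

  det-expand : ∀ n → n ℕ.≤ 9 → Expansion n
  det-expand 0 _ = expansion-0
  det-expand 1 _ = expansion-1
  det-expand 2 _ = expansion-2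
  det-expand 3 _ = expansion-3
  det-expand 4 _ = expansion-4
  det-expand 5 _ = expansion-5
  det-expand 6 _ = expansion-6
  det-expand 7 _ = expansion-7
  det-expand 8 _ = expansion-8
  det-expand 9 _ = expansion-9
  det-expand (suc (suc (suc (suc (suc (suc (suc (suc (suc (suc _))))))))))
    (ℕ.s≤s (ℕ.s≤s (ℕ.s≤s (ℕ.s≤s (ℕ.s≤s (ℕ.s≤s (ℕ.s≤s (ℕ.s≤s (ℕ.s≤s ())))))))))

  -- The cofactor expansion of a 10 × 10 matrix has 10! terms. The matrix is sparse, and recognising
  -- literal zeros while building sums and products discards the vanishing branches.
  isZero : ∀ {n} → Expr ℤ n → Bool
  isZero (Κ (+ 0)) = true
  isZero _         = false

  infixl 6 _⊹_
  infixl 7 _⋆_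
  _⊹_ _⋆_ : ∀ {n} → Expr ℤ n → Expr ℤ n → Expr ℤ n
  e ⊹ f = if isZero e then f else if isZero f then e else e :+ f
  e ⋆ f = if isZero e then Κ (+ 0) else if isZero f then Κ (+ 0) else e :* f

  signed : ∀ {n} → ℕ → Expr ℤ n → Expr ℤ n
  signed zero          e = e
  signed (suc zero)    e = if isZero e then Κ (+ 0) else :- e
  signed (suc (suc k)) e = signed k e

  sumFinE : ∀ {m} n → (Fin n → Expr ℤ m) → Expr ℤ m
  sumFinE zero    f = Κ (+ 0)
  sumFinE (suc n) f = f Fin.zero ⊹ sumFinE n (λ i → f (Fin.suc i))

  detE : ∀ {m} n → (Fin n → Fin n → Expr ℤ m) → Expr ℤ m
  detE zero    M = Κ (+ 1)
  detE (suc n) M = sumFinE (suc n) (λ j → signed (toℕ j) (M Fin.zero j) ⋆ detE n (λ r c → M (Fin.suc r) (punchIn j c)))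

  discMatE : ∀ {m} (n : ℕ) → (ℕ → Expr ℤ m) → ℕ → ℕ → Expr ℤ m
  discMatE n a r c =
    if suc r ≤ᵇ (n ∸ 2) then
      (if (r ≤ᵇ c) ∧ ((c ∸ r) ≤ᵇ n) then a (n ∸ (c ∸ r)) else Κ (+ 0))
    else if r ≤ᵇ (n ∸ 2) then
      (if suc c ≤ᵇ n then signed 1 (Κ (+ suc c) ⋆ a (n ∸ suc c)) else Κ (+ 0))
    else
      (if (r ≤ᵇ (c ℕ.+ (n ∸ 1))) ∧ (((c ℕ.+ (n ∸ 1)) ∸ r) ≤ᵇ (n ∸ 1))
       then Κ (+ (n ∸ ((c ℕ.+ (n ∸ 1)) ∸ r))) ⋆ a (n ∸ ((c ℕ.+ (n ∸ 1)) ∸ r))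
       else Κ (+ 0))

  opaque
    -- The minus sign is that of degree 6, where n(n-1)/2 = 15 is odd. Opacity keeps the expanded
    -- determinant out of conversion checks.
    discFormE : ∀ {m} (n : ℕ) → (ℕ → Expr ℤ m) → Expr ℤ m
    discFormE n e = :- detE ((n ∸ 1) ℕ.+ (n ∸ 1)) (λ r c → discMatE n e (toℕ r) (toℕ c))

  module Value {m} (ρ : Vec ℤ m) where
    val-of : Expr ℤ m → ℚ
    val-of e = ℤ→ℚ (⟦ e ⟧ ρ)

    isZero-sound : ∀ e → isZero e ≡ true → ⟦ e ⟧ ρ ≡ + 0
    isZero-sound (Κ (+ 0)) _ = refl
    isZero-sound (Κ (+ suc n)) ()
    isZero-sound (Κ (-[1+ n ])) ()
    isZero-sound (Ι x) ()
    isZero-sound (e :+ f) ()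
    isZero-sound (e :* f) ()
    isZero-sound (e ⊛ n) ()
    isZero-sound (:- e) ()

    ⟦⊹⟧ : ∀ e f → ⟦ e ⊹ f ⟧ ρ ≡ ⟦ e ⟧ ρ ℤ.+ ⟦ f ⟧ ρ
    ⟦⊹⟧ e f with isZero e in p
    ... | true = sym (trans (cong (ℤ._+ ⟦ f ⟧ ρ) (isZero-sound e p)) (ℤ.+-identityˡ (⟦ f ⟧ ρ)))
    ... | false with isZero f in q
    ... | true  = sym (trans (cong (λ x → ⟦ e ⟧ ρ ℤ.+ x) (isZero-sound f q)) (ℤ.+-identityʳ (⟦ e ⟧ ρ)))
    ... | false = refl

    ⟦⋆⟧ : ∀ e f → ⟦ e ⋆ f ⟧ ρ ≡ ⟦ e ⟧ ρ ℤ.* ⟦ f ⟧ ρ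
    ⟦⋆⟧ e f with isZero e in p
    ... | true = sym (trans (cong (ℤ._* ⟦ f ⟧ ρ) (isZero-sound e p)) (ℤ.*-zeroˡ (⟦ f ⟧ ρ)))
    ... | false with isZero f in q
    ... | true  = sym (trans (cong (λ x → ⟦ e ⟧ ρ ℤ.* x) (isZero-sound f q)) (ℤ.*-zeroʳ (⟦ e ⟧ ρ)))
    ... | false = refl

    val-⋆ : ∀ e f → val-of (e ⋆ f) ≡ val-of e * val-of f
    val-⋆ e f = trans (cong ℤ→ℚ (⟦⋆⟧ e f)) (ℤ→ℚ-* (⟦ e ⟧ ρ) (⟦ f ⟧ ρ))

    val-neg : ∀ e → val-of (signed 1 e) ≡ - val-of e
    val-neg e with isZero e in p
    ... | true  = sym (cong -_ (cong ℤ→ℚ (isZero-sound e p)))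
    ... | false = ℤ→ℚ-neg (⟦ e ⟧ ρ)

    val-signed : ∀ k e → val-of (signed k e) ≡ signQ k * val-of e
    val-signed zero          e = sym (*-identityˡ _)
    val-signed (suc zero)    e = trans (val-neg e) (sym (trans (sym (neg-distribˡ-* 1ℚ (val-of e))) (cong -_ (*-identityˡ _))))
    val-signed (suc (suc k)) e = val-signed k e

    val-sumFin : ∀ n (f : Fin n → Expr ℤ m) → val-of (sumFinE n f) ≡ sumFin n (λ i → val-of (f i))
    val-sumFin zero    f = refl
    val-sumFin (suc n) f = trans (cong ℤ→ℚ (⟦⊹⟧ (f Fin.zero) (sumFinE n (λ i → f (Fin.suc i)))))
      (trans (ℤ→ℚ-+ (⟦ f Fin.zero ⟧ ρ) _) (cong (λ x → val-of (f Fin.zero) + x) (val-sumFin n (λ i → f (Fin.suc i)))))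

    val-det : ∀ n → n ℕ.≤ 10 → ∀ M (E : Fin n → Fin n → Expr ℤ m) → (∀ r c → M r c ≡ val-of (E r c)) →
              det n M ≡ val-of (detE n E)
    val-det zero    _   M E eq = refl
    val-det (suc n) n≤9 M E eq = trans (expand (det-expand n (ℕ.≤-pred n≤9)) M)
      (trans (sumFin-cong (suc n) entry) (sym (val-sumFin (suc n) row)))
      where
      row : Fin (suc n) → Expr ℤ m
      row j = signed (toℕ j) (E Fin.zero j) ⋆ detE n (λ r c → E (Fin.suc r) (punchIn j c))
      minor : ∀ j → det n (λ r c → M (Fin.suc r) (punchIn j c)) ≡ val-of (detE n (λ r c → E (Fin.suc r) (punchIn j c)))
      minor j = val-det n (ℕ.≤-trans (ℕ.n≤1+n n) n≤9) _ _ (λ r c → eq (Fin.suc r) (punchIn j c))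
      entry : ∀ j → (signQ (toℕ j) * M Fin.zero j) * det n (λ r c → M (Fin.suc r) (punchIn j c)) ≡
                    val-of (row j)
      entry j = trans (cong₂ _*_ (trans (cong (λ x → signQ (toℕ j) * x) (eq Fin.zero j)) (sym (val-signed (toℕ j) (E Fin.zero j)))) (minor j))
                      (sym (val-⋆ (signed (toℕ j) (E Fin.zero j)) (detE n (λ r c → E (Fin.suc r) (punchIn j c)))))

    val-if : ∀ b {x y : ℚ} {e f : Expr ℤ m} → x ≡ val-of e → y ≡ val-of f →
             (if b then x else y) ≡ val-of (if b then e else f)
    val-if true  p q = p
    val-if false p q = q

    val-discMat : ∀ n (a : ℕ → ℚ) (e : ℕ → Expr ℤ m) → (∀ k → k ℕ.≤ n → a k ≡ val-of (e k)) →
                  ∀ r c → discMat n a r c ≡ val-of (discMatE n e r c)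
    val-discMat n a e eq r c =
      val-if (suc r ≤ᵇ (n ∸ 2)) (val-if ((r ≤ᵇ c) ∧ ((c ∸ r) ≤ᵇ n)) (at (c ∸ r)) refl)
        (val-if (r ≤ᵇ (n ∸ 2))
          (val-if (suc c ≤ᵇ n) (trans (cong -_ (scaled (suc c) (suc c))) (sym (val-neg (Κ (+ suc c) ⋆ e (n ∸ suc c))))) refl)
          (val-if ((r ≤ᵇ (c ℕ.+ (n ∸ 1))) ∧ (((c ℕ.+ (n ∸ 1)) ∸ r) ≤ᵇ (n ∸ 1)))
            (scaled (n ∸ ((c ℕ.+ (n ∸ 1)) ∸ r)) ((c ℕ.+ (n ∸ 1)) ∸ r)) refl))
      where
      at : ∀ i → a (n ∸ i) ≡ val-of (e (n ∸ i))
      at i = eq (n ∸ i) (ℕ.m∸n≤m n i)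
      scaled : ∀ k i → ℕ→ℚ k * a (n ∸ i) ≡ val-of (Κ (+ k) ⋆ e (n ∸ i))
      scaled k i = trans (cong (λ x → ℕ→ℚ k * x) (at i)) (sym (val-⋆ (Κ (+ k)) (e (n ∸ i))))

    opaque
      unfolding discFormE

      val-discForm : ∀ n → (n ∸ 1) ℕ.+ (n ∸ 1) ℕ.≤ 10 → signQ ((n ℕ.* (n ∸ 1)) ℕ./ 2) ≡ - 1ℚ →
                     ∀ (a : ℕ → ℚ) (e : ℕ → Expr ℤ m) → (∀ k → k ℕ.≤ n → a k ≡ val-of (e k)) →
                     discForm n a ≡ val-of (discFormE n e)
      val-discForm n n≤ sign a e eq = trans (cong₂ _*_ sign
        (val-det ((n ∸ 1) ℕ.+ (n ∸ 1)) n≤ (λ r c → discMat n a (toℕ r) (toℕ c)) (λ r c → discMatE n e (toℕ r) (toℕ c))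
          (λ r c → val-discMat n a e eq (toℕ r) (toℕ c)))) (minus (⟦ E ⟧ ρ))
        where
        E : Expr ℤ m
        E = detE ((n ∸ 1) ℕ.+ (n ∸ 1)) (λ r c → discMatE n e (toℕ r) (toℕ c))
        minus : ∀ z → (- 1ℚ) * ℤ→ℚ z ≡ ℤ→ℚ (ℤ.- z)
        minus z = trans (sym (neg-distribˡ-* 1ℚ (ℤ→ℚ z))) (trans (cong -_ (*-identityˡ (ℤ→ℚ z))) (sym (ℤ→ℚ-neg z)))

-- Product formula for the discriminant of linear × quadratic × quadratic

module QuinticDiscriminant where
  open Forms
  open Congruence
  open Determinants

  module Quintic where
    a b c d e A B : Expr ℤ 7
    a = Ι (# 0)
    b = Ι (# 1)
    c = Ι (# 2)
    d = Ι (# 3)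
    e = Ι (# 4)
    A = Ι (# 5)
    B = Ι (# 6)

    -- (A x + B) (a x⁴ + b x³ + c x² + d x + e)
    coeffs : ℕ → Expr ℤ 7
    coeffs 0 = B :* e
    coeffs 1 = A :* e :+ B :* d
    coeffs 2 = A :* d :+ B :* c
    coeffs 3 = A :* c :+ B :* b
    coeffs 4 = A :* b :+ B :* a
    coeffs 5 = A :* a
    coeffs _ = Κ (+ 0)

    -- `disc₄` is the classical sixteen-term discriminant of the quartic, and `value` the resultant
    -- of the linear factor with it.
    lead disc₄ value : Expr ℤ 7
    lead = A :* a
    disc₄ =
         256 · a ⊛ 3 :* e ⊛ 3 :- 192 · a ⊛ 2 :* b :* d :* e ⊛ 2 :- 128 · a ⊛ 2 :* c ⊛ 2 :* e ⊛ 2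
      :+ 144 · a ⊛ 2 :* c :* d ⊛ 2 :* e :- 27 · a ⊛ 2 :* d ⊛ 4 :+ 144 · a :* b ⊛ 2 :* c :* e ⊛ 2
      :- 6 · a :* b ⊛ 2 :* d ⊛ 2 :* e :- 80 · a :* b :* c ⊛ 2 :* d :* e :+ 18 · a :* b :* c :* d ⊛ 3
      :+ 16 · a :* c ⊛ 4 :* e :- 4 · a :* c ⊛ 3 :* d ⊛ 2 :- 27 · b ⊛ 4 :* e ⊛ 2 :+ 18 · b ⊛ 3 :* c :* d :* e
      :- 4 · b ⊛ 3 :* d ⊛ 3 :- 4 · b ⊛ 2 :* c ⊛ 3 :* e :+ b ⊛ 2 :* c ⊛ 2 :* d ⊛ 2
    value = a :* B ⊛ 4 :- b :* B ⊛ 3 :* A :+ c :* B ⊛ 2 :* A ⊛ 2 :- d :* B :* A ⊛ 3 :+ e :* A ⊛ 4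

    opaque
      unfolding discFormE

      -- A sextic form with vanishing top coefficient has discriminant a₅² times that of the
      -- quintic, and disc(l h) = disc(h) Res(l, h)². The quartic is left generic here and split
      -- only afterwards, which keeps the normal form of the determinant in seven variables.
      discriminant : norm (discFormE 6 coeffs) ≡ norm (lead :* lead :* disc₄ :* (value :* value))
      discriminant = refl

  open Quintic

  quartic : ℕ → Expr ℤ 11
  quartic = convE quadC quadC′

  factors : Vec (Expr ℤ 11) 7
  factors = quartic 4 ∷ quartic 3 ∷ quartic 2 ∷ quartic 1 ∷ quartic 0 ∷ α ∷ β ∷ []

  disc₄-factors : norm (disc₄ [ factors ]) ≡ norm (disc :* disc′ :* (res :* res))
  disc₄-factors = refl

  value-factors : norm (value [ factors ]) ≡ norm (val :* val′)
  value-factors = refl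

  coeffs-factors : ∀ k → k ℕ.≤ 5 → norm (coeffs k [ factors ]) ≡ norm (prodC k)
  coeffs-factors 0 _ = refl
  coeffs-factors 1 _ = refl
  coeffs-factors 2 _ = refl
  coeffs-factors 3 _ = refl
  coeffs-factors 4 _ = refl
  coeffs-factors 5 _ = refl
  coeffs-factors (suc (suc (suc (suc (suc (suc _)))))) (ℕ.s≤s (ℕ.s≤s (ℕ.s≤s (ℕ.s≤s (ℕ.s≤s ())))))

-- From the rational discriminant to an equation between natural numbers

module DiscriminantOfProduct where
  open import Defs
  open Forms
  open Congruence
  open Embedding
  open Determinants
  open QuinticDiscriminant
  open Quintic using (coeffs; disc₄; value; lead; discriminant)
  open import Data.Integer using (_*_; -_; ∣_∣)

  specialise : ∀ {m n} (e : Expr ℤ m) (σ : Vec (Expr ℤ n) m) (f : Expr ℤ n) → norm (e [ σ ]) ≡ norm f →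
               ∀ ρ → ⟦ e ⟧ (⟦ σ ⟧* ρ) ≡ ⟦ f ⟧ ρ
  specialise e σ f eq ρ = trans (sym (⟦[]⟧ e σ ρ)) (identity (e [ σ ]) f eq ρ)

  discriminantOf : ℤ → ℤ → ℤ → ℤ → ℤ → ℤ
  discriminantOf l d d′ r y = l * l * (d * d′ * (r * r)) * (y * y)

  ⟦product⟧ : ∀ {n} (d d′ r : Expr ℤ n) ρ → ⟦ d :* d′ :* (r :* r) ⟧ ρ ≡ ⟦ d ⟧ ρ * ⟦ d′ ⟧ ρ * (⟦ r ⟧ ρ * ⟦ r ⟧ ρ)
  ⟦product⟧ d d′ r ρ = refl

  ⟦shape⟧ : ∀ {n} (l x y : Expr ℤ n) ρ l₁ d₁ d₂ r₁ y₁ → ⟦ l ⟧ ρ ≡ l₁ → ⟦ x ⟧ ρ ≡ d₁ * d₂ * (r₁ * r₁) → ⟦ y ⟧ ρ ≡ y₁ →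
            ⟦ l :* l :* x :* (y :* y) ⟧ ρ ≡ discriminantOf l₁ d₁ d₂ r₁ y₁
  ⟦shape⟧ l x y ρ l₁ d₁ d₂ r₁ y₁ p q s =
    cong₂ _*_ (cong₂ _*_ (cong₂ _*_ p p) q) (cong₂ _*_ s s)

  discForm-factors : ∀ ρ (F : ℕ → ℚ) → (∀ k → k ℕ.≤ 5 → F k ≡ ℤ→ℚ (⟦ prodC k ⟧ ρ)) → F 6 ≡ 0ℚ →
    discForm 6 F ≡ ℤ→ℚ (discriminantOf (⟦ prodC 5 ⟧ ρ) (⟦ disc ⟧ ρ) (⟦ disc′ ⟧ ρ) (⟦ res ⟧ ρ) (⟦ val :* val′ ⟧ ρ))
  discForm-factors ρ F F≡ F6≡0 =
    trans (Value.val-discForm ρ₇ 6 (ℕ.≤ᵇ⇒≤ 10 10 _) refl F coeffs entries) (cong ℤ→ℚ value≡)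
    where
    ρ₇ = ⟦ factors ⟧* ρ
    entries : ∀ k → k ℕ.≤ 6 → F k ≡ ℤ→ℚ (⟦ coeffs k ⟧ ρ₇)
    entries k k≤6 = cases (ℕ.m≤n⇒m<n∨m≡n k≤6)
      where
      cases : (k ℕ.< 6 ⊎ k ≡ 6) → F k ≡ ℤ→ℚ (⟦ coeffs k ⟧ ρ₇)
      cases (inj₁ k<6)  = trans (F≡ k (ℕ.≤-pred k<6)) (cong ℤ→ℚ (sym (specialise (coeffs k) factors (prodC k) (coeffs-factors k (ℕ.≤-pred k<6)) ρ)))
      cases (inj₂ refl) = F6≡0
    lead≡ : ⟦ lead ⟧ ρ₇ ≡ ⟦ prodC 5 ⟧ ρ
    lead≡ = specialise lead factors (prodC 5) refl ρ
    disc₄≡ : ⟦ disc₄ ⟧ ρ₇ ≡ ⟦ disc :* disc′ :* (res :* res) ⟧ ρ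
    disc₄≡ = specialise disc₄ factors (disc :* disc′ :* (res :* res)) disc₄-factors ρ
    y≡ : ⟦ value ⟧ ρ₇ ≡ ⟦ val :* val′ ⟧ ρ
    y≡ = specialise value factors (val :* val′) value-factors ρ
    value≡ : ⟦ discFormE 6 coeffs ⟧ ρ₇ ≡
             discriminantOf (⟦ prodC 5 ⟧ ρ) (⟦ disc ⟧ ρ) (⟦ disc′ ⟧ ρ) (⟦ res ⟧ ρ) (⟦ val :* val′ ⟧ ρ)
    value≡ = trans (identity (discFormE 6 coeffs) (lead :* lead :* disc₄ :* (value :* value)) discriminant ρ₇)
      (⟦shape⟧ lead disc₄ value ρ₇ (⟦ prodC 5 ⟧ ρ) (⟦ disc ⟧ ρ) (⟦ disc′ ⟧ ρ) (⟦ res ⟧ ρ) (⟦ val :* val′ ⟧ ρ) lead≡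
         (trans disc₄≡ (⟦product⟧ disc disc′ res ρ)) y≡)

  abs-of-Δ : ∀ z ℓ → ℚ.∣ ℤ→ℚ z ℚ.* ((+ 1) ℚ./ 4096) ∣ ≡ ℕ→ℚ ℓ → ∣ z ∣ ≡ 4096 ℕ.* ℓ
  abs-of-Δ z ℓ eq = cases (ℚ.∣p∣≡p∨∣p∣≡-p (ℤ→ℚ z ℚ.* c))
    where
    c = (+ 1) ℚ./ 4096
    cancel : ∀ x → ℤ→ℚ x ℚ.* c ≡ ℕ→ℚ ℓ → ∣ x ∣ ≡ 4096 ℕ.* ℓ
    cancel x p = trans (cong ∣_∣ (ℤ→ℚ-injective {x} {+ ℓ * + 4096} (begin
      ℤ→ℚ x                               ≡⟨ ℚ.*-identityʳ (ℤ→ℚ x) ⟨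
      ℤ→ℚ x ℚ.* (c ℚ.* ℤ→ℚ (+ 4096))      ≡⟨ ℚ.*-assoc (ℤ→ℚ x) c (ℤ→ℚ (+ 4096)) ⟨
      ℤ→ℚ x ℚ.* c ℚ.* ℤ→ℚ (+ 4096)        ≡⟨ cong (λ y → y ℚ.* ℤ→ℚ (+ 4096)) p ⟩
      ℤ→ℚ (+ ℓ) ℚ.* ℤ→ℚ (+ 4096)          ≡⟨ ℤ→ℚ-* (+ ℓ) (+ 4096) ⟨
      ℤ→ℚ (+ ℓ * + 4096)                  ∎))) (trans (ℤ.abs-* (+ ℓ) (+ 4096)) (ℕ.*-comm ℓ 4096))
      where open ≡-Reasoning
    cases : (ℚ.∣ ℤ→ℚ z ℚ.* c ∣ ≡ ℤ→ℚ z ℚ.* c) ⊎ (ℚ.∣ ℤ→ℚ z ℚ.* c ∣ ≡ ℚ.- (ℤ→ℚ z ℚ.* c)) → ∣ z ∣ ≡ 4096 ℕ.* ℓ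
    cases (inj₁ p) = cancel z (trans (sym p) eq)
    cases (inj₂ p) = trans (sym (ℤ.∣-i∣≡∣i∣ z)) (cancel (- z) (trans (trans (cong (ℚ._* c) (ℤ→ℚ-neg z)) (sym (ℚ.neg-distribˡ-* (ℤ→ℚ z) c))) (trans (sym p) eq)))

  -- The leading coefficient 4 of F enters squared, and 4096 = 16 · 256. The computation is done for
  -- variables in place of the values, so that these stay folded.
  discriminantOf-abs : ∀ ρ ℓ → ∣ discriminantOf (+ 4) (⟦ disc ⟧ ρ) (⟦ disc′ ⟧ ρ) (⟦ res ⟧ ρ) (⟦ val :* val′ ⟧ ρ) ∣ ≡ 4096 ℕ.* ℓ →
    ∣ ⟦ disc ⟧ ρ ∣ ℕ.* ∣ ⟦ disc′ ⟧ ρ ∣ ℕ.* (∣ ⟦ mixed ⟧ ρ ∣ ℕ.* ∣ ⟦ mixed ⟧ ρ ∣) ≡ 256 ℕ.* ℓ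
  discriminantOf-abs ρ ℓ = general (⟦ disc ⟧ ρ) (⟦ disc′ ⟧ ρ) (⟦ res ⟧ ρ) (⟦ val :* val′ ⟧ ρ)
    where
    general : ∀ d d′ r y → ∣ discriminantOf (+ 4) d d′ r y ∣ ≡ 4096 ℕ.* ℓ →
              ∣ d ∣ ℕ.* ∣ d′ ∣ ℕ.* (∣ r * y ∣ ℕ.* ∣ r * y ∣) ≡ 256 ℕ.* ℓ
    general d d′ r y eq = ℕ.*-cancelˡ-≡ _ _ 16 (begin
      16 ℕ.* (∣ d ∣ ℕ.* ∣ d′ ∣ ℕ.* (∣ r * y ∣ ℕ.* ∣ r * y ∣))
        ≡⟨ cong (λ s → 16 ℕ.* (∣ d ∣ ℕ.* ∣ d′ ∣ ℕ.* (s ℕ.* s))) (ℤ.abs-* r y) ⟩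
      16 ℕ.* (∣ d ∣ ℕ.* ∣ d′ ∣ ℕ.* (∣ r ∣ ℕ.* ∣ y ∣ ℕ.* (∣ r ∣ ℕ.* ∣ y ∣)))
        ≡⟨ lem (∣ d ∣) (∣ d′ ∣) (∣ r ∣) (∣ y ∣) ⟩
      16 ℕ.* (∣ d ∣ ℕ.* ∣ d′ ∣ ℕ.* (∣ r ∣ ℕ.* ∣ r ∣)) ℕ.* (∣ y ∣ ℕ.* ∣ y ∣)
        ≡⟨ cong₂ ℕ._*_ (cong (16 ℕ.*_) (cong₂ ℕ._*_ (ℤ.abs-* d d′) (ℤ.abs-* r r))) (ℤ.abs-* y y) ⟨
      16 ℕ.* (∣ d * d′ ∣ ℕ.* ∣ r * r ∣) ℕ.* ∣ y * y ∣
        ≡⟨ cong (λ s → 16 ℕ.* s ℕ.* ∣ y * y ∣) (ℤ.abs-* (d * d′) (r * r)) ⟨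
      16 ℕ.* ∣ d * d′ * (r * r) ∣ ℕ.* ∣ y * y ∣
        ≡⟨ cong (λ s → s ℕ.* ∣ y * y ∣) (ℤ.abs-* (+ 16) (d * d′ * (r * r))) ⟨
      ∣ + 16 * (d * d′ * (r * r)) ∣ ℕ.* ∣ y * y ∣
        ≡⟨ ℤ.abs-* (+ 16 * (d * d′ * (r * r))) (y * y) ⟨
      ∣ discriminantOf (+ 4) d d′ r y ∣
        ≡⟨ eq ⟩
      4096 ℕ.* ℓ
        ≡⟨ ℕ.*-assoc 16 256 ℓ ⟩
      16 ℕ.* (256 ℕ.* ℓ) ∎)
      where
      open ≡-Reasoning
      lem : ∀ d e r y → 16 ℕ.* (d ℕ.* e ℕ.* (r ℕ.* y ℕ.* (r ℕ.* y))) ≡ 16 ℕ.* (d ℕ.* e ℕ.* (r ℕ.* r)) ℕ.* (y ℕ.* y)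
      lem = ℕSolver.solve-∀

-- Gauss's lemma and the descent to integral factors

module GaussLemma where
  open import Data.List using (List; []; _∷_)
  open import Data.List.Relation.Unary.All using (All; []; _∷_)
  open import Data.Integer using (_+_; _*_; ∣_∣)
  open import Data.Integer.Divisibility.Signed
  open import Data.Nat.Induction using (<-rec)
  open import Data.Nat.ListAction using (product)
  open import Data.Nat.Primality.Factorisation using (factorise; module PrimeFactorisation)
  open import Relation.Binary.Definitions using (tri<; tri≈; tri>)

  sumZ : ℕ → (ℕ → ℤ) → ℤ
  sumZ zero    g = + 0
  sumZ (suc n) g = sumZ n g + g n

  coeffZ : ∀ {n} → Vec ℤ n → ℕ → ℤ
  coeffZ []       i       = + 0
  coeffZ (a ∷ as) zero    = a
  coeffZ (a ∷ as) (suc i) = coeffZ as i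

  convZ : (ℕ → ℤ) → (ℕ → ℤ) → ℕ → ℤ
  convZ f g k = sumZ (suc k) (λ i → f i * g (k ∸ i))

  sumZ-cong : ∀ n {f g : ℕ → ℤ} → (∀ i → f i ≡ g i) → sumZ n f ≡ sumZ n g
  sumZ-cong zero    eq = refl
  sumZ-cong (suc n) eq = cong₂ _+_ (sumZ-cong n eq) (eq n)

  sumZ-*ʳ : ∀ n f c → sumZ n (λ i → f i * c) ≡ sumZ n f * c
  sumZ-*ʳ zero    f c = refl
  sumZ-*ʳ (suc n) f c = trans (cong (_+ f n * c) (sumZ-*ʳ n f c)) (sym (ℤ.*-distribʳ-+ c (sumZ n f) (f n)))

  convZ-scaleˡ : ∀ f f′ g c → (∀ i → f i ≡ f′ i * c) → ∀ k → convZ f g k ≡ convZ f′ g k * c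
  convZ-scaleˡ f f′ g c eq k = trans (sumZ-cong (suc k) (λ i → trans (cong (_* g (k ∸ i)) (eq i)) (lem (f′ i) c (g (k ∸ i)))))
                                         (sumZ-*ʳ (suc k) (λ i → f′ i * g (k ∸ i)) c)
    where
    lem : ∀ x c y → x * c * y ≡ x * y * c
    lem = solve-∀

  convZ-scaleʳ : ∀ f g g′ c → (∀ i → g i ≡ g′ i * c) → ∀ k → convZ f g k ≡ convZ f g′ k * c
  convZ-scaleʳ f g g′ c eq k = trans (sumZ-cong (suc k) (λ i → trans (cong (f i *_) (eq (k ∸ i))) (sym (ℤ.*-assoc (f i) (g′ (k ∸ i)) c))))
                                         (sumZ-*ʳ (suc k) (λ i → f i * g′ (k ∸ i)) c)

  module Gauss {p} (pr : Prime p) where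
    euclid : ∀ x y → + p ∣ x * y → (+ p ∣ x) ⊎ (+ p ∣ y)
    euclid x y d with euclidsLemma ∣ x ∣ ∣ y ∣ pr (subst (p ℕ.∣_) (ℤ.abs-* x y) (∣⇒∣ᵤ d))
    ... | inj₁ e = inj₁ (∣ᵤ⇒∣ e)
    ... | inj₂ e = inj₂ (∣ᵤ⇒∣ e)

    ∣-sum : ∀ n h → (∀ i → i ℕ.< n → + p ∣ h i) → + p ∣ sumZ n h
    ∣-sum zero    h d = divides (+ 0) refl
    ∣-sum (suc n) h d = ∣m∣n⇒∣m+n (∣-sum n h (λ i i<n → d i (ℕ.m<n⇒m<1+n i<n))) (d n ℕ.≤-refl)

    isolate : ∀ n h i₀ → i₀ ℕ.< n → (∀ i → i ℕ.< n → i ≢ i₀ → + p ∣ h i) → + p ∣ sumZ n h → + p ∣ h i₀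
    isolate (suc n) h i₀ i₀<n others d with i₀ ℕ.≟ n
    ... | yes refl = ∣m+n∣m⇒∣n d (∣-sum n h (λ i i<n → others i (ℕ.m<n⇒m<1+n i<n) (ℕ.<⇒≢ i<n)))
    ... | no  i₀≢n = isolate n h i₀ (ℕ.≤∧≢⇒< (ℕ.≤-pred i₀<n) i₀≢n)
                       (λ i i<n → others i (ℕ.m<n⇒m<1+n i<n))
                       (∣m+n∣n⇒∣m d (others n ℕ.≤-refl (λ n≡i₀ → i₀≢n (sym n≡i₀))))

    least : ∀ m (f : ℕ → ℤ) → (∀ i → i ℕ.< m → + p ∣ f i) ⊎ (∃ λ i₀ → i₀ ℕ.< m × ¬ (+ p ∣ f i₀) × (∀ i → i ℕ.< i₀ → + p ∣ f i))
    least zero    f = inj₁ (λ _ ())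
    least (suc m) f with least m f
    ... | inj₂ (i₀ , i₀<m , rest) = inj₂ (i₀ , ℕ.m<n⇒m<1+n i₀<m , rest)
    ... | inj₁ below with + p ∣? f m
    ... | no  ¬d = inj₂ (m , ℕ.≤-refl , ¬d , below)
    ... | yes d  = inj₁ (λ i i≤m → cases (ℕ.m≤n⇒m<n∨m≡n (ℕ.≤-pred i≤m)))
      where
      cases : ∀ {i} → i ℕ.< m ⊎ i ≡ m → + p ∣ f i
      cases (inj₁ i<m)  = below _ i<m
      cases (inj₂ refl) = d

    -- Here `m` and `n` count coefficients, so `k` runs up to the sum of the degrees. With `i₀` the
    -- first index at which p does not divide f, strong induction on `j` applies: in the coefficient
    -- of index `i₀ + j` every term but `f i₀ * g j` is divisible, by f on one side and by the
    -- induction hypothesis on the other.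
    gauss : ∀ (f g : ℕ → ℤ) m n → (∀ k → suc k ℕ.< m ℕ.+ n → + p ∣ convZ f g k) →
            (∀ i → i ℕ.< m → + p ∣ f i) ⊎ (∀ j → j ℕ.< n → + p ∣ g j)
    gauss f g m n d with least m f
    ... | inj₁ all = inj₁ all
    ... | inj₂ (i₀ , i₀<m , ¬d , below) = inj₂ (<-rec (λ j → j ℕ.< n → + p ∣ g j) step)
      where
      step : ∀ j → (∀ {i} → i ℕ.< j → i ℕ.< n → + p ∣ g i) → j ℕ.< n → + p ∣ g j
      step j rec j<n = cases (euclid (f i₀) (g j) (subst (λ i → + p ∣ f i₀ * g i) (ℕ.m+n∸m≡n i₀ j)
          (isolate (suc (i₀ ℕ.+ j)) (λ i → f i * g (i₀ ℕ.+ j ∸ i)) i₀ (ℕ.s≤s (ℕ.m≤m+n i₀ j)) others (d (i₀ ℕ.+ j) (subst (ℕ._≤ m ℕ.+ n) (cong suc (ℕ.+-suc i₀ j)) (ℕ.+-mono-≤ i₀<m j<n))))))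
        where
        cases : (+ p ∣ f i₀) ⊎ (+ p ∣ g j) → + p ∣ g j
        cases (inj₁ e) = contradiction e ¬d
        cases (inj₂ e) = e
        others : ∀ i → i ℕ.< suc (i₀ ℕ.+ j) → i ≢ i₀ → + p ∣ f i * g (i₀ ℕ.+ j ∸ i)
        others i i≤ i≢i₀ with ℕ.<-cmp i i₀
        ... | tri< i<i₀ _ _ = ∣m⇒∣m*n (g (i₀ ℕ.+ j ∸ i)) (below i i<i₀)
        ... | tri≈ _ i≡i₀ _ = contradiction i≡i₀ i≢i₀
        ... | tri> _ _ i₀<i = ∣n⇒∣m*n (f i) (rec small (ℕ.<-trans small j<n))
          where
          small : i₀ ℕ.+ j ∸ i ℕ.< j
          small = ℕ.<-≤-trans (ℕ.∸-monoʳ-< i₀<i (ℕ.≤-pred i≤)) (ℕ.≤-reflexive (ℕ.m+n∸m≡n i₀ j))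

  -- The leading coefficients are natural numbers, so a product 4 admits only positive triples and
  -- no signs have to be normalised; division by a prime preserves this.
  record Factors : Set where
    constructor factors
    field
      βₙ vₙ uₙ v′ₙ u′ₙ : ℤ
      αₙ wₙ w′ₙ : ℕ

    linear quadratic quadratic′ : ℕ → ℤ
    linear     = coeffZ (βₙ ∷ + αₙ ∷ [])
    quadratic  = coeffZ (vₙ ∷ uₙ ∷ + wₙ ∷ [])
    quadratic′ = coeffZ (v′ₙ ∷ u′ₙ ∷ + w′ₙ ∷ [])

    expanded : ℕ → ℤ
    expanded = convZ (convZ linear quadratic) quadratic′

  open Factors using (linear; quadratic; quadratic′; expanded)

  _Expands_ : Factors → (ℕ → ℤ) → Set
  φ Expands F = ∀ k → k ℕ.≤ 5 → expanded φ k ≡ F k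

  divide-lead : ∀ {p a} → + p ∣ + a → ∃ λ a′ → + a ≡ + a′ * + p
  divide-lead {p} {a} d with ∣⇒∣ᵤ d
  ... | ℕ.divides a′ eq = a′ , trans (cong +_ eq) (ℤ.pos-* a′ p)

  module _ {p} (pr : Prime p) where
    open Gauss pr

    Scaled : Factors → Factors → Set
    Scaled φ ψ = ∀ k → expanded φ k ≡ expanded ψ k * + p

    divide-quad : ∀ {v u w} → (∀ i → i ℕ.< 3 → + p ∣ coeffZ (v ∷ u ∷ + w ∷ []) i) →
      ∃[ v₁ ] ∃[ u₁ ] ∃[ w₁ ] (∀ i → coeffZ (v ∷ u ∷ + w ∷ []) i ≡ coeffZ (v₁ ∷ u₁ ∷ + w₁ ∷ []) i * + p)
    divide-quad {v} {u} {w} d with d 0 (ℕ.≤ᵇ⇒≤ _ _ _) | d 1 (ℕ.≤ᵇ⇒≤ _ _ _) | divide-lead (d 2 (ℕ.≤ᵇ⇒≤ _ _ _))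
    ... | divides v₁ ev | divides u₁ eu | w₁ , ew = v₁ , u₁ , w₁ , λ where
      0 → ev
      1 → eu
      2 → ew
      (suc (suc (suc _))) → refl

    divide-lin : ∀ {b a} → (∀ i → i ℕ.< 2 → + p ∣ coeffZ (b ∷ + a ∷ []) i) →
      ∃[ b₁ ] ∃[ a₁ ] (∀ i → coeffZ (b ∷ + a ∷ []) i ≡ coeffZ (b₁ ∷ + a₁ ∷ []) i * + p)
    divide-lin d with d 0 (ℕ.≤ᵇ⇒≤ _ _ _) | divide-lead (d 1 (ℕ.≤ᵇ⇒≤ _ _ _))
    ... | divides b₁ eb | a₁ , ea = b₁ , a₁ , λ where
      0 → eb
      1 → ea
      (suc (suc _)) → refl

    divide : ∀ φ → (∀ k → k ℕ.≤ 5 → + p ∣ expanded φ k) → ∃ (Scaled φ)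
    divide φ@(factors b v u v′ u′ a w w′) d =
      outer (gauss (convZ (linear φ) (quadratic φ)) (quadratic′ φ) 4 3 (λ k k<6 → d k (ℕ.≤-pred (ℕ.≤-pred k<6))))
      where
      from-quadratic′ : (∃[ v₁ ] ∃[ u₁ ] ∃[ w₁ ] (∀ i → quadratic′ φ i ≡ coeffZ (v₁ ∷ u₁ ∷ + w₁ ∷ []) i * + p)) → ∃ (Scaled φ)
      from-quadratic′ (v₁ , u₁ , w₁ , eq) =
        factors b v u v₁ u₁ a w w₁ , convZ-scaleʳ (convZ (linear φ) (quadratic φ)) (quadratic′ φ) (coeffZ (v₁ ∷ u₁ ∷ + w₁ ∷ [])) (+ p) eq
      from-quadratic : (∃[ v₁ ] ∃[ u₁ ] ∃[ w₁ ] (∀ i → quadratic φ i ≡ coeffZ (v₁ ∷ u₁ ∷ + w₁ ∷ []) i * + p)) → ∃ (Scaled φ)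
      from-quadratic (v₁ , u₁ , w₁ , eq) =
        factors b v₁ u₁ v′ u′ a w₁ w′ ,
        convZ-scaleˡ (convZ (linear φ) (quadratic φ)) (convZ (linear φ) (coeffZ (v₁ ∷ u₁ ∷ + w₁ ∷ []))) (quadratic′ φ) (+ p)
          (convZ-scaleʳ (linear φ) (quadratic φ) (coeffZ (v₁ ∷ u₁ ∷ + w₁ ∷ [])) (+ p) eq)
      from-linear : (∃[ b₁ ] ∃[ a₁ ] (∀ i → linear φ i ≡ coeffZ (b₁ ∷ + a₁ ∷ []) i * + p)) → ∃ (Scaled φ)
      from-linear (b₁ , a₁ , eq) =
        factors b₁ v u v′ u′ a₁ w w′ ,
        convZ-scaleˡ (convZ (linear φ) (quadratic φ)) (convZ (coeffZ (b₁ ∷ + a₁ ∷ [])) (quadratic φ)) (quadratic′ φ) (+ p)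
          (convZ-scaleˡ (linear φ) (coeffZ (b₁ ∷ + a₁ ∷ [])) (quadratic φ) (+ p) eq)
      inner : (∀ i → i ℕ.< 2 → + p ∣ linear φ i) ⊎ (∀ j → j ℕ.< 3 → + p ∣ quadratic φ j) → ∃ (Scaled φ)
      inner (inj₁ e) = from-linear (divide-lin e)
      inner (inj₂ e) = from-quadratic (divide-quad e)
      outer : (∀ i → i ℕ.< 4 → + p ∣ convZ (linear φ) (quadratic φ) i) ⊎ (∀ j → j ℕ.< 3 → + p ∣ quadratic′ φ j) → ∃ (Scaled φ)
      outer (inj₁ e) = inner (gauss (linear φ) (quadratic φ) 2 3 (λ k k<4 → e k (ℕ.≤-pred k<4)))
      outer (inj₂ e) = from-quadratic′ (divide-quad e)

  -- A prime of the common denominator divides every coefficient of the product, hence all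
  -- coefficients of one factor, and is cancelled there. Repeating this removes the denominator.
  descent : ∀ ps → All Prime ps → ∀ F φ → φ Expands (λ k → F k * + product ps) → ∃ λ ψ → ψ Expands F
  descent []       []         F φ eq = φ , λ k k≤5 → trans (eq k k≤5) (ℤ.*-identityʳ (F k))
  descent (p ∷ ps) (pr ∷ prs) F φ eq = next (divide pr φ (λ k k≤5 → divides (F k * + product ps) (trans (eq k k≤5) (regroup k))))
    where
    instance
      _ = prime⇒nonZero pr
    regroup : ∀ k → F k * + (p ℕ.* product ps) ≡ F k * + product ps * + p
    regroup k = trans (cong (F k *_) (trans (ℤ.pos-* p (product ps)) (ℤ.*-comm (+ p) (+ product ps)))) (sym (ℤ.*-assoc (F k) (+ product ps) (+ p)))
    next : ∃ (Scaled pr φ) → ∃ λ ψ → ψ Expands F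
    next (ψ , scaled) = descent ps prs F ψ (λ k k≤5 →
      ℤ.*-cancelʳ-≡ (expanded ψ k) (F k * + product ps) (+ p) (trans (sym (scaled k)) (trans (eq k k≤5) (regroup k))))

  integral-factors : ∀ N .{{_ : ℕ.NonZero N}} F φ → φ Expands (λ k → F k * + N) → ∃ λ ψ → ψ Expands F
  integral-factors N F φ eq = descent (PrimeFactorisation.factors pf) (PrimeFactorisation.factorsPrime pf) F φ
    (λ k k≤5 → trans (eq k k≤5) (cong (λ n → F k * + n) (PrimeFactorisation.isFactorisation pf)))
    where
    pf = factorise N

-- Evaluating integral polynomial expressions at rational numbers

module RationalEvaluation where
  open import Defs using (ℤ→ℚ)
  open Congruence using (_[_])
  open Embedding
  open import Data.Rational using (_+_; _*_; -_; 1/_; ≢-nonZero)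
  open import Data.Maybe using (nothing)

  ringℚ : AlmostCommutativeRing _ _
  ringℚ = fromCommutativeRing ℚ.+-*-commutativeRing (λ _ → nothing)

  open import Algebra.Properties.Semiring.Exp.TCOptimised (AlmostCommutativeRing.semiring ringℚ) using (^-congˡ)
  open Eval (AlmostCommutativeRing.rawRing ringℚ) ℤ→ℚ public using () renaming (⟦_⟧ to ⟦_⟧ℚ)

  -- Normal forms keep their integer coefficients and only their values lie in ℚ, so a rational
  -- identity is settled by the same `refl` as an integral one.
  homomorphism : Homomorphism _ _ _ _
  homomorphism = record
    { from = Homomorphism.from Ops.homo
    ; to   = ringℚ
    ; morphism = record
      { ⟦_⟧ = ℤ→ℚ ; +-homo = ℤ→ℚ-+ ; *-homo = ℤ→ℚ-* ; -‿homo = ℤ→ℚ-neg ; 0-homo = refl ; 1-homo = refl }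
    ; Zero-C⟶Zero-R = λ { (+ 0) _ → refl }
    }

  open import Tactic.RingSolver.Core.Polynomial.Semantics homomorphism using () renaming (⟦_⟧ to ⟦_⟧ₚ)
  open import Tactic.RingSolver.Core.Polynomial.Homomorphism homomorphism

  norm-correct : ∀ {n} (e : Expr ℤ n) ρ → ⟦ norm e ⟧ₚ ρ ≡ ⟦ e ⟧ℚ ρ
  norm-correct (Κ x)    ρ = κ-hom x ρ
  norm-correct (Ι i)    ρ = ι-hom i ρ
  norm-correct (e :+ f) ρ = trans (⊞-hom (norm e) (norm f) ρ) (cong₂ _+_ (norm-correct e ρ) (norm-correct f ρ))
  norm-correct (e :* f) ρ = trans (⊠-hom (norm e) (norm f) ρ) (cong₂ _*_ (norm-correct e ρ) (norm-correct f ρ))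
  norm-correct (e ⊛ n)  ρ = trans (⊡-hom (norm e) n ρ) (^-congˡ n (norm-correct e ρ))
  norm-correct (:- e)   ρ = trans (⊟-hom (norm e) ρ) (cong -_ (norm-correct e ρ))

  identityℚ : ∀ {n} (e f : Expr ℤ n) → norm e ≡ norm f → ∀ ρ → ⟦ e ⟧ℚ ρ ≡ ⟦ f ⟧ℚ ρ
  identityℚ e f eq ρ = trans (sym (norm-correct e ρ)) (trans (cong (λ p → ⟦ p ⟧ₚ ρ) eq) (norm-correct f ρ))

  ⟦_⟧ℚ* : ∀ {m n} → Vec (Expr ℤ n) m → Vec ℚ n → Vec ℚ m
  ⟦ σ ⟧ℚ* ρ = Vec.map (λ e → ⟦ e ⟧ℚ ρ) σ

  ⟦[]⟧ℚ : ∀ {m n} (e : Expr ℤ m) (σ : Vec (Expr ℤ n) m) ρ → ⟦ e [ σ ] ⟧ℚ ρ ≡ ⟦ e ⟧ℚ (⟦ σ ⟧ℚ* ρ)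
  ⟦[]⟧ℚ (Κ x)    σ ρ = refl
  ⟦[]⟧ℚ (Ι i)    σ ρ = sym (lookup-map i (λ e → ⟦ e ⟧ℚ ρ) σ)
  ⟦[]⟧ℚ (e :+ f) σ ρ = cong₂ _+_ (⟦[]⟧ℚ e σ ρ) (⟦[]⟧ℚ f σ ρ)
  ⟦[]⟧ℚ (e :* f) σ ρ = cong₂ _*_ (⟦[]⟧ℚ e σ ρ) (⟦[]⟧ℚ f σ ρ)
  ⟦[]⟧ℚ (e ⊛ n)  σ ρ = ^-congˡ n (⟦[]⟧ℚ e σ ρ)
  ⟦[]⟧ℚ (:- e)   σ ρ = cong -_ (⟦[]⟧ℚ e σ ρ)

  specialiseℚ : ∀ {m n} (e : Expr ℤ m) (σ : Vec (Expr ℤ n) m) (f : Expr ℤ n) → norm (e [ σ ]) ≡ norm f →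
                ∀ ρ → ⟦ e ⟧ℚ (⟦ σ ⟧ℚ* ρ) ≡ ⟦ f ⟧ℚ ρ
  specialiseℚ e σ f eq ρ = trans (sym (⟦[]⟧ℚ e σ ρ)) (identityℚ (e [ σ ]) f eq ρ)

  ℤ→ℚ-^ : ∀ {n} (e : Expr ℤ n) k ρ → ℤ→ℚ (⟦ e ⟧ ρ) ≡ ⟦ e ⟧ℚ (Vec.map ℤ→ℚ ρ) → ℤ→ℚ (⟦ e ⊛ k ⟧ ρ) ≡ ⟦ e ⊛ k ⟧ℚ (Vec.map ℤ→ℚ ρ)
  ℤ→ℚ-^ e zero          ρ eq = refl
  ℤ→ℚ-^ e (suc zero)    ρ eq = eq
  ℤ→ℚ-^ e (suc (suc k)) ρ eq = trans (ℤ→ℚ-* (⟦ e ⊛ suc k ⟧ ρ) (⟦ e ⟧ ρ)) (cong₂ _*_ (ℤ→ℚ-^ e (suc k) ρ eq) eq)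

  ℤ→ℚ-⟦⟧ : ∀ {n} (e : Expr ℤ n) ρ → ℤ→ℚ (⟦ e ⟧ ρ) ≡ ⟦ e ⟧ℚ (Vec.map ℤ→ℚ ρ)
  ℤ→ℚ-⟦⟧ (Κ x)    ρ = refl
  ℤ→ℚ-⟦⟧ (Ι i)    ρ = sym (lookup-map i ℤ→ℚ ρ)
  ℤ→ℚ-⟦⟧ (e :+ f) ρ = trans (ℤ→ℚ-+ (⟦ e ⟧ ρ) (⟦ f ⟧ ρ)) (cong₂ _+_ (ℤ→ℚ-⟦⟧ e ρ) (ℤ→ℚ-⟦⟧ f ρ))
  ℤ→ℚ-⟦⟧ (e :* f) ρ = trans (ℤ→ℚ-* (⟦ e ⟧ ρ) (⟦ f ⟧ ρ)) (cong₂ _*_ (ℤ→ℚ-⟦⟧ e ρ) (ℤ→ℚ-⟦⟧ f ρ))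
  ℤ→ℚ-⟦⟧ (e ⊛ k)  ρ = ℤ→ℚ-^ e k ρ (ℤ→ℚ-⟦⟧ e ρ)
  ℤ→ℚ-⟦⟧ (:- e)   ρ = trans (ℤ→ℚ-neg (⟦ e ⟧ ρ)) (cong -_ (ℤ→ℚ-⟦⟧ e ρ))

  product-zero : ∀ x y → x * y ≡ 0ℚ → x ≡ 0ℚ ⊎ y ≡ 0ℚ
  product-zero x y eq with x ℚ.≟ 0ℚ
  ... | yes x≡0 = inj₁ x≡0
  ... | no  x≢0 = inj₂ (begin
    y                ≡⟨ ℚ.*-identityˡ y ⟨
    1ℚ * y           ≡⟨ cong (_* y) (ℚ.*-inverseˡ x) ⟨
    1/ x * x * y     ≡⟨ ℚ.*-assoc (1/ x) x y ⟩
    1/ x * (x * y)   ≡⟨ cong (1/ x *_) eq ⟩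
    1/ x * 0ℚ        ≡⟨ ℚ.*-zeroʳ (1/ x) ⟩
    0ℚ               ∎)
    where
    open ≡-Reasoning
    instance
      _ = ≢-nonZero x≢0

-- Division of a quintic by a monic quadratic and by a linear polynomial

module QuadraticDivision where
  open Forms
  open Congruence using (_[_])
  open Defects using (one)
  open RationalEvaluation
  open import Data.Rational using (_+_; _*_)

  module Division where
    f₀ f₁ f₂ f₃ f₄ t a b : Expr ℤ 8
    f₀ = Ι (# 0)
    f₁ = Ι (# 1)
    f₂ = Ι (# 2)
    f₃ = Ι (# 3)
    f₄ = Ι (# 4)
    t  = Ι (# 5)
    a  = Ι (# 6)
    b  = Ι (# 7)

    -- 4x⁵ + f₄x⁴ + … + f₀ = (x² + a x + b)(4x³ + k₂x² + k₁x + k₀) + r₁x + r₀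
    k₂ k₁ k₀ r₁ r₀ : Expr ℤ 8
    k₂ = f₄ :- 4 · a
    k₁ = f₃ :- a :* k₂ :- 4 · b
    k₀ = f₂ :- a :* k₁ :- b :* k₂
    r₁ = f₁ :- a :* k₀ :- b :* k₁
    r₀ = f₀ :- b :* k₀

    -- 4x³ + k₂x² + k₁x + k₀ = (x - t)(4x² + c x + e) + k[t]
    c e k[t] : Expr ℤ 8
    c    = k₂ :+ 4 · t
    e    = k₁ :+ t :* c
    k[t] = k₀ :+ t :* e

    split : Vec (Expr ℤ 8) 11
    split = :- t ∷ one ∷ b ∷ a ∷ one ∷ e ∷ c ∷ Κ (+ 4) ∷ Κ (+ 0) ∷ Κ (+ 0) ∷ Κ (+ 0) ∷ []

    f : ℕ → Expr ℤ 8
    f = coeffE (f₀ ∷ f₁ ∷ f₂ ∷ f₃ ∷ f₄ ∷ Κ (+ 4) ∷ [])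

    horner : ∀ {n} → (ℕ → Expr ℤ n) → Expr ℤ n → Expr ℤ n
    horner g x = g 0 :+ x :* (g 1 :+ x :* (g 2 :+ x :* (g 3 :+ x :* (g 4 :+ x :* g 5))))

    remainder : norm (horner f t) ≡ norm ((t :* t :+ a :* t :+ b) :* k[t] :+ (r₁ :* t :+ r₀))
    remainder = refl

    -- The coefficients of k(t)(x² + a x + b) + r₁ x + r₀, the part of the quintic lost when both
    -- divisions are treated as exact.
    corrected : ℕ → Expr ℤ 8
    corrected 0 = r₀ :+ k[t] :* b
    corrected 1 = r₁ :+ k[t] :* a
    corrected 2 = k[t]
    corrected _ = Κ (+ 0)

    split-prod : ∀ k → k ℕ.≤ 5 → norm (prodC k [ split ] :+ corrected k) ≡ norm (f k)
    split-prod 0 _ = refl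
    split-prod 1 _ = refl
    split-prod 2 _ = refl
    split-prod 3 _ = refl
    split-prod 4 _ = refl
    split-prod 5 _ = refl
    split-prod (suc (suc (suc (suc (suc (suc _)))))) (ℕ.s≤s (ℕ.s≤s (ℕ.s≤s (ℕ.s≤s (ℕ.s≤s ())))))

  open Division using (split; horner; corrected; split-prod; remainder; k[t])

  times-zero : ∀ {z} x → z ≡ 0ℚ → x * z ≡ 0ℚ
  times-zero x refl = ℚ.*-zeroʳ x

  zero-times : ∀ {z} x → z ≡ 0ℚ → z * x ≡ 0ℚ
  zero-times x refl = ℚ.*-zeroˡ x

  module _ (ρ : Vec ℚ 8) (r₁≡0 : ⟦ Division.r₁ ⟧ℚ ρ ≡ 0ℚ) (r₀≡0 : ⟦ Division.r₀ ⟧ℚ ρ ≡ 0ℚ) where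
    open Division using (t; a; b; r₁; r₀; f)

    root-of-cubic : ⟦ horner f t ⟧ℚ ρ ≡ 0ℚ → ⟦ t :* t :+ a :* t :+ b ⟧ℚ ρ ≢ 0ℚ → ⟦ k[t] ⟧ℚ ρ ≡ 0ℚ
    root-of-cubic root ≢0 = cases (product-zero (⟦ m ⟧ℚ ρ) (⟦ k[t] ⟧ℚ ρ)
      (trans (sym (trans (cong (λ z → ⟦ m ⟧ℚ ρ * ⟦ k[t] ⟧ℚ ρ + z) rest≡0) (ℚ.+-identityʳ (⟦ m ⟧ℚ ρ * ⟦ k[t] ⟧ℚ ρ))))
             (trans (sym (identityℚ (horner f t) (m :* k[t] :+ (r₁ :* t :+ r₀)) remainder ρ)) root)))
      where
      m : Expr ℤ 8
      m = t :* t :+ a :* t :+ b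
      rest≡0 : ⟦ r₁ ⟧ℚ ρ * ⟦ t ⟧ℚ ρ + ⟦ r₀ ⟧ℚ ρ ≡ 0ℚ
      rest≡0 = cong₂ _+_ (zero-times (⟦ t ⟧ℚ ρ) r₁≡0) r₀≡0
      cases : ⟦ m ⟧ℚ ρ ≡ 0ℚ ⊎ ⟦ k[t] ⟧ℚ ρ ≡ 0ℚ → ⟦ k[t] ⟧ℚ ρ ≡ 0ℚ
      cases (inj₁ p) = ⊥-elim (≢0 p)
      cases (inj₂ p) = p

    factorisation : ⟦ k[t] ⟧ℚ ρ ≡ 0ℚ → ∀ k → k ℕ.≤ 5 → ⟦ prodC k ⟧ℚ (⟦ split ⟧ℚ* ρ) ≡ ⟦ f k ⟧ℚ ρ
    factorisation k≡0 k k≤5 = trans (sym (⟦[]⟧ℚ (prodC k) split ρ))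
      (trans (sym (trans (cong (λ z → ⟦ prodC k [ split ] ⟧ℚ ρ + z) (vanish k)) (ℚ.+-identityʳ (⟦ prodC k [ split ] ⟧ℚ ρ))))
             (identityℚ (prodC k [ split ] :+ corrected k) (f k) (split-prod k k≤5) ρ))
      where
      vanish : ∀ k → ⟦ corrected k ⟧ℚ ρ ≡ 0ℚ
      vanish 0 = cong₂ _+_ r₀≡0 (zero-times (⟦ b ⟧ℚ ρ) k≡0)
      vanish 1 = cong₂ _+_ r₁≡0 (zero-times (⟦ a ⟧ℚ ρ) k≡0)
      vanish 2 = k≡0
      vanish (suc (suc (suc _))) = refl

-- P, Q and F at a rational point and at a point r + s√d

module CurvePolynomials where
  open import Defs
  open Forms
  open Congruence using (_[_])
  open RationalEvaluation
  open QuadraticDivision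
  open import Data.Rational using (½; _+_; _*_; -_)
  open Division using (horner)

  module Curve where
    d r s : Expr ℤ 11
    d = Ι (# 0)
    r = Ι (# 1)
    s = Ι (# 2)

    pC qC fC : ℕ → Expr ℤ 11
    pC = coeffE (Ι (# 3) ∷ Ι (# 4) ∷ Ι (# 5) ∷ Ι (# 6) ∷ Ι (# 7) ∷ Κ (+ 1) ∷ Κ (+ 0) ∷ [])
    qC = coeffE (Ι (# 8) ∷ Ι (# 9) ∷ Ι (# 10) ∷ Κ (+ 0) ∷ [])
    fC k = 4 · pC k :+ convE qC qC k

    powE : ∀ {n} → Expr ℤ n → ℕ → Expr ℤ n
    powE x zero    = Κ (+ 1)
    powE x (suc n) = x :* powE x n

    evalE : ∀ {n} → ℕ → (ℕ → Expr ℤ n) → Expr ℤ n → Expr ℤ n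
    evalE n f x = sumE (suc n) (λ i → f i :* powE x i)

    Pair : Set
    Pair = Expr ℤ 11 × Expr ℤ 11

    powP : ℕ → Pair
    powP zero    = Κ (+ 1) , Κ (+ 0)
    powP (suc n) = r :* proj₁ (powP n) :+ d :* (s :* proj₂ (powP n)) , r :* proj₂ (powP n) :+ s :* proj₁ (powP n)

    -- The products with 0 copy the multiplication by `emb` in `evald`, so that both evaluations
    -- agree by congruence alone.
    evalPair : ℕ → (ℕ → Expr ℤ 11) → Pair
    evalPair zero    f = f 0 , Κ (+ 0)
    evalPair (suc n) f =
      proj₁ (evalPair n f) :+ (f (suc n) :* proj₁ (powP (suc n)) :+ d :* (Κ (+ 0) :* proj₂ (powP (suc n)))) ,
      proj₂ (evalPair n f) :+ (f (suc n) :* proj₂ (powP (suc n)) :+ Κ (+ 0) :* proj₁ (powP (suc n)))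

    Pr Qr Fr P₀ P₁ Q₀ Q₁ : Expr ℤ 11
    Pr = evalE 6 pC r
    Qr = evalE 3 qC r
    Fr = horner fC r
    P₀ = proj₁ (evalPair 6 pC)
    P₁ = proj₂ (evalPair 6 pC)
    Q₀ = proj₁ (evalPair 3 qC)
    Q₁ = proj₂ (evalPair 3 qC)

    -- the monic quadratic polynomial with root r + s√d
    toDivision : Vec (Expr ℤ 11) 8
    toDivision = fC 0 ∷ fC 1 ∷ fC 2 ∷ fC 3 ∷ fC 4 ∷ Κ (+ 0) ∷ :- (2 · r) ∷ r :* r :- d :* (s :* s) ∷ []

    R₁ R₀ : Expr ℤ 11
    R₁ = Division.r₁ [ toDivision ]
    R₀ = Division.r₀ [ toDivision ]

    F≡4P+Q² : norm Fr ≡ norm (4 · Pr :+ Qr :* Qr)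
    F≡4P+Q² = refl

    -- The quadratic divisor vanishes at r + s√d, so F takes there the value R₁ (r + s√d) + R₀ of
    -- the remainder; this and the next identity are its two components.
    rational-part : norm (4 · P₀ :+ (Q₀ :* Q₀ :+ d :* (Q₁ :* Q₁))) ≡ norm (R₁ :* r :+ R₀)
    rational-part = refl

    irrational-part : norm (4 · P₁ :+ 2 · (Q₀ :* Q₁)) ≡ norm (R₁ :* s)
    irrational-part = refl

    -- Serves to show that a Weierstrass point with rational abscissa has a rational ordinate.
    Q₁-multiple : norm Q₁ ≡ norm (s :* (qC 1 :+ 2 · (qC 2 :* r)))
    Q₁-multiple = refl

  open Curve

  ⟦coeffE⟧ : ∀ {m n} (es : Vec (Expr ℤ m) n) ρ k → ⟦ coeffE es k ⟧ℚ ρ ≡ vcoeff (⟦ es ⟧ℚ* ρ) k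
  ⟦coeffE⟧ []       ρ k       = refl
  ⟦coeffE⟧ (e ∷ es) ρ zero    = refl
  ⟦coeffE⟧ (e ∷ es) ρ (suc k) = ⟦coeffE⟧ es ρ k

  ⟦sumE⟧ : ∀ {m} n (f : ℕ → Expr ℤ m) (g : ℕ → ℚ) ρ → (∀ i → ⟦ f i ⟧ℚ ρ ≡ g i) → ⟦ sumE n f ⟧ℚ ρ ≡ sumBelow n g
  ⟦sumE⟧ zero    f g ρ eq = refl
  ⟦sumE⟧ (suc n) f g ρ eq = cong₂ _+_ (⟦sumE⟧ n f g ρ eq) (eq n)

  ⟦convE⟧ : ∀ {m} (f f′ : ℕ → Expr ℤ m) (g g′ : ℕ → ℚ) ρ → (∀ i → ⟦ f i ⟧ℚ ρ ≡ g i) → (∀ i → ⟦ f′ i ⟧ℚ ρ ≡ g′ i) →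
            ∀ k → ⟦ convE f f′ k ⟧ℚ ρ ≡ (g ⊗ g′) k
  ⟦convE⟧ f f′ g g′ ρ eq eq′ k = ⟦sumE⟧ (suc k) (λ i → f i :* f′ (k ∸ i)) (λ i → g i * g′ (k ∸ i)) ρ
    (λ i → cong₂ _*_ (eq i) (eq′ (k ∸ i)))

  ⟦powE⟧ : ∀ {m} (e : Expr ℤ m) ρ n → ⟦ powE e n ⟧ℚ ρ ≡ ⟦ e ⟧ℚ ρ ^ n
  ⟦powE⟧ e ρ zero    = refl
  ⟦powE⟧ e ρ (suc n) = cong (λ x → ⟦ e ⟧ℚ ρ * x) (⟦powE⟧ e ρ n)

  ⟦evalE⟧ : ∀ {m} n (f : ℕ → Expr ℤ m) (g : ℕ → ℚ) e ρ → (∀ i → ⟦ f i ⟧ℚ ρ ≡ g i) → ⟦ evalE n f e ⟧ℚ ρ ≡ evalP n g (⟦ e ⟧ℚ ρ)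
  ⟦evalE⟧ n f g e ρ eq = ⟦sumE⟧ (suc n) (λ i → f i :* powE e i) (λ i → g i * (⟦ e ⟧ℚ ρ ^ i)) ρ (λ i → cong₂ _*_ (eq i) (⟦powE⟧ e ρ i))

  ⟦_⟧P : Pair → Vec ℚ 11 → Qd
  ⟦ x , y ⟧P ρ = ⟦ x ⟧ℚ ρ , ⟦ y ⟧ℚ ρ

  module _ (ρ : Vec ℚ 11) where
    open QuadArith (⟦ d ⟧ℚ ρ)

    ⟦powP⟧ : ∀ n → ⟦ powP n ⟧P ρ ≡ powd (⟦ r ⟧ℚ ρ , ⟦ s ⟧ℚ ρ) n
    ⟦powP⟧ zero    = refl
    ⟦powP⟧ (suc n) = cong (λ y → (⟦ r ⟧ℚ ρ , ⟦ s ⟧ℚ ρ) *d y) (⟦powP⟧ n)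

    ⟦evalPair⟧ : ∀ n (f : ℕ → Expr ℤ 11) (g : ℕ → ℚ) → (∀ i → ⟦ f i ⟧ℚ ρ ≡ g i) →
                 ⟦ evalPair n f ⟧P ρ ≡ evald n g (⟦ r ⟧ℚ ρ , ⟦ s ⟧ℚ ρ)
    ⟦evalPair⟧ zero    f g eq = cong (λ x → x , 0ℚ) (eq 0)
    ⟦evalPair⟧ (suc n) f g eq = cong₂ _+d_ (⟦evalPair⟧ n f g eq)
      (cong₂ (λ c y → emb c *d y) (eq (suc n)) (⟦powP⟧ (suc n)))

  double-zero : ∀ y → y + y ≡ 0ℚ → y ≡ 0ℚ
  double-zero y eq = trans (sym (ℚ.*-identityˡ y)) (trans (ℚ.*-distribʳ-+ y ½ ½) (trans (sym (ℚ.*-distribˡ-+ ½ y y)) (times-zero ½ eq)))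

  -- y is fixed by the involution y ↦ - y - c exactly when 2y + c = 0
  fixed⇒ : ∀ y c → - y + - c ≡ y → y + y + c ≡ 0ℚ
  fixed⇒ y c eq = trans (identityℚ (Y :+ Y :+ C) (Y :- (:- Y :- C)) refl (y ∷ c ∷ [])) (trans (cong (λ z → y + - z) eq) (ℚ.+-inverseʳ y))
    where
    Y C : Expr ℤ 2
    Y = Ι (# 0)
    C = Ι (# 1)

-- Weierstrass points as roots of F

module WeierstrassPoints where
  open import Defs
  open Forms
  open RationalEvaluation
  open QuadraticDivision
  open CurvePolynomials
  open import Data.Rational using (½; _+_; _*_; -_; _-_)
  open Curve

  -- On the curve 4z + c² is the square of 2y + c, which vanishes at a fixed point.
  fixed⇒square : ∀ y c z → y * y + c * y ≡ z → - y + - c ≡ y → ℤ→ℚ (+ 4) * z + c * c ≡ 0ℚ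
  fixed⇒square y c z eq fixed = trans (cong (λ z → ℤ→ℚ (+ 4) * z + c * c) (sym eq))
    (trans (identityℚ (4 · (Y :* Y :+ C :* Y) :+ C :* C) ((Y :+ Y :+ C) :* (Y :+ Y :+ C)) refl (y ∷ c ∷ []))
           (zero-times (y + y + c) (fixed⇒ y c fixed)))
    where
    Y C : Expr ℤ 2
    Y = Ι (# 0)
    C = Ι (# 1)

  square⇒fixed : ∀ c z → ℤ→ℚ (+ 4) * z + c * c ≡ 0ℚ → let y = - (½ * c) in (y * y + c * y ≡ z) × (- y - c ≡ y)
  square⇒fixed c z eq = oncurve , fixed
    where
    H C Z : Expr ℤ 3
    H = Ι (# 0)
    C = Ι (# 1)
    Z = Ι (# 2)
    ρ : Vec ℚ 3
    ρ = ½ ∷ c ∷ z ∷ []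
    unit : ∀ x → (½ + ½) * x ≡ x
    unit = ℚ.*-identityˡ
    fixed : - - (½ * c) - c ≡ - (½ * c)
    fixed = trans (cong (λ x → - - (½ * c) - x) (sym (unit c)))
      (identityℚ (:- (:- (H :* C)) :- (H :+ H) :* C) (:- (H :* C)) refl ρ)
    oncurve : - (½ * c) * - (½ * c) + c * - (½ * c) ≡ z
    oncurve = begin
      - (½ * c) * - (½ * c) + c * - (½ * c)
        ≡⟨ cong (λ x → - (½ * c) * - (½ * c) + x * - (½ * c)) (sym (unit c)) ⟩
      - (½ * c) * - (½ * c) + (½ + ½) * c * - (½ * c)
        ≡⟨ identityℚ (:- (H :* C) :* (:- (H :* C)) :+ (H :+ H) :* C :* (:- (H :* C))) ((H :+ H) :* ((H :+ H) :* Z) :- H :* H :* (4 · Z :+ C :* C)) refl ρ ⟩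
      (½ + ½) * ((½ + ½) * z) + - (½ * ½ * (ℤ→ℚ (+ 4) * z + c * c))
        ≡⟨ cong₂ (λ x y → x + - y) (trans (unit ((½ + ½) * z)) (unit z)) (times-zero (½ * ½) eq) ⟩
      z + 0ℚ
        ≡⟨ ℚ.+-identityʳ z ⟩
      z ∎
      where open ≡-Reasoning

  module Points (p₀ p₁ p₂ p₃ p₄ : ℤ) (c₀ c₁ c₂ : ℤ) where
    E : WEq
    E = fromℤ (p₀ ∷ p₁ ∷ p₂ ∷ p₃ ∷ p₄ ∷ + 1 ∷ + 0 ∷ []) (c₀ ∷ c₁ ∷ c₂ ∷ + 0 ∷ [])

    coefficients : Vec ℤ 8
    coefficients = p₀ ∷ p₁ ∷ p₂ ∷ p₃ ∷ p₄ ∷ c₀ ∷ c₁ ∷ c₂ ∷ []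

    env : ℚ → ℚ → ℚ → Vec ℚ 11
    env δ x y = δ ∷ x ∷ y ∷ Vec.map ℤ→ℚ coefficients

    module _ (δ x y : ℚ) where
      ⟦pC⟧ : ∀ k → ⟦ pC k ⟧ℚ (env δ x y) ≡ Pp E k
      ⟦pC⟧ = ⟦coeffE⟧ (Ι (# 3) ∷ Ι (# 4) ∷ Ι (# 5) ∷ Ι (# 6) ∷ Ι (# 7) ∷ Κ (+ 1) ∷ Κ (+ 0) ∷ []) (env δ x y)

      ⟦qC⟧ : ∀ k → ⟦ qC k ⟧ℚ (env δ x y) ≡ Qp E k
      ⟦qC⟧ = ⟦coeffE⟧ (Ι (# 8) ∷ Ι (# 9) ∷ Ι (# 10) ∷ Κ (+ 0) ∷ []) (env δ x y)

      ⟦fC⟧ : ∀ k → ⟦ fC k ⟧ℚ (env δ x y) ≡ Fp E k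
      ⟦fC⟧ k = cong₂ _+_ (cong (λ z → ℕ→ℚ 4 * z) (⟦pC⟧ k)) (⟦convE⟧ qC qC (Qp E) (Qp E) (env δ x y) ⟦qC⟧ ⟦qC⟧ k)

      ⟦Pr⟧ : ⟦ Pr ⟧ℚ (env δ x y) ≡ evalP 6 (Pp E) x
      ⟦Pr⟧ = ⟦evalE⟧ 6 pC (Pp E) r (env δ x y) ⟦pC⟧

      ⟦Qr⟧ : ⟦ Qr ⟧ℚ (env δ x y) ≡ evalP 3 (Qp E) x
      ⟦Qr⟧ = ⟦evalE⟧ 3 qC (Qp E) r (env δ x y) ⟦qC⟧

    Root : ℚ → Set
    Root x = ⟦ Fr ⟧ℚ (env 0ℚ x 0ℚ) ≡ 0ℚ

    Fr≡ : ∀ x → ⟦ Fr ⟧ℚ (env 0ℚ x 0ℚ) ≡ ℤ→ℚ (+ 4) * evalP 6 (Pp E) x + evalP 3 (Qp E) x * evalP 3 (Qp E) x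
    Fr≡ x = trans (identityℚ Fr (4 · Pr :+ Qr :* Qr) F≡4P+Q² (env 0ℚ x 0ℚ))
      (cong₂ (λ a b → ℤ→ℚ (+ 4) * a + b * b) (⟦Pr⟧ 0ℚ x 0ℚ) (⟦Qr⟧ 0ℚ x 0ℚ))

    ordinate : Pt → ℚ
    ordinate (aff _ y) = y
    ordinate (inf y)   = y

    RatWP⇒Root : ∀ x y → RatWP E (aff x y) → Root x
    RatWP⇒Root x y (on , fix) = trans (Fr≡ x) (fixed⇒square y (evalP 3 (Qp E) x) (evalP 6 (Pp E) x) on (cong ordinate fix))

    Root⇒RatWP : ∀ x → Root x → RatWP E (aff x (- (½ * evalP 3 (Qp E) x)))
    Root⇒RatWP x root = proj₁ sq , cong (aff x) (proj₂ sq)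
      where
      sq : (- (½ * evalP 3 (Qp E) x) * - (½ * evalP 3 (Qp E) x) + evalP 3 (Qp E) x * - (½ * evalP 3 (Qp E) x) ≡ evalP 6 (Pp E) x) ×
           (- - (½ * evalP 3 (Qp E) x) - evalP 3 (Qp E) x ≡ - (½ * evalP 3 (Qp E) x))
      sq = square⇒fixed (evalP 3 (Qp E) x) (evalP 6 (Pp E) x) (trans (sym (Fr≡ x)) root)

    inf-fixed : ∀ y → RatWP E (inf y) → y ≡ 0ℚ
    inf-fixed y (_ , fix) = double-zero y (trans (sym (ℚ.+-identityʳ (y + y))) (fixed⇒ y 0ℚ (cong ordinate fix)))

    inf-RatWP : RatWP E (inf 0ℚ)
    inf-RatWP = refl , refl

    abscissa : Pt → ℚ
    abscissa (aff x _) = x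
    abscissa (inf _)   = 0ℚ

    module Unique (two : ExactlyTwoRatWP E) where
      w₁ w₂ : Pt
      w₁ = proj₁ two
      w₂ = proj₁ (proj₂ two)

      only : ∀ w → RatWP E w → w ≡ w₁ ⊎ w ≡ w₂
      only = proj₂ (proj₂ (proj₂ (proj₂ (proj₂ two))))

      root : ∃ Root
      root = go w₁ w₂ refl refl
        where
        go : ∀ v₁ v₂ → w₁ ≡ v₁ → w₂ ≡ v₂ → ∃ Root
        go (aff x y) _         p q = x , RatWP⇒Root x y (subst (RatWP E) p (proj₁ (proj₂ (proj₂ (proj₂ two)))))
        go (inf _)   (aff x y) p q = x , RatWP⇒Root x y (subst (RatWP E) q (proj₁ (proj₂ (proj₂ (proj₂ (proj₂ two))))))
        go (inf y₁)  (inf y₂)  p q = ⊥-elim (proj₁ (proj₂ (proj₂ two)) (trans p (trans (cong inf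
          (trans (inf-fixed y₁ (subst (RatWP E) p (proj₁ (proj₂ (proj₂ (proj₂ two))))))
                 (sym (inf-fixed y₂ (subst (RatWP E) q (proj₁ (proj₂ (proj₂ (proj₂ (proj₂ two)))))))))) (sym q))))

      -- The point at infinity is one of the two rational Weierstrass points, which leaves a single
      -- affine one.
      unique : ∀ x y → Root x → Root y → x ≡ y
      unique x y fx fy = cases (only _ inf-RatWP) (only _ (Root⇒RatWP x fx)) (only _ (Root⇒RatWP y fy))
        where
        inf≢aff : ∀ {a b c} → inf a ≢ aff b c
        inf≢aff ()
        cases : ∀ {a b v₁ v₂} → inf 0ℚ ≡ v₁ ⊎ inf 0ℚ ≡ v₂ → aff x a ≡ v₁ ⊎ aff x a ≡ v₂ → aff y b ≡ v₁ ⊎ aff y b ≡ v₂ → x ≡ y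
        cases _        (inj₁ p) (inj₁ q) = cong abscissa (trans p (sym q))
        cases _        (inj₂ p) (inj₂ q) = cong abscissa (trans p (sym q))
        cases (inj₁ i) (inj₁ p) (inj₂ _) = ⊥-elim (inf≢aff (trans i (sym p)))
        cases (inj₂ i) (inj₁ _) (inj₂ q) = ⊥-elim (inf≢aff (trans i (sym q)))
        cases (inj₁ i) (inj₂ _) (inj₁ q) = ⊥-elim (inf≢aff (trans i (sym q)))
        cases (inj₂ i) (inj₂ p) (inj₁ _) = ⊥-elim (inf≢aff (trans i (sym p)))

    QuadraticFactor : Set
    QuadraticFactor = ∃[ δ ] ∃[ x ] ∃[ y ] (NonSquare δ × y ≢ 0ℚ × ⟦ R₁ ⟧ℚ (env δ x y) ≡ 0ℚ × ⟦ R₀ ⟧ℚ (env δ x y) ≡ 0ℚ)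

    -- At an affine fixed point 2y + Q(x) = 0 in ℚ(√δ), so F(x) = 0. The irrational component R₁ s =
    -- 0 gives R₁ = 0, and the rational one then gives R₀ = 0. A fixed point at infinity has y = 0
    -- and is rational.
    quadratic-factor : HasQuadraticWP E → QuadraticFactor
    quadratic-factor (δ , nonsq , infd (y₀ , y₁) , (_ , fix) , irr) =
      ⊥-elim (irr (double-zero y₁ (trans (sym (ℚ.+-identityʳ (y₁ + y₁))) (fixed⇒ y₁ 0ℚ (cong irrational fix)))))
      where
      irrational : PtQd → ℚ
      irrational (affd _ (_ , y)) = y
      irrational (infd (_ , y))   = y
    quadratic-factor (δ , nonsq , affd (x , y) (y₀ , y₁) , (on , fix) , irr) =
      δ , x , y , nonsq , y≢0 , R₁≡0 , R₀≡0
      where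
      ρ : Vec ℚ 11
      ρ = env δ x y
      open QuadArith δ
      PP QQ : Qd
      PP = evald 6 (Pp E) (x , y)
      QQ = evald 3 (Qp E) (x , y)
      yy : PtQd → Qd
      yy (affd _ z) = z
      yy (infd z)   = z
      pp : (⟦ P₀ ⟧ℚ ρ , ⟦ P₁ ⟧ℚ ρ) ≡ PP
      pp = ⟦evalPair⟧ ρ 6 pC (Pp E) (⟦pC⟧ δ x y)
      qq : (⟦ Q₀ ⟧ℚ ρ , ⟦ Q₁ ⟧ℚ ρ) ≡ QQ
      qq = ⟦evalPair⟧ ρ 3 qC (Qp E) (⟦qC⟧ δ x y)
      on′ : ((y₀ , y₁) *d (y₀ , y₁)) +d ((⟦ Q₀ ⟧ℚ ρ , ⟦ Q₁ ⟧ℚ ρ) *d (y₀ , y₁)) ≡ (⟦ P₀ ⟧ℚ ρ , ⟦ P₁ ⟧ℚ ρ)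
      on′ = trans (cong (λ z → ((y₀ , y₁) *d (y₀ , y₁)) +d (z *d (y₀ , y₁))) qq) (trans on (sym pp))
      fix′ : negd (y₀ , y₁) +d negd (⟦ Q₀ ⟧ℚ ρ , ⟦ Q₁ ⟧ℚ ρ) ≡ (y₀ , y₁)
      fix′ = trans (cong (λ z → negd (y₀ , y₁) +d negd z) qq) (cong yy fix)
      g₀ : y₀ + y₀ + ⟦ Q₀ ⟧ℚ ρ ≡ 0ℚ
      g₀ = fixed⇒ y₀ (⟦ Q₀ ⟧ℚ ρ) (cong proj₁ fix′)
      g₁ : y₁ + y₁ + ⟦ Q₁ ⟧ℚ ρ ≡ 0ℚ
      g₁ = fixed⇒ y₁ (⟦ Q₁ ⟧ℚ ρ) (cong proj₂ fix′)
      e₀ e₁ e₂ e₃ e₄ : Expr ℤ 5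
      e₀ = Ι (# 0)
      e₁ = Ι (# 1)
      e₂ = Ι (# 2)
      e₃ = Ι (# 3)
      e₄ = Ι (# 4)
      τ : Vec ℚ 5
      τ = y₀ ∷ y₁ ∷ ⟦ Q₀ ⟧ℚ ρ ∷ ⟦ Q₁ ⟧ℚ ρ ∷ δ ∷ []
      t₀ t₁ : Expr ℤ 5
      t₀ = e₀ :+ e₀ :+ e₂
      t₁ = e₁ :+ e₁ :+ e₃
      rat : ⟦ R₁ ⟧ℚ ρ * x + ⟦ R₀ ⟧ℚ ρ ≡ 0ℚ
      rat = trans (sym (identityℚ (4 · P₀ :+ (Q₀ :* Q₀ :+ d :* (Q₁ :* Q₁))) (R₁ :* r :+ R₀) rational-part ρ))
        (trans (cong (λ z → ℤ→ℚ (+ 4) * z + (⟦ Q₀ ⟧ℚ ρ * ⟦ Q₀ ⟧ℚ ρ + δ * (⟦ Q₁ ⟧ℚ ρ * ⟦ Q₁ ⟧ℚ ρ))) (sym (cong proj₁ on′)))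
        (trans (identityℚ (4 · ((e₀ :* e₀ :+ e₄ :* (e₁ :* e₁)) :+ (e₂ :* e₀ :+ e₄ :* (e₃ :* e₁))) :+ (e₂ :* e₂ :+ e₄ :* (e₃ :* e₃)))
                          (t₀ :* t₀ :+ e₄ :* (t₁ :* t₁)) refl τ)
        (cong₂ _+_ (zero-times (⟦ t₀ ⟧ℚ τ) g₀) (times-zero δ (zero-times (⟦ t₁ ⟧ℚ τ) g₁)))))
      irrat : ⟦ R₁ ⟧ℚ ρ * y ≡ 0ℚ
      irrat = trans (sym (identityℚ (4 · P₁ :+ 2 · (Q₀ :* Q₁)) (R₁ :* s) irrational-part ρ))
        (trans (cong (λ z → ℤ→ℚ (+ 4) * z + ℤ→ℚ (+ 2) * (⟦ Q₀ ⟧ℚ ρ * ⟦ Q₁ ⟧ℚ ρ)) (sym (cong proj₂ on′)))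
        (trans (identityℚ (4 · ((e₀ :* e₁ :+ e₁ :* e₀) :+ (e₂ :* e₁ :+ e₃ :* e₀)) :+ 2 · (e₂ :* e₃)) (2 · (t₀ :* t₁)) refl τ)
        (times-zero (ℤ→ℚ (+ 2)) (zero-times (⟦ t₁ ⟧ℚ τ) g₀))))
      y≢0 : y ≢ 0ℚ
      y≢0 y≡0 = irr (y≡0 , double-zero y₁ (trans (sym (ℚ.+-identityʳ (y₁ + y₁))) (trans (cong (λ z → y₁ + y₁ + z) (sym Q₁≡0)) g₁)))
        where
        Q₁≡0 : ⟦ Q₁ ⟧ℚ ρ ≡ 0ℚ
        Q₁≡0 = trans (identityℚ Q₁ (s :* (qC 1 :+ 2 · (qC 2 :* r))) Q₁-multiple ρ) (zero-times (⟦ qC 1 :+ 2 · (qC 2 :* r) ⟧ℚ ρ) y≡0)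
      R₁≡0 : ⟦ R₁ ⟧ℚ ρ ≡ 0ℚ
      R₁≡0 = go (product-zero (⟦ R₁ ⟧ℚ ρ) y irrat)
        where
        go : ⟦ R₁ ⟧ℚ ρ ≡ 0ℚ ⊎ y ≡ 0ℚ → ⟦ R₁ ⟧ℚ ρ ≡ 0ℚ
        go (inj₁ p) = p
        go (inj₂ p) = ⊥-elim (y≢0 p)
      R₀≡0 : ⟦ R₀ ⟧ℚ ρ ≡ 0ℚ
      R₀≡0 = trans (sym (ℚ.+-identityˡ (⟦ R₀ ⟧ℚ ρ))) (trans (cong (λ z → z + ⟦ R₀ ⟧ℚ ρ) (sym (zero-times x R₁≡0))) rat)

-- Clearing denominators in the rational factorisation

module ClearingDenominators where
  open import Defs using (ℤ→ℚ)
  open Forms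
  open Congruence using (_[_])
  open Defects using (one)
  open Embedding
  open GaussLemma
  open RationalEvaluation
  open import Data.Rational using (mkℚ; _*_; -_; ↥_; ↧ₙ_; toℚᵘ)
  open import Data.Rational.Unnormalised as ℚᵘ using (mkℚᵘ; *≡*)
  import Data.Rational.Unnormalised.Properties as ℚᵘ

  clear-denominator : ∀ z → z * ℤ→ℚ (+ ↧ₙ z) ≡ ℤ→ℚ (↥ z)
  clear-denominator z@(mkℚ n d-1 _) = ℚ.toℚᵘ-injective (begin
    toℚᵘ (z * ℤ→ℚ (+ suc d-1))               ≈⟨ ℚ.toℚᵘ-homo-* z (ℤ→ℚ (+ suc d-1)) ⟩
    mkℚᵘ n d-1 ℚᵘ.* toℚᵘ (ℤ→ℚ (+ suc d-1))   ≈⟨ ℚᵘ.*-cong (ℚᵘ.≃-refl {mkℚᵘ n d-1}) (toℚᵘ-ℤ→ℚ (+ suc d-1)) ⟩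
    mkℚᵘ n d-1 ℚᵘ.* mkℚᵘ (+ suc d-1) 0       ≈⟨ *≡* (trans (ℤ.*-identityʳ (n ℤ.* + suc d-1)) (cong (λ k → n ℤ.* + suc k) (sym (ℕ.*-identityʳ d-1)))) ⟩
    mkℚᵘ n 0                                 ≈⟨ ℚᵘ.≃-sym (toℚᵘ-ℤ→ℚ n) ⟩
    toℚᵘ (ℤ→ℚ n)                             ∎)
    where open ℚᵘ.≃-Reasoning

  stateOf : Factors → Vec ℤ 3 → Vec ℤ 11
  stateOf φ qs = βₙ φ ∷ + αₙ φ ∷ vₙ φ ∷ uₙ φ ∷ + wₙ φ ∷ v′ₙ φ ∷ u′ₙ φ ∷ + w′ₙ φ ∷ qs
    where open Factors

  sum-hom : ∀ {m} n (f : ℕ → Expr ℤ m) (g : ℕ → ℤ) ρ → (∀ i → ⟦ f i ⟧ ρ ≡ g i) → ⟦ sumE n f ⟧ ρ ≡ sumZ n g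
  sum-hom zero    f g ρ eq = refl
  sum-hom (suc n) f g ρ eq = cong₂ ℤ._+_ (sum-hom n f g ρ eq) (eq n)

  conv-hom : ∀ {m} (f f′ : ℕ → Expr ℤ m) (g g′ : ℕ → ℤ) ρ → (∀ i → ⟦ f i ⟧ ρ ≡ g i) → (∀ i → ⟦ f′ i ⟧ ρ ≡ g′ i) →
             ∀ k → ⟦ convE f f′ k ⟧ ρ ≡ convZ g g′ k
  conv-hom f f′ g g′ ρ eq eq′ k = sum-hom (suc k) (λ i → f i :* f′ (k ∸ i)) (λ i → g i ℤ.* g′ (k ∸ i)) ρ
    (λ i → cong₂ ℤ._*_ (eq i) (eq′ (k ∸ i)))

  coeff-hom : ∀ {m n} (es : Vec (Expr ℤ m) n) ρ k → ⟦ coeffE es k ⟧ ρ ≡ coeffZ (Vec.map (λ e → ⟦ e ⟧ ρ) es) k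
  coeff-hom []       ρ k       = refl
  coeff-hom (e ∷ es) ρ zero    = refl
  coeff-hom (e ∷ es) ρ (suc k) = coeff-hom es ρ k

  expanded≡ : ∀ φ qs k → ⟦ prodC k ⟧ (stateOf φ qs) ≡ Factors.expanded φ k
  expanded≡ φ qs = conv-hom (convE linC quadC) quadC′ (convZ (Factors.linear φ) (Factors.quadratic φ)) (Factors.quadratic′ φ) ρ
    (conv-hom linC quadC (Factors.linear φ) (Factors.quadratic φ) ρ
      (coeff-hom (Forms.β ∷ Forms.α ∷ []) ρ) (coeff-hom (Forms.v ∷ Forms.u ∷ Forms.w ∷ []) ρ))
    (coeff-hom (Forms.v′ ∷ Forms.u′ ∷ Forms.w′ ∷ []) ρ)
    where ρ = stateOf φ qs

  module Scaling where
    t a b c e A W M : Expr ℤ 8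
    t = Ι (# 0)
    a = Ι (# 1)
    b = Ι (# 2)
    c = Ι (# 3)
    e = Ι (# 4)
    A = Ι (# 5)
    W = Ι (# 6)
    M = Ι (# 7)

    scaled unscaled : Vec (Expr ℤ 8) 11
    scaled   = :- (t :* A) ∷ A ∷ b :* W ∷ a :* W ∷ W ∷ e :* M ∷ c :* M ∷ 4 · M ∷ Κ (+ 0) ∷ Κ (+ 0) ∷ Κ (+ 0) ∷ []
    unscaled = :- t ∷ one ∷ b ∷ a ∷ one ∷ e ∷ c ∷ Κ (+ 4) ∷ Κ (+ 0) ∷ Κ (+ 0) ∷ Κ (+ 0) ∷ []

    homogeneity : ∀ k → k ℕ.≤ 5 → norm (prodC k [ scaled ]) ≡ norm (prodC k [ unscaled ] :* (A :* W :* M))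
    homogeneity 0 _ = refl
    homogeneity 1 _ = refl
    homogeneity 2 _ = refl
    homogeneity 3 _ = refl
    homogeneity 4 _ = refl
    homogeneity 5 _ = refl
    homogeneity (suc (suc (suc (suc (suc (suc _)))))) (ℕ.s≤s (ℕ.s≤s (ℕ.s≤s (ℕ.s≤s (ℕ.s≤s ())))))

  open Scaling using (scaled; unscaled; homogeneity)

  vec-cong : ∀ {A : Set} {x₀ x₁ x₂ x₃ x₄ x₅ x₆ x₇ y₀ y₁ y₂ y₃ y₄ y₅ y₆ y₇ : A} {n} {xs : Vec A n} →
    x₀ ≡ y₀ → x₁ ≡ y₁ → x₂ ≡ y₂ → x₃ ≡ y₃ → x₄ ≡ y₄ → x₅ ≡ y₅ → x₆ ≡ y₆ → x₇ ≡ y₇ →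
    _≡_ {A = Vec A (8 ℕ.+ n)} (x₀ ∷ x₁ ∷ x₂ ∷ x₃ ∷ x₄ ∷ x₅ ∷ x₆ ∷ x₇ ∷ xs) (y₀ ∷ y₁ ∷ y₂ ∷ y₃ ∷ y₄ ∷ y₅ ∷ y₆ ∷ y₇ ∷ xs)
  vec-cong refl refl refl refl refl refl refl refl = refl

  -- Clearing denominators in (x - t)(x² + a x + b)(4x² + c x + e).
  module _ (t a b c e : ℚ) where
    -- Each quadratic is multiplied by the product of the denominators of its two lower
    -- coefficients. So the leading coefficients are natural numbers, and the factor 4 of F stays
    -- with the second quadratic.
    numerators : Factors
    numerators = factors (ℤ.- ↥ t) (↥ b ℤ.* + ↧ₙ a) (↥ a ℤ.* + ↧ₙ b) (↥ e ℤ.* + ↧ₙ c) (↥ c ℤ.* + ↧ₙ e)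
      (↧ₙ t) (↧ₙ a ℕ.* ↧ₙ b) (4 ℕ.* (↧ₙ c ℕ.* ↧ₙ e))

    denominator : ℕ
    denominator = ↧ₙ t ℕ.* (↧ₙ a ℕ.* ↧ₙ b) ℕ.* (↧ₙ c ℕ.* ↧ₙ e)

    private
      env₈ : Vec ℚ 8
      env₈ = t ∷ a ∷ b ∷ c ∷ e ∷ ℤ→ℚ (+ ↧ₙ t) ∷ ℤ→ℚ (+ (↧ₙ a ℕ.* ↧ₙ b)) ∷ ℤ→ℚ (+ (↧ₙ c ℕ.* ↧ₙ e)) ∷ []

      ℕ-* : ∀ m n → ℤ→ℚ (+ (m ℕ.* n)) ≡ ℤ→ℚ (+ m) * ℤ→ℚ (+ n)
      ℕ-* m n = trans (cong ℤ→ℚ (ℤ.pos-* m n)) (ℤ→ℚ-* (+ m) (+ n))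

      first : ∀ y z → ℤ→ℚ (↥ y ℤ.* + ↧ₙ z) ≡ y * ℤ→ℚ (+ (↧ₙ y ℕ.* ↧ₙ z))
      first y z = trans (ℤ→ℚ-* (↥ y) (+ ↧ₙ z)) (trans (cong (_* ℤ→ℚ (+ ↧ₙ z)) (sym (clear-denominator y)))
        (trans (ℚ.*-assoc y (ℤ→ℚ (+ ↧ₙ y)) (ℤ→ℚ (+ ↧ₙ z))) (cong (y *_) (sym (ℕ-* (↧ₙ y) (↧ₙ z))))))

      second : ∀ y z → ℤ→ℚ (↥ z ℤ.* + ↧ₙ y) ≡ z * ℤ→ℚ (+ (↧ₙ y ℕ.* ↧ₙ z))
      second y z = trans (first z y) (cong (λ n → z * ℤ→ℚ (+ n)) (ℕ.*-comm (↧ₙ z) (↧ₙ y)))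

      state≡ : Vec.map ℤ→ℚ (stateOf numerators (+ 0 ∷ + 0 ∷ + 0 ∷ [])) ≡ ⟦ scaled ⟧ℚ* env₈
      state≡ = vec-cong (trans (ℤ→ℚ-neg (↥ t)) (cong -_ (sym (clear-denominator t)))) refl (second a b) (first a b) refl
        (second c e) (first c e) (ℕ-* 4 (↧ₙ c ℕ.* ↧ₙ e))

    clear-denominators : ∀ (F : ℕ → ℤ) → (∀ k → k ℕ.≤ 5 → ⟦ prodC k ⟧ℚ (- t ∷ 1ℚ ∷ b ∷ a ∷ 1ℚ ∷ e ∷ c ∷ ℤ→ℚ (+ 4) ∷ 0ℚ ∷ 0ℚ ∷ 0ℚ ∷ []) ≡ ℤ→ℚ (F k)) →
                         numerators Expands (λ k → F k ℤ.* + denominator)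
    clear-denominators F eq k k≤5 = trans (sym (expanded≡ numerators (+ 0 ∷ + 0 ∷ + 0 ∷ []) k)) (ℤ→ℚ-injective (begin
      ℤ→ℚ (⟦ prodC k ⟧ (stateOf numerators (+ 0 ∷ + 0 ∷ + 0 ∷ [])))             ≡⟨ ℤ→ℚ-⟦⟧ (prodC k) (stateOf numerators (+ 0 ∷ + 0 ∷ + 0 ∷ [])) ⟩
      ⟦ prodC k ⟧ℚ (Vec.map ℤ→ℚ (stateOf numerators (+ 0 ∷ + 0 ∷ + 0 ∷ [])))    ≡⟨ cong ⟦ prodC k ⟧ℚ state≡ ⟩
      ⟦ prodC k ⟧ℚ (⟦ scaled ⟧ℚ* env₈)                                          ≡⟨ specialiseℚ (prodC k) scaled (prodC k [ unscaled ] :* (Scaling.A :* Scaling.W :* Scaling.M)) (homogeneity k k≤5) env₈ ⟩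
      ⟦ prodC k [ unscaled ] ⟧ℚ env₈ * N                                        ≡⟨ cong₂ _*_ (trans (⟦[]⟧ℚ (prodC k) unscaled env₈) (eq k k≤5)) (sym N≡) ⟩
      ℤ→ℚ (F k) * ℤ→ℚ (+ denominator)                                           ≡⟨ ℤ→ℚ-* (F k) (+ denominator) ⟨
      ℤ→ℚ (F k ℤ.* + denominator)                                               ∎))
      where
      open ≡-Reasoning
      N : ℚ
      N = ℤ→ℚ (+ ↧ₙ t) * ℤ→ℚ (+ (↧ₙ a ℕ.* ↧ₙ b)) * ℤ→ℚ (+ (↧ₙ c ℕ.* ↧ₙ e))
      N≡ : ℤ→ℚ (+ denominator) ≡ N
      N≡ = trans (ℕ-* (↧ₙ t ℕ.* (↧ₙ a ℕ.* ↧ₙ b)) (↧ₙ c ℕ.* ↧ₙ e)) (cong (_* ℤ→ℚ (+ (↧ₙ c ℕ.* ↧ₙ e))) (ℕ-* (↧ₙ t) (↧ₙ a ℕ.* ↧ₙ b)))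

    denominator≢0 : ℕ.NonZero denominator
    denominator≢0 = ℕ.m*n≢0 (↧ₙ t ℕ.* (↧ₙ a ℕ.* ↧ₙ b)) (↧ₙ c ℕ.* ↧ₙ e)
      {{ℕ.m*n≢0 (↧ₙ t) (↧ₙ a ℕ.* ↧ₙ b) {{_}} {{ℕ.m*n≢0 (↧ₙ a) (↧ₙ b)}}}} {{ℕ.m*n≢0 (↧ₙ c) (↧ₙ e)}}

-- From the curve to the arithmetic of its three integral factors

module Reduction where
  open import Defs
  open Forms
  open Congruence using (_[_]; identity; ⟦[]⟧; ⟦_⟧*)
  open Defects using (one; defect; leads)
  open TwoAdic using (Reduced)
  open LeadingCoefficients using (leads-absurd)
  open DiscriminantOfProduct using (discForm-factors; abs-of-Δ; discriminantOf; discriminantOf-abs; specialise)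
  open Embedding
  open GaussLemma
  open RationalEvaluation
  open QuadraticDivision
  open CurvePolynomials
  open WeierstrassPoints
  open ClearingDenominators
  import Data.Bool as Bool
  open import Data.Integer.Divisibility.Signed using (divides) renaming (_∣_ to _∣ℤ_)
  open import Data.Rational using (_+_; _*_; -_; _-_; 1/_; ≢-nonZero)
  open Division using (horner; k[t])
  open Curve

  module Quadratic where
    -- `i°` stands for 1/(2w). As inversion is foreign to polynomial identities, these carry
    -- explicit multiples of `h°`, which vanishes at the actual inverse.
    w° u° v° k° i° h° : Expr ℤ 5
    w° = Ι (# 0)
    u° = Ι (# 1)
    v° = Ι (# 2)
    k° = Ι (# 3)
    i° = Ι (# 4)
    h° = 2 · w° :* i° :- one

    root° quad° : Expr ℤ 5
    root° = (:- u° :+ k°) :* i°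
    quad° = w° :* (root° :* root°) :+ u° :* root° :+ v°

    completed-square : norm (4 · w° :* quad°) ≡
      norm (h° :* ((k° :- u°) :* (2 · k° :+ (k° :- u°) :* h°)) :+ (k° :* k° :- (u° :* u° :- 4 · (w° :* v°))))
    completed-square = refl

    difference : norm (k° :+ k°) ≡ norm (2 · w° :* (root° :- (:- u° :- k°) :* i°) :- 2 · k° :* h°)
    difference = refl

  open Quadratic

  module _ (w u v : ℚ) (w≢0 : w ≢ 0ℚ) where
    private
      2w≢0 : ℤ→ℚ (+ 2) * w ≢ 0ℚ
      2w≢0 p = go (product-zero (ℤ→ℚ (+ 2)) w p)
        where
        go : ℤ→ℚ (+ 2) ≡ 0ℚ ⊎ w ≡ 0ℚ → ⊥
        go (inj₁ ())
        go (inj₂ q) = w≢0 q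
      4w≢0 : ℤ→ℚ (+ 4) * w ≢ 0ℚ
      4w≢0 p = go (product-zero (ℤ→ℚ (+ 4)) w p)
        where
        go : ℤ→ℚ (+ 4) ≡ 0ℚ ⊎ w ≡ 0ℚ → ⊥
        go (inj₁ ())
        go (inj₂ q) = w≢0 q
      i : ℚ
      i = 1/_ (ℤ→ℚ (+ 2) * w) {{≢-nonZero 2w≢0}}
      h≡0 : ℤ→ℚ (+ 2) * w * i + - 1ℚ ≡ 0ℚ
      h≡0 = trans (cong (_+ - 1ℚ) (ℚ.*-inverseʳ (ℤ→ℚ (+ 2) * w) {{≢-nonZero 2w≢0}})) refl

    root-from-square : ∀ k → k * k ≡ u * u - ℤ→ℚ (+ 4) * (w * v) →
                       let x = (- u + k) * i in w * (x * x) + u * x + v ≡ 0ℚ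
    root-from-square k sq = go (product-zero (ℤ→ℚ (+ 4) * w) (⟦ quad° ⟧ℚ ρ)
        (trans (identityℚ (4 · w° :* quad°) (h° :* ((k° :- u°) :* (2 · k° :+ (k° :- u°) :* h°)) :+ (k° :* k° :- (u° :* u° :- 4 · (w° :* v°)))) completed-square ρ)
          (cong₂ _+_ (zero-times (⟦ (k° :- u°) :* (2 · k° :+ (k° :- u°) :* h°) ⟧ℚ ρ) h≡0)
                     (trans (cong (_- (u * u - ℤ→ℚ (+ 4) * (w * v))) sq) (ℚ.+-inverseʳ (u * u - ℤ→ℚ (+ 4) * (w * v)))))))
      where
      ρ : Vec ℚ 5
      ρ = w ∷ u ∷ v ∷ k ∷ i ∷ []
      go : ℤ→ℚ (+ 4) * w ≡ 0ℚ ⊎ ⟦ quad° ⟧ℚ ρ ≡ 0ℚ → ⟦ quad° ⟧ℚ ρ ≡ 0ℚ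
      go (inj₁ p) = ⊥-elim (4w≢0 p)
      go (inj₂ p) = p

    -- The roots (-u ± k)/(2w) are both rational; if they coincide, their difference k/w is 0.
    square-discriminant : (∀ x y → w * (x * x) + u * x + v ≡ 0ℚ → w * (y * y) + u * y + v ≡ 0ℚ → x ≡ y) →
                          ∀ k → k * k ≡ u * u - ℤ→ℚ (+ 4) * (w * v) → k ≡ 0ℚ
    square-discriminant unique k sq = double-zero k (trans (identityℚ (k° :+ k°) (2 · w° :* (root° :- (:- u° :- k°) :* i°) :- 2 · k° :* h°) difference ρ)
        (cong₂ (λ x y → x + - y) (times-zero (ℤ→ℚ (+ 2) * w) (trans (cong (_- (- u - k) * i) x₁≡x₂) (ℚ.+-inverseʳ ((- u - k) * i))))
                                 (times-zero (ℤ→ℚ (+ 2) * k) h≡0)))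
      where
      ρ : Vec ℚ 5
      ρ = w ∷ u ∷ v ∷ k ∷ i ∷ []
      sq′ : (- k) * (- k) ≡ u * u - ℤ→ℚ (+ 4) * (w * v)
      sq′ = trans (identityℚ (:- k° :* (:- k°)) (k° :* k°) refl ρ) sq
      x₁≡x₂ : (- u + k) * i ≡ (- u - k) * i
      x₁≡x₂ = unique ((- u + k) * i) ((- u - k) * i) (root-from-square k sq) (root-from-square (- k) sq′)

  module _ (p₀ p₁ p₂ p₃ p₄ c₀ c₁ c₂ : ℤ) where
    open Points p₀ p₁ p₂ p₃ p₄ c₀ c₁ c₂

    point : Vec ℤ 11
    point = + 0 ∷ + 0 ∷ + 0 ∷ coefficients

    FZ : ℕ → ℤ
    FZ k = ⟦ fC k ⟧ point

    Fp≡ : ∀ k → Fp E k ≡ ℤ→ℚ (FZ k)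
    Fp≡ k = trans (sym (⟦fC⟧ 0ℚ 0ℚ 0ℚ k)) (sym (ℤ→ℚ-⟦⟧ (fC k) point))

    ⟦fC⟧≡ : ∀ δ x y k → ⟦ fC k ⟧ℚ (env δ x y) ≡ ℤ→ℚ (FZ k)
    ⟦fC⟧≡ δ x y k = trans (⟦fC⟧ δ x y k) (Fp≡ k)

    FZ₅ : FZ 5 ≡ + 4
    FZ₅ = identity (fC 5) (Κ (+ 4)) refl point

    FZ₆ : FZ 6 ≡ + 0
    FZ₆ = identity (fC 6) (Κ (+ 0)) refl point

    qs : Vec ℤ 3
    qs = c₀ ∷ c₁ ∷ c₂ ∷ []

    integral-factorisation : ∃ Root → QuadraticFactor → ∃ λ ψ → ψ Expands FZ
    integral-factorisation (t , root) (δ , x , y , nonsquare , y≢0 , R₁≡0 , R₀≡0) =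
      integral-factors (denominator t a b c e) {{denominator≢0 t a b c e}} FZ (numerators t a b c e)
        (clear-denominators t a b c e FZ (λ k k≤5 → trans (factorisation ρ r₁≡0 r₀≡0 k[t]≡0 k k≤5) (f≡ k k≤5)))
      where
      a b : ℚ
      a = ⟦ :- (2 · r) ⟧ℚ (env δ x y)
      b = ⟦ r :* r :- d :* (s :* s) ⟧ℚ (env δ x y)
      coeffs₈ : ℚ → ℚ → ℚ → Vec ℚ 8
      coeffs₈ t a b = ℤ→ℚ (FZ 0) ∷ ℤ→ℚ (FZ 1) ∷ ℤ→ℚ (FZ 2) ∷ ℤ→ℚ (FZ 3) ∷ ℤ→ℚ (FZ 4) ∷ t ∷ a ∷ b ∷ []
      ρ : Vec ℚ 8
      ρ = coeffs₈ t a b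
      c e : ℚ
      c = ⟦ Division.c ⟧ℚ ρ
      e = ⟦ Division.e ⟧ℚ ρ
      -- The remainder does not involve the rational root, whose slot holds 0 here; in the same way
      -- `a` and `b` are 0 where only F(t) is evaluated.
      toDivision≡ : ⟦ toDivision ⟧ℚ* (env δ x y) ≡ coeffs₈ 0ℚ a b
      toDivision≡ = vec-cong (⟦fC⟧≡ δ x y 0) (⟦fC⟧≡ δ x y 1) (⟦fC⟧≡ δ x y 2) (⟦fC⟧≡ δ x y 3) (⟦fC⟧≡ δ x y 4) refl refl refl
      r₁≡0 : ⟦ Division.r₁ ⟧ℚ (coeffs₈ 0ℚ a b) ≡ 0ℚ
      r₁≡0 = trans (cong ⟦ Division.r₁ ⟧ℚ (sym toDivision≡)) (trans (sym (⟦[]⟧ℚ Division.r₁ toDivision (env δ x y))) R₁≡0)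
      r₀≡0 : ⟦ Division.r₀ ⟧ℚ (coeffs₈ 0ℚ a b) ≡ 0ℚ
      r₀≡0 = trans (cong ⟦ Division.r₀ ⟧ℚ (sym toDivision≡)) (trans (sym (⟦[]⟧ℚ Division.r₀ toDivision (env δ x y))) R₀≡0)
      evaluation : Vec (Expr ℤ 11) 8
      evaluation = fC 0 ∷ fC 1 ∷ fC 2 ∷ fC 3 ∷ fC 4 ∷ r ∷ Κ (+ 0) ∷ Κ (+ 0) ∷ []
      evaluation≡ : ⟦ evaluation ⟧ℚ* (env 0ℚ t 0ℚ) ≡ coeffs₈ t 0ℚ 0ℚ
      evaluation≡ = vec-cong (⟦fC⟧≡ 0ℚ t 0ℚ 0) (⟦fC⟧≡ 0ℚ t 0ℚ 1) (⟦fC⟧≡ 0ℚ t 0ℚ 2) (⟦fC⟧≡ 0ℚ t 0ℚ 3) (⟦fC⟧≡ 0ℚ t 0ℚ 4) refl refl refl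
      horner≡0 : ⟦ horner Division.f Division.t ⟧ℚ (coeffs₈ t 0ℚ 0ℚ) ≡ 0ℚ
      horner≡0 = trans (cong ⟦ horner Division.f Division.t ⟧ℚ (sym evaluation≡))
        (trans (specialiseℚ (horner Division.f Division.t) evaluation Fr refl (env 0ℚ t 0ℚ)) root)
      m : Expr ℤ 8
      m = Division.t :* Division.t :+ Division.a :* Division.t :+ Division.b
      -- If `t` were a root of (X - x)² - δ y², then (t - x)/y would be a rational square root of δ.
      m≢0 : ⟦ m ⟧ℚ ρ ≢ 0ℚ
      m≢0 m≡0 = nonsquare ((t - x) * i) (begin
        (t - x) * i * ((t - x) * i)
          ≡⟨ identityℚ ((T :- X) :* I :* ((T :- X) :* I)) (I :* I :* (T :* T :+ (:- (2 · X)) :* T :+ (X :* X :- D :* (Y :* Y))) :+ D :* ((Y :* I) :* (Y :* I))) refl τ ⟩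
        i * i * ⟦ m ⟧ℚ ρ + δ * ((y * i) * (y * i))
          ≡⟨ cong₂ (λ m z → i * i * m + δ * (z * z)) m≡0 (ℚ.*-inverseʳ y) ⟩
        i * i * 0ℚ + δ * (1ℚ * 1ℚ)
          ≡⟨ cong₂ _+_ (ℚ.*-zeroʳ (i * i)) (ℚ.*-identityʳ δ) ⟩
        0ℚ + δ
          ≡⟨ ℚ.+-identityˡ δ ⟩
        δ ∎)
        where
        open ≡-Reasoning
        instance
          _ = ≢-nonZero y≢0
        i : ℚ
        i = 1/ y
        T X Y D I : Expr ℤ 5
        T = Ι (# 0)
        X = Ι (# 1)
        Y = Ι (# 2)
        D = Ι (# 3)
        I = Ι (# 4)
        τ : Vec ℚ 5
        τ = t ∷ x ∷ y ∷ δ ∷ i ∷ []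
      k[t]≡0 : ⟦ k[t] ⟧ℚ ρ ≡ 0ℚ
      k[t]≡0 = root-of-cubic ρ r₁≡0 r₀≡0 horner≡0 m≢0
      f≡ : ∀ k → k ℕ.≤ 5 → ⟦ Division.f k ⟧ℚ ρ ≡ ℤ→ℚ (FZ k)
      f≡ 0 _ = refl
      f≡ 1 _ = refl
      f≡ 2 _ = refl
      f≡ 3 _ = refl
      f≡ 4 _ = refl
      f≡ 5 _ = cong ℤ→ℚ (sym FZ₅)
      f≡ (suc (suc (suc (suc (suc (suc _)))))) (ℕ.s≤s (ℕ.s≤s (ℕ.s≤s (ℕ.s≤s (ℕ.s≤s ())))))

    module FromFactors (two : ExactlyTwoRatWP E) (ψ : Factors) (expands : ψ Expands FZ)
                       {ℓ : ℕ} (prime : Prime ℓ)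
                       (E′ : WEq) (E′≡E : E′ ≡ E) (|Δ′|≡ℓ : ℚ.∣ Δ E′ ∣ ≡ ℕ→ℚ ℓ) where
      open Factors ψ using (αₙ; wₙ; w′ₙ; βₙ; vₙ; uₙ; v′ₙ; u′ₙ)

      -- Transported explicitly: comparing Δ E′ with Δ E by conversion would expand the determinant.
      |Δ|≡ℓ : ℚ.∣ Δ E ∣ ≡ ℕ→ℚ ℓ
      |Δ|≡ℓ = subst (λ E → ℚ.∣ Δ E ∣ ≡ ℕ→ℚ ℓ) {E′} {E} E′≡E |Δ′|≡ℓ

      ρ : Vec ℤ 11
      ρ = stateOf ψ qs

      prodC≡ : ∀ rs k → k ℕ.≤ 5 → ⟦ prodC k ⟧ (stateOf ψ rs) ≡ FZ k
      prodC≡ rs k k≤5 = trans (expanded≡ ψ rs k) (expands k k≤5)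

      leads≡4 : αₙ ℕ.* wₙ ℕ.* w′ₙ ≡ 4
      leads≡4 = ℤ.+-injective (trans (trans (ℤ.pos-* (αₙ ℕ.* wₙ) w′ₙ) (cong (ℤ._* + w′ₙ) (ℤ.pos-* αₙ wₙ)))
        (trans (sym (identity (prodC 5) (α :* w :* w′) refl ρ)) (trans (prodC≡ qs 5 (ℕ.≤ᵇ⇒≤ 5 5 _)) FZ₅)))

      discriminant≡ : discForm 6 (Fp E) ≡ ℤ→ℚ (discriminantOf (⟦ prodC 5 ⟧ ρ) (⟦ disc ⟧ ρ) (⟦ disc′ ⟧ ρ) (⟦ res ⟧ ρ) (⟦ val :* val′ ⟧ ρ))
      discriminant≡ = discForm-factors ρ (Fp E) (λ k k≤5 → trans (Fp≡ k) (cong ℤ→ℚ (sym (prodC≡ qs k k≤5)))) (trans (Fp≡ 6) (cong ℤ→ℚ FZ₆))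

      size : ℤ.∣ ⟦ disc ⟧ ρ ∣ ℕ.* ℤ.∣ ⟦ disc′ ⟧ ρ ∣ ℕ.* (ℤ.∣ ⟦ mixed ⟧ ρ ∣ ℕ.* ℤ.∣ ⟦ mixed ⟧ ρ ∣) ≡ 256 ℕ.* ℓ
      size = discriminantOf-abs ρ ℓ (trans (cong ℤ.∣_∣ (cong (λ l → discriminantOf l (⟦ disc ⟧ ρ) (⟦ disc′ ⟧ ρ) (⟦ res ⟧ ρ) (⟦ val :* val′ ⟧ ρ))
          (sym (trans (prodC≡ qs 5 (ℕ.≤ᵇ⇒≤ 5 5 _)) FZ₅))))
        (abs-of-Δ (discriminantOf (⟦ prodC 5 ⟧ ρ) (⟦ disc ⟧ ρ) (⟦ disc′ ⟧ ρ) (⟦ res ⟧ ρ) (⟦ val :* val′ ⟧ ρ)) ℓ (trans (cong (λ x → ℚ.∣ x * ((+ 1) ℚ./ 4096) ∣) (sym discriminant≡)) |Δ|≡ℓ)))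

      256ℓ≢0 : 256 ℕ.* ℓ ≢ 0
      256ℓ≢0 p = ℕ.≢-nonZero⁻¹ (256 ℕ.* ℓ) {{ℕ.m*n≢0 256 ℓ {{_}} {{prime⇒nonZero prime}}}} p

      disc≢0 : ⟦ disc ⟧ ρ ≢ + 0
      disc≢0 p = 256ℓ≢0 (trans (sym size) (cong (λ z → ℤ.∣ z ∣ ℕ.* ℤ.∣ ⟦ disc′ ⟧ ρ ∣ ℕ.* (ℤ.∣ ⟦ mixed ⟧ ρ ∣ ℕ.* ℤ.∣ ⟦ mixed ⟧ ρ ∣)) p))

      disc′≢0 : ⟦ disc′ ⟧ ρ ≢ + 0
      disc′≢0 p = 256ℓ≢0 (trans (sym size) (trans (cong (λ z → ℤ.∣ ⟦ disc ⟧ ρ ∣ ℕ.* ℤ.∣ z ∣ ℕ.* (ℤ.∣ ⟦ mixed ⟧ ρ ∣ ℕ.* ℤ.∣ ⟦ mixed ⟧ ρ ∣)) p)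
        (cong (ℕ._* (ℤ.∣ ⟦ mixed ⟧ ρ ∣ ℕ.* ℤ.∣ ⟦ mixed ⟧ ρ ∣)) (ℕ.*-zeroʳ ℤ.∣ ⟦ disc ⟧ ρ ∣))))

      leads≢0 : (wₙ ≢ 0) × (w′ₙ ≢ 0)
      leads≢0 = (λ p → ℕ.0≢1+n (trans (sym (cong (ℕ._* w′ₙ) (trans (cong (αₙ ℕ.*_) p) (ℕ.*-zeroʳ αₙ)))) leads≡4)) ,
                (λ p → ℕ.0≢1+n (trans (sym (trans (cong (αₙ ℕ.* wₙ ℕ.*_) p) (ℕ.*-zeroʳ (αₙ ℕ.* wₙ)))) leads≡4))

      cast≢0 : ∀ {n} → n ≢ 0 → ℤ→ℚ (+ n) ≢ 0ℚ
      cast≢0 n≢0 p = n≢0 (ℤ.+-injective (ℤ→ℚ-injective p))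

      -- prodC does not involve q₀, which serves here as the indeterminate.
      quadratic₁ quadratic₂ : Expr ℤ 11
      quadratic₁ = w :* (q₀ :* q₀) :+ u :* q₀ :+ v
      quadratic₂ = w′ :* (q₀ :* q₀) :+ u′ :* q₀ :+ v′

      at : ℚ → Vec ℚ 11
      at x = ℤ→ℚ βₙ ∷ ℤ→ℚ (+ αₙ) ∷ ℤ→ℚ vₙ ∷ ℤ→ℚ uₙ ∷ ℤ→ℚ (+ wₙ) ∷ ℤ→ℚ v′ₙ ∷ ℤ→ℚ u′ₙ ∷ ℤ→ℚ (+ w′ₙ) ∷ x ∷ 0ℚ ∷ 0ℚ ∷ []

      value-at : ∀ x → ⟦ Fr ⟧ℚ (env 0ℚ x 0ℚ) ≡ ⟦ α :* q₀ :+ β ⟧ℚ (at x) * ⟦ quadratic₁ ⟧ℚ (at x) * ⟦ quadratic₂ ⟧ℚ (at x)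
      value-at x = begin
        ⟦ Fr ⟧ℚ (env 0ℚ x 0ℚ)              ≡⟨ specialiseℚ H σ Fr refl (env 0ℚ x 0ℚ) ⟨
        ⟦ H ⟧ℚ (⟦ σ ⟧ℚ* (env 0ℚ x 0ℚ))     ≡⟨ cong ⟦ H ⟧ℚ vectors ⟩
        ⟦ H ⟧ℚ (⟦ τ ⟧ℚ* (at x))            ≡⟨ specialiseℚ H τ ((α :* q₀ :+ β) :* quadratic₁ :* quadratic₂) refl (at x) ⟩
        ⟦ α :* q₀ :+ β ⟧ℚ (at x) * ⟦ quadratic₁ ⟧ℚ (at x) * ⟦ quadratic₂ ⟧ℚ (at x) ∎
        where
        open ≡-Reasoning
        H : Expr ℤ 8
        H = horner (coeffE (Ι (# 0) ∷ Ι (# 1) ∷ Ι (# 2) ∷ Ι (# 3) ∷ Ι (# 4) ∷ Ι (# 5) ∷ [])) (Ι (# 6))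
        σ τ : Vec (Expr ℤ 11) 8
        σ = fC 0 ∷ fC 1 ∷ fC 2 ∷ fC 3 ∷ fC 4 ∷ fC 5 ∷ r ∷ Κ (+ 0) ∷ []
        τ = prodC 0 ∷ prodC 1 ∷ prodC 2 ∷ prodC 3 ∷ prodC 4 ∷ prodC 5 ∷ q₀ ∷ Κ (+ 0) ∷ []
        erase : Vec (Expr ℤ 11) 11
        erase = β ∷ α ∷ v ∷ u ∷ w ∷ v′ ∷ u′ ∷ w′ ∷ Κ (+ 0) ∷ Κ (+ 0) ∷ Κ (+ 0) ∷ []
        erasable : ∀ k → k ℕ.≤ 5 → norm (prodC k [ erase ]) ≡ norm (prodC k)
        erasable 0 _ = refl
        erasable 1 _ = refl
        erasable 2 _ = refl
        erasable 3 _ = refl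
        erasable 4 _ = refl
        erasable 5 _ = refl
        erasable (suc (suc (suc (suc (suc (suc _)))))) (ℕ.s≤s (ℕ.s≤s (ℕ.s≤s (ℕ.s≤s (ℕ.s≤s ())))))
        both : ∀ k → Bool.T (k ℕ.≤ᵇ 5) → ⟦ fC k ⟧ℚ (env 0ℚ x 0ℚ) ≡ ⟦ prodC k ⟧ℚ (at x)
        both k k≤ = trans (⟦fC⟧≡ 0ℚ x 0ℚ k) (trans (cong ℤ→ℚ (sym (prodC≡ (+ 0 ∷ + 0 ∷ + 0 ∷ []) k k≤5)))
          (trans (ℤ→ℚ-⟦⟧ (prodC k) (stateOf ψ (+ 0 ∷ + 0 ∷ + 0 ∷ []))) (specialiseℚ (prodC k) erase (prodC k) (erasable k k≤5) (at x))))
          where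
          k≤5 : k ℕ.≤ 5
          k≤5 = ℕ.≤ᵇ⇒≤ k 5 k≤

        vectors : ⟦ σ ⟧ℚ* (env 0ℚ x 0ℚ) ≡ ⟦ τ ⟧ℚ* (at x)
        vectors = vec-cong (both 0 _) (both 1 _) (both 2 _) (both 3 _) (both 4 _) (both 5 _) refl refl

      open Unique two using (unique)

      root₁ : ∀ x → ⟦ quadratic₁ ⟧ℚ (at x) ≡ 0ℚ → Root x
      root₁ x p = trans (value-at x) (zero-times (⟦ quadratic₂ ⟧ℚ (at x)) (times-zero (⟦ α :* q₀ :+ β ⟧ℚ (at x)) p))

      root₂ : ∀ x → ⟦ quadratic₂ ⟧ℚ (at x) ≡ 0ℚ → Root x
      root₂ x p = trans (value-at x) (times-zero (⟦ α :* q₀ :+ β ⟧ℚ (at x) * ⟦ quadratic₁ ⟧ℚ (at x)) p)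

      -- Every rational root of f is the unique rational root of F, so a square discriminant would
      -- be 0; but the product in `size` is not 0.
      nonsquare : ∀ k → ⟦ disc ⟧ ρ ≢ k ℤ.* k
      nonsquare k eq = disc≢0 (trans eq (cong (λ z → z ℤ.* z) (ℤ→ℚ-injective {k} {+ 0}
        (square-discriminant (ℤ→ℚ (+ wₙ)) (ℤ→ℚ uₙ) (ℤ→ℚ vₙ) (cast≢0 (proj₁ leads≢0))
          (λ x y p q → unique x y (root₁ x p) (root₁ y q)) (ℤ→ℚ k)
          (trans (sym (ℤ→ℚ-* k k)) (trans (cong ℤ→ℚ (sym eq)) (ℤ→ℚ-⟦⟧ disc ρ)))))))

      nonsquare′ : ∀ k → ⟦ disc′ ⟧ ρ ≢ k ℤ.* k
      nonsquare′ k eq = disc′≢0 (trans eq (cong (λ z → z ℤ.* z) (ℤ→ℚ-injective {k} {+ 0}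
        (square-discriminant (ℤ→ℚ (+ w′ₙ)) (ℤ→ℚ u′ₙ) (ℤ→ℚ v′ₙ) (cast≢0 (proj₂ leads≢0))
          (λ x y p q → unique x y (root₂ x p) (root₂ y q)) (ℤ→ℚ k)
          (trans (sym (ℤ→ℚ-* k k)) (trans (cong ℤ→ℚ (sym eq)) (ℤ→ℚ-⟦⟧ disc′ ρ)))))))

      defects : ∀ k → k ℕ.≤ 4 → + 4 ∣ℤ ⟦ defect k ⟧ ρ
      defects k k≤4 = divides (⟦ pC k ⟧ point) (begin
        ⟦ prodC k ⟧ ρ ℤ.- ⟦ squareC k ⟧ ρ                               ≡⟨ cong₂ ℤ._-_ (prodC≡ qs k (ℕ.m≤n⇒m≤1+n k≤4)) (sym (specialise (squareC k) only-q (squareC k) (q-only k k≤4) ρ)) ⟩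
        ⟦ fC k ⟧ point ℤ.- ⟦ squareC k ⟧ (⟦ from-point ⟧* point)        ≡⟨ cong (λ z → ⟦ fC k ⟧ point ℤ.- z) (sym (⟦[]⟧ (squareC k) from-point point)) ⟩
        ⟦ fC k :- squareC k [ from-point ] ⟧ point                      ≡⟨ identity (fC k :- squareC k [ from-point ]) (pC k :* Κ (+ 4)) (quotient k k≤4) point ⟩
        ⟦ pC k ⟧ point ℤ.* + 4                                          ∎)
        where
        open ≡-Reasoning
        only-q from-point : Vec (Expr ℤ 11) 11
        only-q     = Κ (+ 0) ∷ Κ (+ 0) ∷ Κ (+ 0) ∷ Κ (+ 0) ∷ Κ (+ 0) ∷ Κ (+ 0) ∷ Κ (+ 0) ∷ Κ (+ 0) ∷ q₀ ∷ q₁ ∷ q₂ ∷ []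
        from-point = Κ (+ 0) ∷ Κ (+ 0) ∷ Κ (+ 0) ∷ Κ (+ 0) ∷ Κ (+ 0) ∷ Κ (+ 0) ∷ Κ (+ 0) ∷ Κ (+ 0) ∷ Ι (# 8) ∷ Ι (# 9) ∷ Ι (# 10) ∷ []
        q-only : ∀ k → k ℕ.≤ 4 → norm (squareC k [ only-q ]) ≡ norm (squareC k)
        q-only 0 _ = refl
        q-only 1 _ = refl
        q-only 2 _ = refl
        q-only 3 _ = refl
        q-only 4 _ = refl
        q-only (suc (suc (suc (suc (suc _))))) (ℕ.s≤s (ℕ.s≤s (ℕ.s≤s (ℕ.s≤s ()))))
        quotient : ∀ k → k ℕ.≤ 4 → norm (fC k :- squareC k [ from-point ]) ≡ norm (pC k :* Κ (+ 4))
        quotient 0 _ = refl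
        quotient 1 _ = refl
        quotient 2 _ = refl
        quotient 3 _ = refl
        quotient 4 _ = refl
        quotient (suc (suc (suc (suc (suc _))))) (ℕ.s≤s (ℕ.s≤s (ℕ.s≤s (ℕ.s≤s ()))))

      reduced : Reduced ℓ (⟦ leads (+ αₙ) (+ wₙ) (+ w′ₙ) ⟧* ρ)
      -- Substituting into `ρ` its own leading coefficients gives back `ρ` by computation, so the
      -- four fields fit as they stand.
      reduced = record { defects = defects ; size = size ; nonsquare = nonsquare ; nonsquare′ = nonsquare′ }

      absurd : ¬ 2 ℕ.∣ ℓ → ⊥
      absurd odd = leads-absurd prime odd αₙ wₙ w′ₙ leads≡4 ρ reduced

open import Defs
open import Data.Integer using (0ℤ; 1ℤ)
open import Data.Rational using (∣_∣)

theorem4 : (p : Vec ℤ 7) (q : Vec ℤ 4) →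
    lookup p (# 6) ≡ 0ℤ → lookup p (# 5) ≡ 1ℤ → lookup q (# 3) ≡ 0ℤ →
    Δ (fromℤ p q) ≢ 0ℚ →
    ExactlyTwoRatWP (fromℤ p q) →
    HasQuadraticWP (fromℤ p q) →
    GloballyMinimal (fromℤ p q) →
    ¬ (Σ ℕ λ ℓ → Prime ℓ × ¬ (ℓ ≡ 2) × ∣ Δ (fromℤ p q) ∣ ≡ ℕ→ℚ ℓ)
theorem4 p q p₆ p₅ q₃ _ two quadratic _ (ℓ , ℓ-prime , ℓ≢2 , |Δ|≡ℓ) = go p q refl refl p₆ p₅ q₃
  where
  open Reduction
  open GaussLemma using (_Expands_)
  -- Matching is done on copies of the vectors, so that the equation for Δ is left as it is and gets
  -- transported along `E≡` later.
  go : ∀ p′ q′ → p ≡ p′ → q ≡ q′ → lookup p′ (# 6) ≡ 0ℤ → lookup p′ (# 5) ≡ 1ℤ → lookup q′ (# 3) ≡ 0ℤ → ⊥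
  go (a₀ ∷ a₁ ∷ a₂ ∷ a₃ ∷ a₄ ∷ _ ∷ _ ∷ []) (c₀ ∷ c₁ ∷ c₂ ∷ _ ∷ []) p≡ q≡ refl refl refl =
    contradict (integral-factorisation a₀ a₁ a₂ a₃ a₄ c₀ c₁ c₂ (Unique.root two′) (quadratic-factor (subst HasQuadraticWP E≡ quadratic)))
    where
    open WeierstrassPoints.Points a₀ a₁ a₂ a₃ a₄ c₀ c₁ c₂
    E≡ : fromℤ p q ≡ E
    E≡ = cong₂ fromℤ p≡ q≡
    two′ : ExactlyTwoRatWP E
    two′ = subst ExactlyTwoRatWP E≡ two
    contradict : (∃ λ ψ → ψ Expands FZ a₀ a₁ a₂ a₃ a₄ c₀ c₁ c₂) → ⊥
    contradict (ψ , expands) =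
      FromFactors.absurd a₀ a₁ a₂ a₃ a₄ c₀ c₁ c₂ two′ ψ expands ℓ-prime (fromℤ p q) E≡ |Δ|≡ℓ (TwoAdic.odd-prime ℓ-prime ℓ≢2)
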